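{- Let $\pi,\pi'$ be two tree degree sequences of the same length $n$ with $\pi\lhd_w\pi'$, and let $T_\pi^*$, $T_{\pi'}^*$ be the greedy trees with degree sequences $\pi$ and $\pi'$. Then for every integer $k\ge 0$, $$C(k;T_\pi^*)\lhd_w C(k;T_{\pi'}^*).$$ In other words, if $0\le r\le n$ and $U_\pi^*$ and $U_{\pi'}^*$ are the sets of the first $r$ vertices of $T_\pi^*$ and $T_{\pi'}^*$, respectively, in their BFS-orderings, then $$\sum_{v\in U_\pi^*}C_v(k;T_\pi^*)\le\sum_{v\in U_{\pi'}^*}C_v(k;T_{\pi'}^*).$$
   Context: Graphs are finite and simple. For a vertex $v$ of a graph $G$ and an integer $k\ge 0$, $C_v(k;G)$ is the number of closed walks of length $k$ in $G$ starting at $v$, i.e. sequences $w_1,\dots,w_{k+1}$ of vertices with consecutive ones adjacent and $w_1=w_{k+1}=v$; $C(k;G)=(C_v(k;G))_{v\in V(G)}$. A tree degree sequence is a nonincreasing sequence of nonnegative integers that is the degree sequence of some tree. Weak majorization: for nonnegative sequences $\alpha=(x_0,\dots,x_{n-1})$, $\beta=(y_0,\dots,y_{n-1})$ of the same length with nonincreasing rearrangements $x_{[0]}\ge\dots\ge x_{[n-1]}$ and $y_{[0]}\ge\dots\ge y_{[n-1]}$, write $\alpha\lhd_w\beta$ if $\sum_{i=0}^t x_{[i]}\le\sum_{i=0}^t y_{[i]}$ for all $t=0,\dots,n-1$. Greedy tree: in a rooted tree, the height (level) $h(v)$ of a vertex is its distance to the root, and $f(v)$ denotes the father of a non-root vertex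 $v$. A BFS-ordering is a total ordering $\prec$ of the vertices such that vertices of smaller level come before vertices of larger level and, for all $u\prec v$ in the same level: (1) $d(u)\ge d(v)$; (2) if $u,v$ are not roots, then $f(u)=f(v)$ or $f(u)\prec f(v)$. A greedy tree is a rooted tree (one root) admitting a BFS-ordering and such that every degree of a vertex at level $i$ is at least every degree of a vertex at level $i+1$, for all $i$. For each tree degree sequence $\pi$ there is exactly one (up to isomorphism) greedy tree with degree sequence $\pi$, denoted $T_\pi^*$. -}

module Defs where

open import Data.Fin.Base using (Fin; toℕ)
open import Data.Fin.Properties using (_≟_)
open import Data.List.Base as List using (List; allFin; cartesianProductWith; filter; length; map; take)
import Data.List.Sort as Sort
open import Data.List.Relation.Binary.Permutation.Propositional using (_↭_)
open import Data.Nat.Base using (ℕ; zero; suc; _+_; _≤_; _≥_; _<_; NonZero)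
open import Data.Nat.ListAction using (sum)
open import Data.Nat.Properties using (≤-decTotalOrder; _<?_)
open import Data.Product.Base using (Σ-syntax; ∃-syntax; _×_)
open import Data.Sum.Base using (_⊎_)
open import Data.Vec.Base as Vec using (Vec; []; _∷_; head; last; tabulate; toList)
open import Data.Vec.Relation.Unary.Linked using (Linked; linked?)
open import Data.Vec.Relation.Unary.Unique.Propositional using (Unique)
open import Level using (0ℓ)
open import Relation.Binary.Core using (Rel)
open import Relation.Binary.Definitions using (Symmetric; Irreflexive; Decidable)
open import Relation.Binary.Structures using (IsStrictTotalOrder)
import Relation.Binary.Construct.Flip.EqAndOrd as Flip
open import Relation.Binary.PropositionalEquality.Core using (_≡_)
open import Relation.Nullary.Decidable.Core using (Dec; _×-dec_)
open import Relation.Nullary.Negation.Core using (¬_)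

sort↓ : List ℕ → List ℕ
sort↓ = Sort.sort (Flip.decTotalOrder ≤-decTotalOrder)

infix 4 _⊲w_

_⊲w_ : ∀ {n} → Vec ℕ n → Vec ℕ n → Set
_⊲w_ {n} α β = ∀ (t : Fin n) →
  sum (take (suc (toℕ t)) (sort↓ (toList α))) ≤ sum (take (suc (toℕ t)) (sort↓ (toList β)))

record Graph (n : ℕ) : Set₁ where
  infix 4 _∼_ _∼?_
  field
    _∼_    : Rel (Fin n) 0ℓ
    _∼?_   : Decidable _∼_
    symm   : Symmetric _∼_
    irrefl : Irreflexive _≡_ _∼_

module _ {n : ℕ} (G : Graph n) where
  open Graph G

  -- A walk of length k is a sequence of k + 1 vertices.

  IsWalk : ∀ {k} → Fin n → Fin n → Vec (Fin n) (suc k) → Set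
  IsWalk u v w = Linked _∼_ w × head w ≡ u × last w ≡ v

  isWalk? : ∀ {k} u v (w : Vec (Fin n) (suc k)) → Dec (IsWalk u v w)
  isWalk? u v w = linked? _∼?_ w ×-dec (head w ≟ u) ×-dec (last w ≟ v)

  degree : Fin n → ℕ
  degree v = length (filter (v ∼?_) (allFin n))

  IsConnected : Set
  IsConnected = ∀ u v → ∃[ k ] Σ[ w ∈ Vec (Fin n) (suc k) ] IsWalk u v w

  IsAcyclic : Set
  IsAcyclic = ∀ {m} (w : Vec (Fin n) (3 + m)) → Linked _∼_ w → Unique w → ¬ (last w ∼ head w)

  record IsTree : Set where
    field
      nonEmpty  : NonZero n
      connected : IsConnected
      acyclic   : IsAcyclic

  IsDistance : Fin n → Fin n → ℕ → Set
  IsDistance u v d =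
    (Σ[ w ∈ Vec (Fin n) (suc d) ] IsWalk u v w) ×
    (∀ {k} (w : Vec (Fin n) (suc k)) → IsWalk u v w → d ≤ k)

  HasDegreeSequence : Vec ℕ n → Set
  HasDegreeSequence π = Linked _≥_ π × toList π ↭ map degree (allFin n)

IsTreeDegreeSequence : ∀ {n} → Vec ℕ n → Set₁
IsTreeDegreeSequence {n} π = Σ[ G ∈ Graph n ] IsTree G × HasDegreeSequence G π

-- All sequences of m vertices, each listed exactly once.

sequences : ∀ n m → List (Vec (Fin n) m)
sequences n zero    = List.[ [] ]
sequences n (suc m) = cartesianProductWith _∷_ (allFin n) (sequences n m)

closedWalks : ∀ {n} → ℕ → Graph n → Fin n → ℕ
closedWalks {n} k G v = length (filter (isWalk? G v v) (sequences n (suc k)))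

C : ∀ {n} → ℕ → Graph n → Vec ℕ n
C k G = tabulate (closedWalks k G)

-- The field h carries no extra data: it is determined by h-distance.

record RootedTree (n : ℕ) : Set₁ where
  field
    graph      : Graph n
    isTree     : IsTree graph
    root       : Fin n
    h          : Fin n → ℕ
    h-distance : ∀ v → IsDistance graph root v (h v)

  open Graph graph public

  d : Fin n → ℕ
  d = degree graph

  -- The root has no father; every other vertex has exactly one.

  IsFather : Fin n → Fin n → Set
  IsFather p v = p ∼ v × h v ≡ suc (h p)

module _ {n : ℕ} (T : RootedTree n) where
  open RootedTree T

  record IsBFSOrdering (_≺_ : Rel (Fin n) 0ℓ) : Set where
    field
      isStrictTotalOrder : IsStrictTotalOrder _≡_ _≺_
      level-≺            : ∀ {u v} → h u < h v → u ≺ v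
      degree-≥           : ∀ {u v} → u ≺ v → h u ≡ h v → d u ≥ d v
      father-≼           : ∀ {u v} → u ≺ v → h u ≡ h v →
                           ∀ {p q} → IsFather p u → IsFather q v → p ≡ q ⊎ p ≺ q

    open IsStrictTotalOrder isStrictTotalOrder using () renaming (_<?_ to _≺?_)

    -- v is among the first r vertices iff fewer than r vertices precede it.

    position : Fin n → ℕ
    position v = length (filter (_≺? v) (allFin n))

    firstVertices : ℕ → List (Fin n)
    firstVertices r = filter (λ v → position v <? r) (allFin n)

  record IsGreedy : Set₁ where
    field
      _≺_           : Rel (Fin n) 0ℓ
      isBFSOrdering : IsBFSOrdering _≺_
      level-degree  : ∀ {u v} → h v ≡ suc (h u) → d u ≥ d v

-- Write C_v, D_v for the generating functions of the closed walks at v in the whole tree and in the branch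
-- of v.  Decomposing walks at their visits of the father of v gives, with t = X², D_v = 1 / (1 - t ∑ D_w), the
-- sum being over the children w of v, and C_v = D_v + t D_v² C_f(v).  By duality ∑ μ_v C_v = ∑ D_v E_v, where
-- E_v = μ_v + t ∑ D_w² E_w.
--
-- Passing from π to π′ by transfers of one unit, and each transfer through adjacent entries, it suffices to
-- move one vertex c from the father l + 1 to the father l in a breadth-first numbering.  Only D and E at the
-- ancestors of l and l + 1 change.  On the pairs of corresponding ancestors the old values a, b and the new
-- ones a′, b′ satisfy b′ ≤ a, b′ ≤ b and a + b ≤ a′ + b′ coefficientwise; this relation is stable under sums,
-- products and hence under the recursions, so ∑ D_v E_v increases.  If the two chains of ancestors meet in
-- an edge (the one between the vertices 0 and 1) rather than in a vertex, that edge is cut and restored at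
-- the end.  The same argument, moving a mark instead of a vertex, shows that C_v decreases in the numbering.
module Submission where

open import Defs
open import Algebra.Bundles using (CommutativeSemiring)
import Algebra.Solver.Ring.NaturalCoefficients.Default as SemiringSolver
open import Algebra.Structures using (IsCommutativeSemiring)
open import Data.Bool.Base using (Bool; true; false; if_then_else_)
open import Data.Fin.Base as Fin using (Fin; toℕ; fromℕ<; punchOut)
open import Data.Fin.Permutation using (Permutation; permutation)
import Data.Fin.Properties as Fin
open import Data.List.Base as List
  using (List; []; _∷_; _++_; map; length; filter; allFin; tabulate; take; cartesianProductWith)
open import Data.List.Membership.Propositional using (_∈_)
open import Data.List.Membership.Propositional.Properties using (∈-map⁺; ∈-allFin)
open import Data.List.Membership.Propositional.Properties.WithK using (unique∧set⇒bag)
open import Data.List.Properties using (map-tabulate; tabulate-cong)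
open import Data.List.Relation.Binary.BagAndSetEquality using (∼bag⇒↭)
open import Data.List.Relation.Binary.Equality.Propositional using (≋⇒≡)
open import Data.List.Relation.Binary.Permutation.Propositional using (_↭_; ↭-reflexive; ↭-trans; ↭⇒↭ₛ)
open import Data.List.Relation.Binary.Permutation.Propositional.Properties using (map⁺)
import Data.List.Relation.Unary.AllPairs.Properties as AllPairs
open import Data.List.Relation.Unary.Sorted.TotalOrder.Properties using (AllPairs⇒Sorted; ↗↭↗⇒≋)
import Data.List.Relation.Unary.Unique.Propositional.Properties as Unique
import Data.List.Sort as DataListSort
open import Data.Nat.Base
open import Data.Nat.Induction using (<-rec)
open import Data.Nat.ListAction using (sum)
open import Data.Nat.Properties
open import Data.Nat.Tactic.RingSolver using (solve-∀)
open import Data.Product.Base using (∃-syntax; _×_; _,_; proj₁; proj₂)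
open import Data.Sum.Base using (_⊎_; inj₁; inj₂; [_,_]′)
open import Data.Vec.Base as Vec using (Vec; []; _∷_; _∷ʳ_; head; last; toList)
import Data.Vec.Properties as Vec
open import Data.Vec.Relation.Unary.All as All using (All; []; _∷_)
open import Data.Vec.Relation.Unary.AllPairs using ([]; _∷_)
open import Data.Vec.Relation.Unary.Linked using (Linked; []; [-]; _∷_; linked?)
open import Data.Vec.Relation.Unary.Unique.Propositional using (Unique)
open import Function.Base using (_∘_; id)
open import Function.Bundles using (mk⇔)
open import Function.Definitions using (Injective)
open import Level using (0ℓ)
open import Relation.Binary.Bundles using (TotalOrder; DecTotalOrder)
import Relation.Binary.Construct.Flip.EqAndOrd as Flip
open import Relation.Binary.Core using (Rel)
open import Relation.Binary.Definitions using (tri<; tri≈; tri>)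
open import Relation.Binary.PropositionalEquality
import Relation.Binary.Reasoning.Setoid as SetoidReasoning
open import Relation.Binary.Structures using (IsStrictTotalOrder)
open import Relation.Nullary.Decidable using (dec-true; dec-false)
open import Relation.Nullary.Decidable.Core using (Dec; yes; no; does; _×-dec_)
open import Relation.Nullary.Negation.Core using (¬_; contradiction)
open import Relation.Unary using (Decidable; Pred)
open import Algebra.Properties.CommutativeMonoid.Sum +-0-commutativeMonoid
  using (sum-cong-≗; sum-permute; ∑-distrib-+) renaming (sum to ∑ᶠ)

-- Neighbours `m`, `suc m` in a breadth-first numbering are siblings, or have neighbouring fathers,
-- or are 0 and 1. So the ancestors of `l` and `suc l` again come in neighbouring pairs. The
-- relation on a pair passes to the fathers only because the remaining children on the left
-- outnumber and dominate those on the right; hence unchanged vertices must be known to carry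
-- nonincreasing values, and this is carried along in an induction that runs over coefficients, not
-- over the tree. At the pair 0, 1 the branch of 0 contains that of 1, so the two are not comparable
-- in this way. Cutting the edge makes the branches disjoint and leaves every vertex with (degree -
-- 1) children, which is the reason for coding a tree by these numbers. Restoring the edge brings in
-- the product of the two root series, and spreading a pair of numbers does not increase their
-- product; here the special form of the series as resolvents is needed. All coefficients are
-- natural numbers, so inverses and logarithms appear only through the equations that resolvents
-- satisfy.

+-interchange : ∀ a b c d → a + b + (c + d) ≡ a + c + (b + d)
+-interchange = solve-∀

-- Formal power series with natural coefficients

Series : Set
Series = ℕ → ℕ

infixl 6 _⊕_
infixl 7 _⊛_

0s 1s X : Series
0s _ = 0
1s zero = 1
1s (suc _) = 0
X 1 = 1
X _ = 0

_⊕_ _⊛_ : Series → Series → Series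
(f ⊕ g) k = f k + g k
(f ⊛ g) zero = f 0 * g 0
(f ⊛ g) (suc k) = f 0 * g (suc k) + ((λ i → f (suc i)) ⊛ g) k

-- Coefficient `k` of a product sees only coefficients up to `k`. Together with the shift caused by
-- a factor `t`, this makes all recursions below well founded in the coefficient.
⊛-cong-≤ : ∀ k {f f′ g g′ : Series} → (∀ j → j ≤ k → f j ≡ f′ j) → (∀ j → j ≤ k → g j ≡ g′ j) →
  (f ⊛ g) k ≡ (f′ ⊛ g′) k
⊛-cong-≤ zero p q = cong₂ _*_ (p 0 z≤n) (q 0 z≤n)
⊛-cong-≤ (suc k) p q = cong₂ _+_ (cong₂ _*_ (p 0 z≤n) (q (suc k) ≤-refl))
  (⊛-cong-≤ k (λ j j≤k → p (suc j) (s≤s j≤k)) (λ j j≤k → q j (m≤n⇒m≤1+n j≤k)))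

⊛-cong : ∀ {f f′ g g′} → f ≗ f′ → g ≗ g′ → f ⊛ g ≗ f′ ⊛ g′
⊛-cong p q k = ⊛-cong-≤ k (λ j _ → p j) (λ j _ → q j)

⊛-mono-≤ : ∀ k {f f′ g g′ : Series} → (∀ j → j ≤ k → f j ≤ f′ j) → (∀ j → j ≤ k → g j ≤ g′ j) →
  (f ⊛ g) k ≤ (f′ ⊛ g′) k
⊛-mono-≤ zero p q = *-mono-≤ (p 0 z≤n) (q 0 z≤n)
⊛-mono-≤ (suc k) p q = +-mono-≤ (*-mono-≤ (p 0 z≤n) (q (suc k) ≤-refl))
  (⊛-mono-≤ k (λ j j≤k → p (suc j) (s≤s j≤k)) (λ j j≤k → q j (m≤n⇒m≤1+n j≤k)))

⊛-zeroˡ : ∀ g → 0s ⊛ g ≗ 0s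
⊛-zeroˡ g zero = refl
⊛-zeroˡ g (suc k) = ⊛-zeroˡ g k

⊛-identityˡ : ∀ g → 1s ⊛ g ≗ g
⊛-identityˡ g zero = +-identityʳ _
⊛-identityˡ g (suc k) = trans (cong₂ _+_ (+-identityʳ (g (suc k))) (⊛-zeroˡ g k)) (+-identityʳ _)

⊛-distribʳ : ∀ h f g → (f ⊕ g) ⊛ h ≗ (f ⊛ h) ⊕ (g ⊛ h)
⊛-distribʳ h f g zero = *-distribʳ-+ (h 0) (f 0) (g 0)
⊛-distribʳ h f g (suc k) = trans
  (cong₂ _+_ (*-distribʳ-+ (h (suc k)) (f 0) (g 0)) (⊛-distribʳ h (λ i → f (suc i)) (λ i → g (suc i)) k))
  (+-interchange (f 0 * h (suc k)) (g 0 * h (suc k)) _ _)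

⊛-scaleˡ : ∀ c f g k → ((λ i → c * f i) ⊛ g) k ≡ c * (f ⊛ g) k
⊛-scaleˡ c f g zero = *-assoc c (f 0) (g 0)
⊛-scaleˡ c f g (suc k) = trans
  (cong₂ _+_ (*-assoc c (f 0) (g (suc k))) (⊛-scaleˡ c (λ i → f (suc i)) g k))
  (sym (*-distribˡ-+ c (f 0 * g (suc k)) _))

⊛-sucʳ : ∀ f g k → (f ⊛ g) (suc k) ≡ f (suc k) * g 0 + (f ⊛ (λ i → g (suc i))) k
⊛-sucʳ f g zero = +-comm (f 0 * g 1) (f 1 * g 0)
⊛-sucʳ f g (suc k) = trans
  (cong (f 0 * g (suc (suc k)) +_) (⊛-sucʳ (λ i → f (suc i)) g k))
  (rotate (f 0 * g (suc (suc k))) (f (suc (suc k)) * g 0) _)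
  where
  rotate : ∀ a b c → a + (b + c) ≡ b + (a + c)
  rotate = solve-∀

⊛-comm : ∀ f g → f ⊛ g ≗ g ⊛ f
⊛-comm f g zero = *-comm (f 0) (g 0)
⊛-comm f g (suc k) = trans
  (cong₂ _+_ (*-comm (f 0) (g (suc k))) (⊛-comm (λ i → f (suc i)) g k))
  (sym (⊛-sucʳ g f k))

⊛-assoc : ∀ f g h → (f ⊛ g) ⊛ h ≗ f ⊛ (g ⊛ h)
⊛-assoc f g h zero = *-assoc (f 0) (g 0) (h 0)
⊛-assoc f g h (suc k) = begin
  f 0 * g 0 * h (suc k) + (((λ i → f 0 * g (suc i)) ⊕ (tf ⊛ g)) ⊛ h) k
    ≡⟨ cong₂ _+_ (*-assoc (f 0) (g 0) _) (⊛-distribʳ h (λ i → f 0 * g (suc i)) (tf ⊛ g) k) ⟩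
  f 0 * (g 0 * h (suc k)) + (((λ i → f 0 * g (suc i)) ⊛ h) k + ((tf ⊛ g) ⊛ h) k)
    ≡⟨ cong (f 0 * (g 0 * h (suc k)) +_) (cong₂ _+_ (⊛-scaleˡ (f 0) (λ i → g (suc i)) h k) (⊛-assoc tf g h k)) ⟩
  f 0 * (g 0 * h (suc k)) + (f 0 * ((λ i → g (suc i)) ⊛ h) k + (tf ⊛ (g ⊛ h)) k)
    ≡⟨ collect (f 0) (g 0 * h (suc k)) _ _ ⟩
  f 0 * (g 0 * h (suc k) + ((λ i → g (suc i)) ⊛ h) k) + (tf ⊛ (g ⊛ h)) k ∎
  where
  open ≡-Reasoning
  tf : Series
  tf i = f (suc i)
  collect : ∀ a b c d → a * b + (a * c + d) ≡ a * (b + c) + d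
  collect = solve-∀

⊛-⊕-isCommutativeSemiring : IsCommutativeSemiring _≗_ _⊕_ _⊛_ 0s 1s
⊛-⊕-isCommutativeSemiring = record
  { isSemiring = record
    { isSemiringWithoutAnnihilatingZero = record
      { +-isCommutativeMonoid = record
        { isMonoid = record
          { isSemigroup = record
            { isMagma = record
              { isEquivalence = record
                { refl = λ _ → refl ; sym = λ p k → sym (p k) ; trans = λ p q k → trans (p k) (q k) }
              ; ∙-cong = λ p q k → cong₂ _+_ (p k) (q k) }
            ; assoc = λ f g h k → +-assoc (f k) (g k) (h k) }
          ; identity = (λ _ _ → refl) , (λ f k → +-identityʳ (f k)) }
        ; comm = λ f g k → +-comm (f k) (g k) }
      ; *-cong = ⊛-cong
      ; *-assoc = ⊛-assoc
      ; *-identity = ⊛-identityˡ , (λ g k → trans (⊛-comm g 1s k) (⊛-identityˡ g k))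
      ; distrib = (λ f g h k → trans (⊛-comm f (g ⊕ h) k) (trans (⊛-distribʳ f g h k)
                     (cong₂ _+_ (⊛-comm g f k) (⊛-comm h f k))))
                , ⊛-distribʳ }
    ; zero = ⊛-zeroˡ , (λ g k → trans (⊛-comm g 0s k) (⊛-zeroˡ g k)) }
  ; *-comm = ⊛-comm }

seriesSemiring : CommutativeSemiring 0ℓ 0ℓ
seriesSemiring = record { isCommutativeSemiring = ⊛-⊕-isCommutativeSemiring }

private
  module SS = SemiringSolver seriesSemiring
  module S = CommutativeSemiring seriesSemiring
open SS using (_:+_; _:*_; _:=_; con)

t : Series
t = X ⊛ X

X-⊛-suc : ∀ f k → (X ⊛ f) (suc k) ≡ f k
X-⊛-suc f zero = +-identityʳ (f 0)
X-⊛-suc f (suc k) = trans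
  (⊛-cong-≤ (suc k) {λ i → X (suc i)} {1s} {f} (λ { zero _ → refl ; (suc _) _ → refl }) (λ _ _ → refl))
  (⊛-identityˡ f (suc k))

t-⊛-1 : ∀ f → (t ⊛ f) 1 ≡ 0
t-⊛-1 f = trans (⊛-assoc X X f 1) (X-⊛-suc (X ⊛ f) 0)

t-⊛-suc² : ∀ f k → (t ⊛ f) (suc (suc k)) ≡ f k
t-⊛-suc² f k = trans (⊛-assoc X X f (suc (suc k))) (trans (X-⊛-suc (X ⊛ f) (suc k)) (X-⊛-suc f k))

⊕-cancelʳ : ∀ {f g} h → f ⊕ h ≗ g ⊕ h → f ≗ g
⊕-cancelʳ h p k = +-cancelʳ-≡ (h k) _ _ (p k)

module Series≗ = SetoidReasoning S.setoid

-- Both sides of D ⊛ Y = D ⊛ (Y + t S Z) = (1 + t S D) ⊛ Z are expanded and t S D Z is cancelled.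
resolvent-unique : ∀ {D S Y Z} → D ≗ 1s ⊕ t ⊛ (S ⊛ D) → Z ≗ Y ⊕ t ⊛ (S ⊛ Z) → Z ≗ D ⊛ Y
resolvent-unique {D} {S} {Y} {Z} eD eZ = ⊕-cancelʳ (t ⊛ (S ⊛ (D ⊛ Z))) (begin
  Z ⊕ t ⊛ (S ⊛ (D ⊛ Z))
    ≈⟨ SS.solve 4 (λ t S D Z → Z :+ t :* (S :* (D :* Z)) := (con 1 :+ t :* (S :* D)) :* Z) S.refl t S D Z ⟩
  (1s ⊕ t ⊛ (S ⊛ D)) ⊛ Z
    ≈⟨ ⊛-cong (S.sym eD) S.refl ⟩
  D ⊛ Z
    ≈⟨ ⊛-cong {D} (λ _ → refl) eZ ⟩
  D ⊛ (Y ⊕ t ⊛ (S ⊛ Z))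
    ≈⟨ SS.solve 5 (λ t S D Y Z → D :* (Y :+ t :* (S :* Z)) := D :* Y :+ t :* (S :* (D :* Z))) S.refl t S D Y Z ⟩
  D ⊛ Y ⊕ t ⊛ (S ⊛ (D ⊛ Z)) ∎)
  where open Series≗

resolvent-difference : ∀ {A B b s} → A ≗ 1s ⊕ t ⊛ ((b ⊕ s) ⊛ A) → B ≗ 1s ⊕ t ⊛ (b ⊛ B) →
  A ≗ B ⊕ t ⊛ (s ⊛ (A ⊛ B))
resolvent-difference {A} {B} {b} {s} eA eB = begin
  A
    ≈⟨ resolvent-unique {B} {b} {1s ⊕ t ⊛ (s ⊛ A)} {A} eB (S.trans eA
         (SS.solve 4 (λ t A b s → con 1 :+ t :* ((b :+ s) :* A) := con 1 :+ t :* (s :* A) :+ t :* (b :* A))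
            S.refl t A b s)) ⟩
  B ⊛ (1s ⊕ t ⊛ (s ⊛ A))
    ≈⟨ SS.solve 4 (λ t A B s → B :* (con 1 :+ t :* (s :* A)) := B :+ t :* (s :* (A :* B))) S.refl t A B s ⟩
  B ⊕ t ⊛ (s ⊛ (A ⊛ B)) ∎
  where open Series≗

t-⊛-cong-< : ∀ k {f g} → (∀ j → j < k → f j ≡ g j) → (t ⊛ f) k ≡ (t ⊛ g) k
t-⊛-cong-< 0 p = refl
t-⊛-cong-< 1 {f} {g} p = trans (t-⊛-1 f) (sym (t-⊛-1 g))
t-⊛-cong-< (suc (suc k)) {f} {g} p =
  trans (t-⊛-suc² f k) (trans (p k (m≤n⇒m≤1+n ≤-refl)) (sym (t-⊛-suc² g k)))

-- Causal systems of series and their solutions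

-- A contraction in the X-adic sense: each application of `Op` settles one more coefficient of every
-- series, so coefficient `j` can be read off after `suc j` iterations from 0.
module Fixpoint (Op : (ℕ → Series) → (ℕ → Series))
  (causal : ∀ k {F G} → (∀ y j → j < k → F y j ≡ G y j) → ∀ y j → j ≤ k → Op F y j ≡ Op G y j) where

  approx : ℕ → ℕ → Series
  approx zero _ = 0s
  approx (suc m) = Op (approx m)

  approx-stable : ∀ m y j → j < m → approx m y j ≡ approx (suc m) y j
  approx-stable (suc m) y j (s≤s j≤m) = causal m (approx-stable m) y j j≤m

  fix : ℕ → Series
  fix y j = approx (suc j) y j

  approx-fix : ∀ m y j → j < m → approx m y j ≡ fix y j
  approx-fix (suc m) y j (s≤s j≤m) with m≤n⇒m<n∨m≡n j≤m
  ... | inj₁ j<m = trans (sym (approx-stable m y j j<m)) (approx-fix m y j j<m)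
  ... | inj₂ refl = refl

  fix-eq : ∀ y → fix y ≗ Op fix y
  fix-eq y k = causal k (λ y j → approx-fix k y j) y k ≤-refl

RowOp : Set
RowOp = (ℕ → ℕ) → ℕ → ℕ

lift : RowOp → (ℕ → Series) → ℕ → Series
lift L F y k = L (λ x → F x k) y

-- D y is the generating function of the closed walks at y inside the branch of y.  If ε μ x is added to
-- t ⊛ lift L D x for every x, then E y is the derivative of -1 / D y at ε = 0.
record Solution (L : RowOp) (μ : ℕ → Series) : Set where
  field
    D E  : ℕ → Series
    D-eq : ∀ y → D y ≗ 1s ⊕ t ⊛ (lift L D y ⊛ D y)
    E-eq : ∀ y → E y ≗ μ y ⊕ t ⊛ lift L (λ x → D x ⊛ D x ⊛ E x) y

Extensional : RowOp → Set
Extensional L = ∀ {a b} → (∀ x → a x ≡ b x) → ∀ y → L a y ≡ L b y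

-- Every recursive occurrence stands behind a factor `t`, so both systems are causal; `E` is solved
-- with `D` already fixed. The row operator is arbitrary, which covers the cut tree and the codes
-- between two transfers as well as the greedy trees.
solution : ∀ L μ → Extensional L → Solution L μ
solution L μ ext = record { D = D ; E = E ; D-eq = D-eq ; E-eq = E-eq }
  where
  open Fixpoint (λ F y → 1s ⊕ t ⊛ (lift L F y ⊛ F y))
    (λ k {F} {G} p y j j≤k → cong (1s j +_) (t-⊛-cong-< j λ i i<j → ⊛-cong-≤ i
      (λ l l≤i → ext (λ x → p x l (<-≤-trans (≤-<-trans l≤i i<j) j≤k)) y)
      (λ l l≤i → p y l (<-≤-trans (≤-<-trans l≤i i<j) j≤k))))
    renaming (fix to D; fix-eq to D-eq)
  open Fixpoint (λ F y → μ y ⊕ t ⊛ lift L (λ x → D x ⊛ D x ⊛ F x) y)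
    (λ k {F} {G} p y j j≤k → cong (μ y j +_) (t-⊛-cong-< j λ i i<j → ext (λ x → ⊛-cong-≤ i
      (λ _ _ → refl) (λ l l≤i → p x l (<-≤-trans (≤-<-trans l≤i i<j) j≤k))) y))
    renaming (fix to E; fix-eq to E-eq)

-- Finite sums, and spreading of pairs

∑ : ℕ → (ℕ → ℕ) → ℕ
∑ zero g = 0
∑ (suc m) g = ∑ m g + g m

∑-cong : ∀ m {f g} → (∀ j → j < m → f j ≡ g j) → ∑ m f ≡ ∑ m g
∑-cong zero p = refl
∑-cong (suc m) p = cong₂ _+_ (∑-cong m (λ j j<m → p j (m≤n⇒m≤1+n j<m))) (p m ≤-refl)

∑-mono-≤ : ∀ {m n} {f g} → m ≤ n → (∀ j → j < m → f j ≤ g j) → ∑ m f ≤ ∑ n g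
∑-mono-≤ {zero} _ p = z≤n
∑-mono-≤ {suc m} {suc n} {f} {g} (s≤s m≤n) p with m≤n⇒m<n∨m≡n m≤n
... | inj₁ m<n = ≤-trans (∑-mono-≤ m<n p) (m≤m+n (∑ n g) (g n))
... | inj₂ refl = +-mono-≤ (∑-mono-≤ {m} ≤-refl (λ j j<m → p j (m≤n⇒m≤1+n j<m))) (p m ≤-refl)

∑-suc : ∀ m f → ∑ (suc m) f ≡ f 0 + ∑ m (f ∘ suc)
∑-suc zero f = +-comm 0 (f 0)
∑-suc (suc m) f = trans (cong (_+ f (suc m)) (∑-suc m f)) (+-assoc (f 0) _ _)

-- A term that may drop is compensated by its predecessor. The induction runs from the last term
-- downwards, so that such a pair is removed as a whole.
∑-mono-paired : ∀ m {f g} →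
  (∀ j → j < m → f j ≤ g j ⊎ ∃[ i ] (j ≡ suc i × f i + f j ≤ g i + g j)) → ∑ m f ≤ ∑ m g
∑-mono-paired zero p = z≤n
∑-mono-paired (suc m) p with p m ≤-refl
... | inj₁ fm≤gm = +-mono-≤ (∑-mono-paired m (λ j j<m → p j (m≤n⇒m≤1+n j<m))) fm≤gm
∑-mono-paired (suc (suc m)) {f} {g} p | inj₂ (_ , refl , f+f≤g+g) =
  subst₂ _≤_ (sym (+-assoc (∑ m f) _ _)) (sym (+-assoc (∑ m g) _ _))
    (+-mono-≤ (∑-mono-paired m (λ j j<m → p j (m≤n⇒m≤1+n (m≤n⇒m≤1+n j<m)))) f+f≤g+g)

single : ℕ → ℕ → ℕ → ℕ
single v d y = if does (v ≟ y) then d else 0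

single-≡ : ∀ v d → single v d v ≡ d
single-≡ v d rewrite dec-true (v ≟ v) refl = refl

single-≢ : ∀ {v y} d → v ≢ y → single v d y ≡ 0
single-≢ {v} {y} d v≢y rewrite dec-false (v ≟ y) v≢y = refl

-- A strong form of weak majorization of the pair `a`, `b` by `a′`, `b′`: the bound on the sums
-- combined with `b′≤b` gives `a ≤ a′`, and combined with `b′≤a` it gives `b ≤ a′`. The sum may
-- grow, as it does under products.
record Spread (a′ b′ a b : ℕ) : Set where
  constructor spread
  field
    b′≤a : b′ ≤ a
    b′≤b : b′ ≤ b
    sum≤ : a + b ≤ a′ + b′
open Spread

spread-≤ : ∀ {a b} → b ≤ a → Spread a b a b
spread-≤ b≤a = spread b≤a ≤-refl ≤-refl

spread-resp : ∀ {a b c d a₁ b₁ c₁ d₁} → a ≡ a₁ → b ≡ b₁ → c ≡ c₁ → d ≡ d₁ →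
  Spread a₁ b₁ c₁ d₁ → Spread a b c d
spread-resp refl refl refl refl s = s

spread-+ : ∀ {a′ b′ a b c′ d′ c d} → Spread a′ b′ a b → Spread c′ d′ c d →
  Spread (a′ + c′) (b′ + d′) (a + c) (b + d)
spread-+ {a′} {b′} {a} {b} {c′} {d′} {c} {d} p q = spread
  (+-mono-≤ (b′≤a p) (b′≤a q)) (+-mono-≤ (b′≤b p) (b′≤b q))
  (subst₂ _≤_ (+-interchange a b c d) (+-interchange a′ b′ c′ d′) (+-mono-≤ (sum≤ p) (sum≤ q)))

-- Write `β`, `δ` for the new smaller entries, `s`, `r` and `σ`, `ρ` for the excesses of the old
-- entries over them. Then `a′ ≥ β + s + r` and `c′ ≥ δ + σ + ρ`, and the cross terms
-- `s * ρ + r * σ` are the slack in the sum.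
spread-* : ∀ {a′ b′ a b c′ d′ c d} → Spread a′ b′ a b → Spread c′ d′ c d →
  Spread (a′ * c′) (b′ * d′) (a * c) (b * d)
spread-* {a′} {β} {c′ = c′} {δ} (spread β≤a β≤b a+b≤) (spread δ≤c δ≤d c+d≤)
  with m≤n⇒∃[o]m+o≡n β≤a | m≤n⇒∃[o]m+o≡n β≤b | m≤n⇒∃[o]m+o≡n δ≤c | m≤n⇒∃[o]m+o≡n δ≤d
... | s , refl | r , refl | σ , refl | ρ , refl = spread
  (*-mono-≤ β≤a δ≤c) (*-mono-≤ β≤b δ≤d)
  (≤-trans
    (≤-trans (m≤m+n _ (s * ρ + r * σ)) (≤-reflexive (expand β s r δ σ ρ)))
    (+-monoˡ-≤ (β * δ) (*-mono-≤ (cancel a′ β s r a+b≤) (cancel c′ δ σ ρ c+d≤))))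
  where
  expand : ∀ β s r δ σ ρ → (β + s) * (δ + σ) + (β + r) * (δ + ρ) + (s * ρ + r * σ) ≡
                           (β + s + r) * (δ + σ + ρ) + β * δ
  expand = solve-∀
  regroup : ∀ β s r → β + s + (β + r) ≡ β + s + r + β
  regroup = solve-∀
  cancel : ∀ a β s r → β + s + (β + r) ≤ a + β → β + s + r ≤ a
  cancel a β s r le = +-cancelʳ-≤ β (β + s + r) a (subst (_≤ a + β) (regroup β s r) le)

-- The comparison relation between old and new values

module Dominance (u : ℕ → ℕ) (h : ℕ) where

  -- These are vertices whose branches are not touched. The bound `u h < x` also excludes the common
  -- ancestors of the two chains, whose branches contain both ends of the move; for them only
  -- `other` is available.
  Low : ℕ → Set
  Low x = u h < x × (∀ i → i ≤ h → x ≢ u i × x ≢ suc (u i))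

  -- The pairs (u i , suc (u i)) are the two ends of the moved edge and their successive ancestors.
  record Dom (a a′ : ℕ → ℕ) : Set where
    field
      low-≡    : ∀ {x} → Low x → a x ≡ a′ x
      low-anti : ∀ {x y} → Low x → Low y → x ≤ y → a y ≤ a x
      pair     : ∀ {i} → i ≤ h → Spread (a′ (u i)) (a′ (suc (u i))) (a (u i)) (a (suc (u i)))
      other    : ∀ {y} → (∀ i → i ≤ h → y ≢ suc (u i)) → a y ≤ a′ y
  open Dom public

  dom-antitone : ∀ {a} → (∀ {x y} → x ≤ y → a y ≤ a x) → Dom a a
  dom-antitone anti = record
    { low-≡ = λ _ → refl ; low-anti = λ _ _ → anti ; pair = λ _ → spread-≤ (anti (n≤1+n _)) ; other = λ _ → ≤-refl }

  dom-resp : ∀ {a a′ b b′} → (∀ y → a y ≡ b y) → (∀ y → a′ y ≡ b′ y) → Dom b b′ → Dom a a′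
  dom-resp {a} {a′} {b} {b′} p q d = record
    { low-≡ = λ {x} l → trans (p x) (trans (low-≡ d l) (sym (q x)))
    ; low-anti = λ {x} {y} l l′ x≤y → subst₂ _≤_ (sym (p y)) (sym (p x)) (low-anti d l l′ x≤y)
    ; pair = λ {i} i≤h → spread-resp (q (u i)) (q (suc (u i))) (p (u i)) (p (suc (u i))) (pair d i≤h)
    ; other = λ {y} y≢ → subst₂ _≤_ (sym (p y)) (sym (q y)) (other d y≢) }

  dom-+ : ∀ {a a′ b b′} → Dom a a′ → Dom b b′ → Dom (λ y → a y + b y) (λ y → a′ y + b′ y)
  dom-+ d e = record
    { low-≡ = λ l → cong₂ _+_ (low-≡ d l) (low-≡ e l)
    ; low-anti = λ l l′ x≤y → +-mono-≤ (low-anti d l l′ x≤y) (low-anti e l l′ x≤y)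
    ; pair = λ i≤h → spread-+ (pair d i≤h) (pair e i≤h)
    ; other = λ y≢ → +-mono-≤ (other d y≢) (other e y≢) }

  dom-* : ∀ {a a′ b b′} → Dom a a′ → Dom b b′ → Dom (λ y → a y * b y) (λ y → a′ y * b′ y)
  dom-* d e = record
    { low-≡ = λ l → cong₂ _*_ (low-≡ d l) (low-≡ e l)
    ; low-anti = λ l l′ x≤y → *-mono-≤ (low-anti d l l′ x≤y) (low-anti e l l′ x≤y)
    ; pair = λ i≤h → spread-* (pair d i≤h) (pair e i≤h)
    ; other = λ y≢ → *-mono-≤ (other d y≢) (other e y≢) }

  dom-⊛ : ∀ k {F F′ G G′ : ℕ → Series} →
    (∀ j → j ≤ k → Dom (λ y → F y j) (λ y → F′ y j)) → (∀ j → j ≤ k → Dom (λ y → G y j) (λ y → G′ y j)) →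
    Dom (λ y → (F y ⊛ G y) k) (λ y → (F′ y ⊛ G′ y) k)
  dom-⊛ zero p q = dom-* (p 0 z≤n) (q 0 z≤n)
  dom-⊛ (suc k) p q = dom-+ (dom-* (p 0 z≤n) (q (suc k) ≤-refl))
    (dom-⊛ k (λ j j≤k → p (suc j) (s≤s j≤k)) (λ j j≤k → q j (m≤n⇒m≤1+n j≤k)))

  dom-t⊛ : ∀ k {F F′ : ℕ → Series} → (∀ j → j < k → Dom (λ y → F y j) (λ y → F′ y j)) →
    Dom (λ y → (t ⊛ F y) k) (λ y → (t ⊛ F′ y) k)
  dom-t⊛ 0 p = dom-antitone (λ _ → ≤-refl)
  dom-t⊛ 1 {F} {F′} p = dom-resp (λ y → t-⊛-1 (F y)) (λ y → t-⊛-1 (F′ y)) (dom-antitone (λ _ → ≤-refl))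
  dom-t⊛ (suc (suc k)) {F} {F′} p =
    dom-resp (λ y → t-⊛-suc² (F y) k) (λ y → t-⊛-suc² (F′ y) k) (p k (m≤n⇒m≤1+n ≤-refl))

  -- Only the right member `suc (u i)` of a pair can lose, and its immediate predecessor `u i` makes
  -- up for it.
  dom-∑ : ∀ {a a′} → Dom a a′ → ∀ n → ∑ n a ≤ ∑ n a′
  dom-∑ {a} {a′} d n = ∑-mono-paired n λ j _ → classify j
    where
    classify : ∀ j → a j ≤ a′ j ⊎ ∃[ i ] (j ≡ suc i × a i + a j ≤ a′ i + a′ j)
    classify j with anyUpTo? (λ i → j ≟ suc (u i)) (suc h)
    ... | yes (i , s≤s i≤h , refl) = inj₂ (u i , refl , sum≤ (pair d i≤h))
    ... | no ∄ = inj₁ (other d λ i i≤h j≡ → ∄ (i , s≤s i≤h , j≡))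

  module _ {L L′ : RowOp} {μ μ′ : ℕ → Series} (dom-L : ∀ {a a′} → Dom a a′ → Dom (L a) (L′ a′))
    (dom-μ : ∀ k → Dom (λ y → μ y k) (λ y → μ′ y k)) (S : Solution L μ) (S′ : Solution L′ μ′) where
    private
      module S₁ = Solution S
      module S₂ = Solution S′

    -- Behind the factor `t` only smaller coefficients occur, so strong induction on `k` reduces the
    -- claim to the closure of `Dom` under sums, products and the row operators.
    dom-D : ∀ k → Dom (λ y → S₁.D y k) (λ y → S₂.D y k)
    dom-D = <-rec _ λ k rec → dom-resp (λ y → S₁.D-eq y k) (λ y → S₂.D-eq y k)
      (dom-+ (dom-antitone (λ _ → ≤-refl)) (dom-t⊛ k λ i i<k → dom-⊛ i
        (λ j j≤i → dom-L (rec (≤-<-trans j≤i i<k))) (λ j j≤i → rec (≤-<-trans j≤i i<k))))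

    dom-E : ∀ k → Dom (λ y → S₁.E y k) (λ y → S₂.E y k)
    dom-E = <-rec _ λ k rec → dom-resp (λ y → S₁.E-eq y k) (λ y → S₂.E-eq y k)
      (dom-+ (dom-μ k) (dom-t⊛ k λ i i<k → dom-L (dom-⊛ i
        (λ j _ → dom-⊛ j (λ l _ → dom-D l) (λ l _ → dom-D l)) (λ j j≤i → rec (≤-<-trans j≤i i<k)))))

    dom-DE : ∀ k → Dom (λ y → (S₁.D y ⊛ S₁.E y) k) (λ y → (S₂.D y ⊛ S₂.E y) k)
    dom-DE k = dom-⊛ k (λ j _ → dom-D j) (λ j _ → dom-E j)

-- Rows of children and chains of ancestors

row : (ℕ → ℕ) → (ℕ → ℕ) → RowOp
row start size a y = ∑ (size y) (λ j → a (start y + j))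

-- What the comparison needs from a breadth-first numbering. `disjoint` is an inequality so that a
-- gap may remain between two rows, at the place of the moved vertex; `below` and `meet` concern
-- nonempty rows only because the start of an empty row carries no information.
record Chain (start size : ℕ → ℕ) (u : ℕ → ℕ) (h : ℕ) : Set where
  InRow : ℕ → ℕ → Set
  InRow y x = ∃[ j ] (j < size y × start y + j ≡ x)
  field
    below      : ∀ {y} → 0 < size y → y < start y
    disjoint   : ∀ {y z} → y < z → start y + size y ≤ start z
    size-anti  : ∀ {y z} → y ≤ z → size z ≤ size y
    descending : ∀ {i} → i < h → suc (u (suc i)) < u i
    lastChild  : ∀ {i} → i < h → ∃[ r ] (size (u (suc i)) ≡ suc r × start (u (suc i)) + r ≡ u i)
    firstChild : ∀ {i} → i < h →
                 ∃[ r ] (size (suc (u (suc i))) ≡ suc r × start (suc (u (suc i))) ≡ suc (u i))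
    -- The last pair consists of siblings or of two roots.
    meet       : ∀ {y} → 0 < size y → start y ≢ suc (u h)

module DominanceRow {start size : ℕ → ℕ} {u : ℕ → ℕ} {h : ℕ} (C : Chain start size u h) where
  open Chain C
  open Dominance u h

  inRow-< : ∀ {y x} → InRow y x → y < x
  inRow-< {y} (j , j<m , refl) = <-≤-trans (below (≤-<-trans z≤n j<m)) (m≤m+n (start y) j)

  inRow-mono : ∀ {y z x x′} → InRow y x → InRow z x′ → y < z → x < x′
  inRow-mono {y} {z} (j , j<m , refl) (j′ , _ , refl) y<z =
    <-≤-trans (+-monoʳ-< (start y) j<m) (≤-trans (disjoint y<z) (m≤m+n (start z) j′))

  inRow-unique : ∀ {y z x} → InRow y x → InRow z x → y ≡ z
  inRow-unique {y} {z} p q with <-cmp y z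
  ... | tri< y<z _ _ = contradiction (inRow-mono p q y<z) (<-irrefl refl)
  ... | tri≈ _ y≡z _ = y≡z
  ... | tri> _ _ z<y = contradiction (inRow-mono q p z<y) (<-irrefl refl)

  parent-u : ∀ {i} → i < h → InRow (u (suc i)) (u i)
  parent-u i<h with lastChild i<h
  ... | r , m≡ , s≡ = r , subst (r <_) (sym m≡) ≤-refl , s≡

  parent-suc-u : ∀ {i} → i < h → InRow (suc (u (suc i))) (suc (u i))
  parent-suc-u {i} i<h with firstChild i<h
  ... | r , m≡ , s≡ = 0 , subst (0 <_) (sym m≡) z<s , trans (+-identityʳ _) s≡

  u-< : ∀ {i j} → i < j → j ≤ h → suc (u j) < u i
  u-< {i} {suc j} (s≤s i≤j) j<h with m≤n⇒m<n∨m≡n i≤j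
  ... | inj₁ i<j = <-trans (descending j<h) (<-trans (n<1+n _) (u-< i<j (<⇒≤ j<h)))
  ... | inj₂ refl = descending j<h

  u-≤ : ∀ {i j} → i ≤ j → j ≤ h → u j ≤ u i
  u-≤ i≤j j≤h with m≤n⇒m<n∨m≡n i≤j
  ... | inj₁ i<j = <⇒≤ (<-trans (n<1+n _) (u-< i<j j≤h))
  ... | inj₂ refl = ≤-refl

  u-injective : ∀ {i j} → i ≤ h → j ≤ h → u i ≡ u j → i ≡ j
  u-injective {i} {j} i≤h j≤h eq with <-cmp i j
  ... | tri< i<j _ _ = contradiction (sym eq) (<⇒≢ (<-trans (n<1+n _) (u-< i<j j≤h)))
  ... | tri≈ _ i≡j _ = i≡j
  ... | tri> _ _ j<i = contradiction eq (<⇒≢ (<-trans (n<1+n _) (u-< j<i i≤h)))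

  u≢suc-u : ∀ {i j} → i ≤ h → j ≤ h → u i ≢ suc (u j)
  u≢suc-u {i} {j} i≤h j≤h eq with i <? j
  ... | yes i<j = contradiction (sym eq) (<⇒≢ (u-< i<j j≤h))
  ... | no i≮j = contradiction eq (<⇒≢ (s≤s (u-≤ (≮⇒≥ i≮j) i≤h)))

  parent-of-u : ∀ {y i} → i < h → InRow y (u i) → y ≡ u (suc i)
  parent-of-u i<h p = inRow-unique p (parent-u i<h)

  parent-of-suc-u : ∀ {y i} → i < h → InRow y (suc (u i)) → y ≡ suc (u (suc i))
  parent-of-suc-u i<h p = inRow-unique p (parent-suc-u i<h)

  -- By `meet`, the vertex `suc (u h)` never comes first in its row, so its predecessor `u h` lies
  -- in the same row.
  meet-row : ∀ {y} → InRow y (suc (u h)) → InRow y (u h)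
  meet-row (zero , j<m , eq) = contradiction (trans (sym (+-identityʳ _)) eq) (meet j<m)
  meet-row {y} (suc j , j<m , eq) = j , <-trans (n<1+n j) j<m , suc-injective (trans (sym (+-suc (start y) j)) eq)

  -- Below the top of the chain a member of a pair has the corresponding member of the next pair as
  -- its father, which `q₁` and `q₂` rule out. The members of the top pair have no father from `u h`
  -- on, because fathers precede their children.
  low-child : ∀ {y x} → u h ≤ y → InRow y x →
    (∀ {i} → i < h → y ≡ u (suc i) → x ≢ u i) →
    (∀ {i} → i < h → y ≡ suc (u (suc i)) → x ≢ suc (u i)) → Low x
  low-child {y} {x} uh≤y p q₁ q₂ = ≤-<-trans uh≤y (inRow-< p) , λ i i≤h → left i≤h , right i≤h
    where
    left : ∀ {i} → i ≤ h → x ≢ u i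
    left i≤h refl with m≤n⇒m<n∨m≡n i≤h
    ... | inj₁ i<h = q₁ i<h (parent-of-u i<h p) refl
    ... | inj₂ refl = <⇒≱ (inRow-< p) uh≤y
    right : ∀ {i} → i ≤ h → x ≢ suc (u i)
    right i≤h refl with m≤n⇒m<n∨m≡n i≤h
    ... | inj₁ i<h = q₂ i<h (parent-of-suc-u i<h p) refl
    ... | inj₂ refl = <⇒≱ (inRow-< (meet-row p)) uh≤y

  low-row : ∀ {y j} → Low y → j < size y → Low (start y + j)
  low-row {y} {j} (uh<y , l) j<m = low-child (<⇒≤ uh<y) (j , j<m , refl)
    (λ {i} i<h y≡ → contradiction y≡ (proj₁ (l (suc i) i<h)))
    (λ {i} i<h y≡ → contradiction y≡ (proj₂ (l (suc i) i<h)))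

  low-row-u₀ : ∀ {j} → j < size (u 0) → Low (start (u 0) + j)
  low-row-u₀ {j} j<m = low-child (u-≤ z≤n ≤-refl) (j , j<m , refl)
    (λ i<h y≡ → contradiction (u-injective z≤n i<h y≡) λ ())
    (λ i<h y≡ → contradiction y≡ (u≢suc-u z≤n i<h))

  low-row-suc-u₀ : ∀ {j} → j < size (suc (u 0)) → Low (start (suc (u 0)) + j)
  low-row-suc-u₀ {j} j<m = low-child (m≤n⇒m≤1+n (u-≤ z≤n ≤-refl)) (j , j<m , refl)
    (λ i<h y≡ → contradiction (sym y≡) (u≢suc-u i<h z≤n))
    (λ i<h y≡ → contradiction (u-injective z≤n i<h (suc-injective y≡)) λ ())

  low-row-u : ∀ {i r j} → i < h → size (u (suc i)) ≡ suc r → start (u (suc i)) + r ≡ u i → j < r →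
    Low (start (u (suc i)) + j)
  low-row-u {i} {r} {j} i<h m≡ s≡ j<r = low-child (u-≤ i<h ≤-refl)
    (j , subst (j <_) (sym m≡) (m≤n⇒m≤1+n j<r) , refl)
    (λ k<h y≡ x≡ → <⇒≢ (+-monoʳ-< (start (u (suc i))) j<r)
      (trans x≡ (trans (cong u (suc-injective (sym (u-injective i<h k<h y≡)))) (sym s≡))))
    (λ k<h y≡ → contradiction y≡ (u≢suc-u i<h k<h))

  low-row-suc-u : ∀ {i r j} → i < h → size (suc (u (suc i))) ≡ suc r → start (suc (u (suc i))) ≡ suc (u i) → j < r →
    Low (start (suc (u (suc i))) + suc j)
  low-row-suc-u {i} {r} {j} i<h m≡ s≡ j<r = low-child (m≤n⇒m≤1+n (u-≤ i<h ≤-refl))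
    (suc j , subst (suc j <_) (sym m≡) (s≤s j<r) , refl)
    (λ k<h y≡ → contradiction (sym y≡) (u≢suc-u k<h i<h))
    (λ k<h y≡ x≡ → m+1+n≢m (start (suc (u (suc i)))) (trans x≡
      (trans (cong (suc ∘ u) (suc-injective (sym (u-injective i<h k<h (suc-injective y≡))))) (sym s≡))))

  row-anti : ∀ {a a′ y z} → Dom a a′ → y ≤ z →
    (∀ {j} → j < size y → Low (start y + j)) → (∀ {j} → j < size z → Low (start z + j)) →
    row start size a z ≤ row start size a y
  row-anti {y = y} {z} d y≤z ly lz with m≤n⇒m<n∨m≡n y≤z
  ... | inj₂ refl = ≤-refl
  ... | inj₁ y<z = ∑-mono-≤ (size-anti y≤z) λ j j<m →
    let j<m′ = <-≤-trans j<m (size-anti y≤z) in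
    low-anti d (ly j<m′) (lz j<m)
      (<⇒≤ (inRow-mono (j , j<m′ , refl) (j , j<m , refl) y<z))

  row-low-≡ : ∀ {a a′ y} → Dom a a′ → (∀ {j} → j < size y → Low (start y + j)) →
    row start size a y ≡ row start size a′ y
  row-low-≡ {y = y} d l = ∑-cong (size y) (λ j j<m → low-≡ d (l j<m))

  -- The left row ends with `u i` and the right row begins with `suc (u i)`. The other children are
  -- unchanged; those on the left are at least as many and come earlier, so their sums form a
  -- trivial spread, to which the spread at the pair of children is added.
  row-pair-suc : ∀ {a a′} → Dom a a′ → ∀ {i} → i < h →
    Spread (row start size a′ (u (suc i))) (row start size a′ (suc (u (suc i))))
           (row start size a (u (suc i))) (row start size a (suc (u (suc i))))
  row-pair-suc {a} {a′} d {i} i<h with lastChild i<h | firstChild i<h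
  ... | r , m≡ , s≡ | r′ , m≡′ , s≡′ = spread-resp
    (trans (splitLast a′) (cong (_+ a′ (u i)) (sym (∑-cong r λ j j<r → low-≡ d (low-row-u i<h m≡ s≡ j<r)))))
    (trans (splitFirst a′) (cong (_+ a′ (suc (u i))) (sym (∑-cong r′ λ j j<r → low-≡ d (low-row-suc-u i<h m≡′ s≡′ j<r)))))
    (splitLast a) (splitFirst a)
    (spread-+ (spread-≤ others) (pair d (<⇒≤ i<h)))
    where
    others : ∑ r′ (λ j → a (start (suc (u (suc i))) + suc j)) ≤ ∑ r (λ j → a (start (u (suc i)) + j))
    others = ∑-mono-≤ (s≤s⁻¹ (subst₂ _≤_ m≡′ m≡ (size-anti (n≤1+n _)))) λ j j<r′ →
      let j<r = <-≤-trans j<r′ (s≤s⁻¹ (subst₂ _≤_ m≡′ m≡ (size-anti (n≤1+n _)))) in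
      low-anti d (low-row-u i<h m≡ s≡ j<r) (low-row-suc-u i<h m≡′ s≡′ j<r′)
        (<⇒≤ (inRow-mono (j , subst (j <_) (sym m≡) (m≤n⇒m≤1+n j<r) , refl)
                         (suc j , subst (suc j <_) (sym m≡′) (s≤s j<r′) , refl) (n<1+n _)))
    splitLast : ∀ b → row start size b (u (suc i)) ≡ ∑ r (λ j → b (start (u (suc i)) + j)) + b (u i)
    splitLast b rewrite m≡ | s≡ = refl
    splitFirst : ∀ b → row start size b (suc (u (suc i))) ≡
                       ∑ r′ (λ j → b (start (suc (u (suc i))) + suc j)) + b (suc (u i))
    splitFirst b rewrite m≡′ = trans (∑-suc r′ _)
      (trans (+-comm _ (∑ r′ rest)) (cong (∑ r′ rest +_) (cong b (trans (+-identityʳ _) s≡′))))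
      where
      rest : ℕ → ℕ
      rest j = b (start (suc (u (suc i))) + suc j)

  dom-row : ∀ {a a′} → Dom a a′ → Dom (row start size a) (row start size a′)
  dom-row {a} {a′} d = record
    { low-≡ = λ l → row-low-≡ d (low-row l)
    ; low-anti = λ l l′ x≤y → row-anti d x≤y (low-row l) (low-row l′)
    ; pair = row-pair
    ; other = row-other }
    where
    row-pair : ∀ {i} → i ≤ h →
      Spread (row start size a′ (u i)) (row start size a′ (suc (u i)))
             (row start size a (u i)) (row start size a (suc (u i)))
    row-pair {zero} _ = spread-resp (sym (row-low-≡ d low-row-u₀)) (sym (row-low-≡ d low-row-suc-u₀)) refl refl
      (spread-≤ (row-anti d (n≤1+n _) low-row-u₀ low-row-suc-u₀))
    row-pair {suc i} i<h = row-pair-suc d i<h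

    -- The father of `suc (u i)` with `i < h` is itself a right member and thus excluded. Only
    -- `suc (u h)` can occur in this row, and then `u h` stands directly before it.
    row-other : ∀ {y} → (∀ i → i ≤ h → y ≢ suc (u i)) → row start size a y ≤ row start size a′ y
    row-other {y} y≢ = ∑-mono-paired (size y) classify
      where
      classify : ∀ j → j < size y → a (start y + j) ≤ a′ (start y + j) ⊎
        ∃[ i ] (j ≡ suc i × a (start y + i) + a (start y + j) ≤ a′ (start y + i) + a′ (start y + j))
      classify j j<m with anyUpTo? (λ i → start y + j ≟ suc (u i)) (suc h)
      ... | no ∄ = inj₁ (other d λ i i≤h x≡ → ∄ (i , s≤s i≤h , x≡))
      ... | yes (i , s≤s i≤h , x≡) with m≤n⇒m<n∨m≡n i≤h
      ...   | inj₁ i<h = contradiction (parent-of-suc-u i<h (j , j<m , x≡)) (y≢ (suc i) i<h)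
      ...   | inj₂ refl with j
      ...     | zero = contradiction (trans (sym (+-identityʳ _)) x≡) (meet j<m)
      ...     | suc j′ = inj₂ (j′ , refl , subst₂ (λ v w → a v + a w ≤ a′ v + a′ w)
                  (sym (suc-injective (trans (sym (+-suc (start y) j′)) x≡))) (sym x≡) (Spread.sum≤ (pair d i≤h)))

  low≢u₀ : ∀ {x} → Low x → u 0 ≢ x
  low≢u₀ l eq = proj₁ (proj₂ l 0 z≤n) (sym eq)

  low≢suc-u₀ : ∀ {x} → Low x → suc (u 0) ≢ x
  low≢suc-u₀ l eq = proj₂ (proj₂ l 0 z≤n) (sym eq)

  -- The move itself: at the bottom pair the values `0`, `c` spread to `c`, `0`. The weight is the
  -- series of the moved vertex in one application and a mark in the other.
  dom-single : ∀ {c c′} → c ≡ c′ → Dom (single (suc (u 0)) c) (single (u 0) c′)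
  dom-single {c} refl = record
    { low-≡ = λ l → trans (single-≢ c (low≢suc-u₀ l)) (sym (single-≢ c (low≢u₀ l)))
    ; low-anti = λ _ l _ → ≤-trans (≤-reflexive (single-≢ c (low≢suc-u₀ l))) z≤n
    ; pair = single-pair
    ; other = λ y≢ → ≤-trans (≤-reflexive (single-≢ c (y≢ 0 z≤n ∘ sym))) z≤n }
    where
    single-pair : ∀ {i} → i ≤ h → Spread (single (u 0) c (u i)) (single (u 0) c (suc (u i)))
                                         (single (suc (u 0)) c (u i)) (single (suc (u 0)) c (suc (u i)))
    single-pair {zero} _ = spread-resp (single-≡ (u 0) c) (single-≢ {u 0} {suc (u 0)} c (1+n≢n ∘ sym)) (single-≢ {suc (u 0)} {u 0} c 1+n≢n)
      (single-≡ (suc (u 0)) c) (spread z≤n z≤n (≤-reflexive (sym (+-identityʳ c))))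
    single-pair {suc i} i<h = spread-resp (single-≢ c λ eq → 1+n≢0 (sym (u-injective z≤n i<h eq)))
      (single-≢ c (u≢suc-u z≤n i<h)) (single-≢ c (λ eq → u≢suc-u i<h z≤n (sym eq)))
      (single-≢ c λ eq → 1+n≢0 (sym (u-injective z≤n i<h (suc-injective eq))))
      (spread z≤n z≤n z≤n)

-- Uniqueness of solutions, and monotonicity of resolvents

module _ {L L′ : RowOp} {μ : ℕ → Series} (L≡L′ : ∀ {a b} → (∀ x → a x ≡ b x) → ∀ y → L a y ≡ L′ b y)
  (S : Solution L μ) (S′ : Solution L′ μ) where
  private
    module S₁ = Solution S
    module S₂ = Solution S′

  D-unique : ∀ k y → S₁.D y k ≡ S₂.D y k
  D-unique = <-rec _ λ k rec y → trans (S₁.D-eq y k) (trans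
    (cong (1s k +_) (t-⊛-cong-< k λ i i<k → ⊛-cong-≤ i
      (λ j j≤i → L≡L′ (λ x → rec (≤-<-trans j≤i i<k) x) y) (λ j j≤i → rec (≤-<-trans j≤i i<k) y)))
    (sym (S₂.D-eq y k)))

  E-unique : ∀ k y → S₁.E y k ≡ S₂.E y k
  E-unique = <-rec _ λ k rec y → trans (S₁.E-eq y k) (trans
    (cong (μ y k +_) (t-⊛-cong-< k λ i i<k → L≡L′ (λ x → ⊛-cong-≤ i
      (λ j _ → ⊛-cong (λ l → D-unique l x) (λ l → D-unique l x) j) (λ j j≤i → rec (≤-<-trans j≤i i<k) x)) y))
    (sym (S₂.E-eq y k)))

total : ∀ {L μ} → Solution L μ → ℕ → ℕ → ℕ
total S n k = ∑ n (λ y → (D y ⊛ E y) k)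
  where open Solution S

-- Codes are only known to agree pointwise, and one code gets solutions built in different ways, by
-- `solution` and by `Rooted`; this makes them interchangeable.
total-unique : ∀ {L L′ μ} → (∀ {a b} → (∀ x → a x ≡ b x) → ∀ y → L a y ≡ L′ b y) →
  (S : Solution L μ) (S′ : Solution L′ μ) → ∀ n k → total S n k ≡ total S′ n k
total-unique L≡L′ S S′ n k = ∑-cong n λ y _ → ⊛-cong (λ j → D-unique L≡L′ S S′ j y) (λ j → E-unique L≡L′ S S′ j y) k

module _ (P : Series) where
  open Fixpoint (λ F y → 1s ⊕ t ⊛ (P ⊛ F y))
    (λ k {F} {G} p y j j≤k → cong (1s j +_) (t-⊛-cong-< j λ i i<j → ⊛-cong-≤ i {P} {P}
      (λ _ _ → refl) (λ l l≤i → p y l (<-≤-trans (≤-<-trans l≤i i<j) j≤k))))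

  -- The series `1 / (1 - t P)`. The operator treats all indices alike, so index 0 is an arbitrary
  -- choice.
  geometric : Series
  geometric = fix 0

  geometric-eq : geometric ≗ 1s ⊕ t ⊛ (P ⊛ geometric)
  geometric-eq = fix-eq 0

t-⊛-mono-< : ∀ k {f g} → (∀ j → j < k → f j ≤ g j) → (t ⊛ f) k ≤ (t ⊛ g) k
t-⊛-mono-< 0 p = ≤-refl
t-⊛-mono-< 1 {f} {g} p = ≤-reflexive (trans (t-⊛-1 f) (sym (t-⊛-1 g)))
t-⊛-mono-< (suc (suc k)) {f} {g} p =
  subst₂ _≤_ (sym (t-⊛-suc² f k)) (sym (t-⊛-suc² g k)) (p k (m≤n⇒m≤1+n ≤-refl))

geometric-mono : ∀ {P Q} → (∀ k → P k ≤ Q k) → ∀ k → geometric P k ≤ geometric Q k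
geometric-mono {P} {Q} P≤Q = <-rec _ λ k rec → subst₂ _≤_ (sym (geometric-eq P k)) (sym (geometric-eq Q k))
  (+-monoʳ-≤ (1s k) (t-⊛-mono-< k λ i i<k → ⊛-mono-≤ i (λ j _ → P≤Q j) (λ j j≤i → rec (≤-<-trans j≤i i<k))))

-- Convexity of log (1 / (1 - t s)): spreading out the pair of exponents increases the product.
resolvent-product-mono : ∀ {s₀ s₁ s₀′ s₁′ A B A′ B′} → (∀ k → Spread (s₀′ k) (s₁′ k) (s₀ k) (s₁ k)) →
  A ≗ 1s ⊕ t ⊛ (s₀ ⊛ A) → B ≗ 1s ⊕ t ⊛ (s₁ ⊛ B) → A′ ≗ 1s ⊕ t ⊛ (s₀′ ⊛ A′) → B′ ≗ 1s ⊕ t ⊛ (s₁′ ⊛ B′) →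
  (∀ k → A k ≤ A′ k) → ∀ k → (A ⊛ B) k ≤ (A′ ⊛ B′) k
resolvent-product-mono {s₀} {s₁} {s₀′} {s₁′} {A} {B} {A′} {B′} sp eA eB eA′ eB′ A≤A′ k =
  -- `A` is expanded around `B′` and `A′` around `B`, so that both products have the leading term
  -- `B′ ⊛ B`. The remainders carry `δ = s₀ - s₁′` and `δ′ = s₀′ - s₁`, which are natural numbers
  -- with `δ ≤ δ′`.
  subst₂ _≤_ (sym (expand {A} {B′} {B} eA₂ k))
    (sym (trans (expand {A′} {B} {B′} eA₂′ k) (cong₂ _+_ (⊛-comm B B′ k)
      (⊛-cong {t} {t} (λ _ → refl) (⊛-cong {δ′} {δ′} (λ _ → refl) commute) k))))
    (+-monoʳ-≤ ((B′ ⊛ B) k) (⊛-mono-≤ k {t} (λ _ _ → ≤-refl) λ j _ → ⊛-mono-≤ j (λ l _ → δ≤δ′ l)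
      λ l _ → ⊛-mono-≤ l (λ m _ → A≤A′ m) (λ _ _ → ≤-refl)))
  where
  δ δ′ : Series
  δ k = s₀ k ∸ s₁′ k
  δ′ k = s₀′ k ∸ s₁ k
  s₁≤s₀′ : ∀ k → s₁ k ≤ s₀′ k
  s₁≤s₀′ k = +-cancelʳ-≤ (s₁′ k) _ _ (≤-trans (+-monoʳ-≤ (s₁ k) (Spread.b′≤a (sp k)))
    (subst (_≤ s₀′ k + s₁′ k) (+-comm (s₀ k) (s₁ k)) (Spread.sum≤ (sp k))))
  δ≤δ′ : ∀ k → δ k ≤ δ′ k
  δ≤δ′ k = m≤n+o⇒m∸n≤o (s₀ k) (s₁′ k) (subst (s₀ k ≤_) (+-∸-assoc (s₁′ k) (s₁≤s₀′ k))
    (m+n≤o⇒m≤o∸n (s₀ k) (subst (s₀ k + s₁ k ≤_) (+-comm (s₀′ k) (s₁′ k)) (Spread.sum≤ (sp k)))))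
  eA₂ : A ≗ B′ ⊕ t ⊛ (δ ⊛ (A ⊛ B′))
  eA₂ = resolvent-difference {A} {B′} {s₁′} {δ} (S.trans eA (S.+-cong {1s} S.refl (⊛-cong {t} {t} (λ _ → refl)
    (⊛-cong (λ k → sym (m+[n∸m]≡n (Spread.b′≤a (sp k)))) (λ _ → refl))))) eB′
  eA₂′ : A′ ≗ B ⊕ t ⊛ (δ′ ⊛ (A′ ⊛ B))
  eA₂′ = resolvent-difference {A′} {B} {s₁} {δ′} (S.trans eA′ (S.+-cong {1s} S.refl (⊛-cong {t} {t} (λ _ → refl)
    (⊛-cong (λ k → sym (m+[n∸m]≡n (s₁≤s₀′ k))) (λ _ → refl))))) eB
  expand : ∀ {U V W δ} → U ≗ V ⊕ t ⊛ (δ ⊛ (U ⊛ V)) → U ⊛ W ≗ V ⊛ W ⊕ t ⊛ (δ ⊛ (U ⊛ (V ⊛ W)))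
  expand {U} {V} {W} {δ} e = S.trans (⊛-cong e (λ _ → refl))
    (SS.solve 5 (λ t δ U V W → (V :+ t :* (δ :* (U :* V))) :* W := V :* W :+ t :* (δ :* (U :* (V :* W)))) S.refl t δ U V W)
  commute : A′ ⊛ (B ⊛ B′) ≗ A′ ⊛ (B′ ⊛ B)
  commute = ⊛-cong {A′} (λ _ → refl) (⊛-comm B B′)

-- Codes of trees, with the edge between 0 and 1 present or cut

-- A tree is coded by ρ y = (degree of the y-th vertex) - 1.  Cutting the edge between 0 and 1,
-- the children of y are the ρ y vertices from lo ρ y on.
lo : (ℕ → ℕ) → ℕ → ℕ
lo ρ zero = 2
lo ρ (suc y) = lo ρ y + ρ y

-- The flag tells whether 1 is a child of 0 (true) or a second root (false).
first extra : Bool → ℕ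
first b = if b then 1 else 2
extra b = if b then 1 else 0

start size : Bool → (ℕ → ℕ) → ℕ → ℕ
start b ρ zero = first b
start b ρ (suc y) = lo ρ (suc y)
size b ρ zero = extra b + ρ 0
size b ρ (suc y) = ρ (suc y)

children : Bool → (ℕ → ℕ) → RowOp
children b ρ = row (start b ρ) (size b ρ)

start+size : ∀ b ρ y → start b ρ y + size b ρ y ≡ lo ρ (suc y)
start+size true ρ zero = refl
start+size false ρ zero = refl
start+size b ρ (suc y) = refl

start≤lo : ∀ b ρ y → start b ρ y ≤ lo ρ y
start≤lo true ρ zero = s≤s z≤n
start≤lo false ρ zero = ≤-refl
start≤lo b ρ (suc y) = ≤-refl

ρ≤size : ∀ b ρ y → ρ y ≤ size b ρ y
ρ≤size true ρ zero = n≤1+n _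
ρ≤size false ρ zero = ≤-refl
ρ≤size b ρ (suc y) = ≤-refl

start-cong : ∀ b {ρ σ} y → lo ρ y ≡ lo σ y → start b ρ y ≡ start b σ y
start-cong true zero _ = refl
start-cong false zero _ = refl
start-cong b (suc y) p = p

lo-cong : ∀ {ρ σ} → (∀ y → ρ y ≡ σ y) → ∀ y → lo ρ y ≡ lo σ y
lo-cong p zero = refl
lo-cong p (suc y) = cong₂ _+_ (lo-cong p y) (p y)

size-cong : ∀ b {ρ σ} y → ρ y ≡ σ y → size b ρ y ≡ size b σ y
size-cong true zero p = cong suc p
size-cong false zero p = p
size-cong b (suc y) p = p

children-cong : ∀ b {ρ σ} → (∀ y → ρ y ≡ σ y) → ∀ {a c} → (∀ x → a x ≡ c x) →
  ∀ y → children b ρ a y ≡ children b σ c y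
children-cong b {ρ} {σ} p {a} {c} q y rewrite size-cong b {ρ} {σ} y (p y) | start-cong b {ρ} {σ} y (lo-cong p y) =
  ∑-cong (size b σ y) (λ j _ → q (start b σ y + j))

children-true : ∀ ρ a y → children true ρ a y ≡ children false ρ a y + single 0 (a 1) y
children-true ρ a zero = trans (∑-suc (ρ 0) (λ j → a (suc j))) (+-comm (a 1) _)
children-true ρ a (suc y) = sym (+-identityʳ _)

lo-mono-≤ : ∀ {ρ σ} → (∀ y → ρ y ≤ σ y) → ∀ y → lo ρ y ≤ lo σ y
lo-mono-≤ p zero = ≤-refl
lo-mono-≤ p (suc y) = +-mono-≤ (lo-mono-≤ p y) (p y)

lo-mono : ∀ ρ {y z} → y ≤ z → lo ρ y ≤ lo ρ z
lo-mono ρ {z = zero} z≤n = ≤-refl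
lo-mono ρ {y} {suc z} y≤1+z with m≤n⇒m<n∨m≡n y≤1+z
... | inj₁ (s≤s y≤z) = ≤-trans (lo-mono ρ y≤z) (m≤m+n _ _)
... | inj₂ refl = ≤-refl

lo-≥ : ∀ ρ y → (∀ i → i < y → 1 ≤ ρ i) → y + 2 ≤ lo ρ y
lo-≥ ρ zero p = ≤-refl
lo-≥ ρ (suc y) p = subst (_≤ lo ρ y + ρ y) (+-comm (y + 2) 1)
  (+-mono-≤ (lo-≥ ρ y (λ i i<y → p i (m≤n⇒m≤1+n i<y))) (p y ≤-refl))

inc : ℕ → (ℕ → ℕ) → ℕ → ℕ
inc l ρ y = ρ y + single l 1 y

inc-≢ : ∀ {l} ρ {y} → l ≢ y → inc l ρ y ≡ ρ y
inc-≢ ρ {y} l≢y = trans (cong (ρ y +_) (single-≢ 1 l≢y)) (+-identityʳ _)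

inc-≡ : ∀ l ρ → inc l ρ l ≡ suc (ρ l)
inc-≡ l ρ = trans (cong (ρ l +_) (single-≡ l 1)) (+-comm (ρ l) 1)

lo-inc-≤ : ∀ {l} ρ {y} → y ≤ l → lo (inc l ρ) y ≡ lo ρ y
lo-inc-≤ ρ {zero} _ = refl
lo-inc-≤ ρ {suc y} y<l = cong₂ _+_ (lo-inc-≤ ρ (<⇒≤ y<l)) (inc-≢ ρ (≢-sym (<⇒≢ y<l)))

lo-inc-> : ∀ {l} ρ {y} → l < y → lo (inc l ρ) y ≡ suc (lo ρ y)
lo-inc-> {l} ρ {suc y} (s≤s l≤y) with m≤n⇒m<n∨m≡n l≤y
... | inj₁ l<y = cong₂ _+_ (lo-inc-> ρ l<y) (inc-≢ ρ (<⇒≢ l<y))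
... | inj₂ refl = trans (cong₂ _+_ (lo-inc-≤ ρ {l} ≤-refl) (inc-≡ l ρ)) (+-suc (lo ρ l) (ρ l))

size-inc : ∀ b l ρ y → size b (inc l ρ) y ≡ size b ρ y + single l 1 y
size-inc true l ρ zero = refl
size-inc false l ρ zero = refl
size-inc b l ρ (suc y) = refl

Antitone : (ℕ → ℕ) → Set
Antitone f = ∀ {y z} → y ≤ z → f z ≤ f y

start≥1 : ∀ b ρ y → 1 ≤ start b ρ y
start≥1 true ρ zero = ≤-refl
start≥1 false ρ zero = s≤s z≤n
start≥1 b ρ (suc y) = ≤-trans (s≤s z≤n) (lo-mono ρ {0} z≤n)

-- Restoring the edge between the roots 0 and 1 multiplies the resolvent of 0 by 1 / (1 - t D₀ D₁).
module Rooted {ρ : ℕ → ℕ} {μ : ℕ → Series} (S : Solution (children false ρ) μ) where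
  open Solution S

  Λ : Series
  Λ = geometric (D 0 ⊛ D 1)

  D⁺ E⁺ : ℕ → Series
  D⁺ zero = D 0 ⊛ Λ
  D⁺ (suc y) = D (suc y)
  E⁺ zero = E 0 ⊕ t ⊛ (D 1 ⊛ D 1 ⊛ E 1)
  E⁺ (suc y) = E (suc y)

  children-⁺ : ∀ a b → (∀ x → a (suc x) ≡ b (suc x)) → ∀ y →
    children true ρ a y ≡ children false ρ b y + single 0 (b 1) y
  children-⁺ a b p y = trans (∑-cong (size true ρ y) λ j _ → agree _ (≤-trans (start≥1 true ρ y) (m≤m+n _ j)))
    (children-true ρ b y)
    where
    agree : ∀ x → 1 ≤ x → a x ≡ b x
    agree (suc x) _ = p x

  D⁺-eq : ∀ y → D⁺ y ≗ 1s ⊕ t ⊛ (lift (children true ρ) D⁺ y ⊛ D⁺ y)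
  D⁺-eq zero = begin
    D 0 ⊛ Λ
      ≈⟨ ⊛-cong (D-eq 0) (λ _ → refl) ⟩
    (1s ⊕ t ⊛ (s ⊛ D 0)) ⊛ Λ
      ≈⟨ SS.solve 4 (λ t s D Λ → (con 1 :+ t :* (s :* D)) :* Λ := Λ :+ t :* (s :* (D :* Λ))) S.refl t s (D 0) Λ ⟩
    Λ ⊕ t ⊛ (s ⊛ (D 0 ⊛ Λ))
      ≈⟨ S.+-cong (geometric-eq (D 0 ⊛ D 1)) (λ _ → refl) ⟩
    1s ⊕ t ⊛ (D 0 ⊛ D 1 ⊛ Λ) ⊕ t ⊛ (s ⊛ (D 0 ⊛ Λ))
      ≈⟨ SS.solve 5 (λ t s D D₁ Λ → con 1 :+ t :* (D :* D₁ :* Λ) :+ t :* (s :* (D :* Λ)) :=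
           con 1 :+ t :* ((s :+ D₁) :* (D :* Λ))) S.refl t s (D 0) (D 1) Λ ⟩
    1s ⊕ t ⊛ ((s ⊕ D 1) ⊛ (D 0 ⊛ Λ))
      ≈⟨ S.+-cong {1s} (λ _ → refl) (⊛-cong {t} (λ _ → refl) (⊛-cong {s ⊕ D 1}
           (λ k → sym (children-⁺ (λ x → D⁺ x k) (λ x → D x k) (λ _ → refl) 0)) (λ _ → refl))) ⟩
    1s ⊕ t ⊛ (lift (children true ρ) D⁺ 0 ⊛ (D 0 ⊛ Λ)) ∎
    where
    open Series≗
    s : Series
    s = lift (children false ρ) D 0
  D⁺-eq (suc y) = S.trans (D-eq (suc y)) (S.+-cong {1s} (λ _ → refl) (⊛-cong {t} (λ _ → refl) (⊛-cong
    (λ k → sym (trans (children-⁺ (λ x → D⁺ x k) (λ x → D x k) (λ _ → refl) (suc y)) (+-identityʳ _))) (λ _ → refl))))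

  E⁺-eq : ∀ y → E⁺ y ≗ μ y ⊕ t ⊛ lift (children true ρ) (λ x → D⁺ x ⊛ D⁺ x ⊛ E⁺ x) y
  E⁺-eq zero = begin
    E 0 ⊕ t ⊛ (D 1 ⊛ D 1 ⊛ E 1)
      ≈⟨ S.+-cong (E-eq 0) (λ _ → refl) ⟩
    μ 0 ⊕ t ⊛ e ⊕ t ⊛ (D 1 ⊛ D 1 ⊛ E 1)
      ≈⟨ SS.solve 4 (λ t m e d → m :+ t :* e :+ t :* d := m :+ t :* (e :+ d)) S.refl t (μ 0) e (D 1 ⊛ D 1 ⊛ E 1) ⟩
    μ 0 ⊕ t ⊛ (e ⊕ D 1 ⊛ D 1 ⊛ E 1)
      ≈⟨ S.+-cong {μ 0} (λ _ → refl) (⊛-cong {t} (λ _ → refl)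
           (λ k → sym (children-⁺ (λ x → (D⁺ x ⊛ D⁺ x ⊛ E⁺ x) k) (λ x → (D x ⊛ D x ⊛ E x) k) (λ _ → refl) 0))) ⟩
    μ 0 ⊕ t ⊛ lift (children true ρ) (λ x → D⁺ x ⊛ D⁺ x ⊛ E⁺ x) 0 ∎
    where
    open Series≗
    e : Series
    e = lift (children false ρ) (λ x → D x ⊛ D x ⊛ E x) 0
  E⁺-eq (suc y) = S.trans (E-eq (suc y)) (S.+-cong {μ (suc y)} (λ _ → refl) (⊛-cong {t} (λ _ → refl)
    (λ k → sym (trans (children-⁺ (λ x → (D⁺ x ⊛ D⁺ x ⊛ E⁺ x) k) (λ x → (D x ⊛ D x ⊛ E x) k) (λ _ → refl) (suc y)) (+-identityʳ _)))))

  rooted : Solution (children true ρ) μ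
  rooted = record { D = D⁺ ; E = E⁺ ; D-eq = D⁺-eq ; E-eq = E⁺-eq }

  -- The contribution of the edge between the two roots. It is symmetric in 0 and 1, although the
  -- rooted solution treats 1 as a child of 0; this is what allows a comparison by means of the pair
  -- 0, 1.
  crossing : Series
  crossing = (D 0 ⊛ E 0 ⊕ D 1 ⊛ E 1) ⊛ (t ⊛ (D 0 ⊛ D 1 ⊛ Λ))

  DE⁺-zero : D⁺ 0 ⊛ E⁺ 0 ≗ D 0 ⊛ E 0 ⊕ crossing
  DE⁺-zero = begin
    D 0 ⊛ Λ ⊛ (E 0 ⊕ t ⊛ (D 1 ⊛ D 1 ⊛ E 1))
      ≈⟨ SS.solve 6 (λ t D E D₁ E₁ Λ → D :* Λ :* (E :+ t :* (D₁ :* D₁ :* E₁)) :=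
           D :* E :* Λ :+ D₁ :* E₁ :* (t :* (D :* D₁ :* Λ))) S.refl t (D 0) (E 0) (D 1) (E 1) Λ ⟩
    D 0 ⊛ E 0 ⊛ Λ ⊕ D 1 ⊛ E 1 ⊛ (t ⊛ (D 0 ⊛ D 1 ⊛ Λ))
      ≈⟨ S.+-cong (⊛-cong {D 0 ⊛ E 0} (λ _ → refl) (geometric-eq (D 0 ⊛ D 1))) (λ _ → refl) ⟩
    D 0 ⊛ E 0 ⊛ (1s ⊕ t ⊛ (D 0 ⊛ D 1 ⊛ Λ)) ⊕ D 1 ⊛ E 1 ⊛ (t ⊛ (D 0 ⊛ D 1 ⊛ Λ))
      ≈⟨ SS.solve 3 (λ p q z → p :* (con 1 :+ z) :+ q :* z := p :+ (p :+ q) :* z) S.refl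
           (D 0 ⊛ E 0) (D 1 ⊛ E 1) (t ⊛ (D 0 ⊛ D 1 ⊛ Λ)) ⟩
    D 0 ⊛ E 0 ⊕ crossing ∎
    where open Series≗

  rooted-total : ∀ n k → total rooted (suc n) k ≡ total S (suc n) k + crossing k
  rooted-total n k = begin
    ∑ (suc n) (λ y → (D⁺ y ⊛ E⁺ y) k)
      ≡⟨ ∑-suc n _ ⟩
    (D⁺ 0 ⊛ E⁺ 0) k + ∑ n (λ y → (D (suc y) ⊛ E (suc y)) k)
      ≡⟨ cong (_+ ∑ n (λ y → (D (suc y) ⊛ E (suc y)) k)) (trans (DE⁺-zero k) (+-comm ((D 0 ⊛ E 0) k) (crossing k))) ⟩
    crossing k + (D 0 ⊛ E 0) k + ∑ n (λ y → (D (suc y) ⊛ E (suc y)) k)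
      ≡⟨ trans (+-assoc (crossing k) _ _) (+-comm (crossing k) _) ⟩
    (D 0 ⊛ E 0) k + ∑ n (λ y → (D (suc y) ⊛ E (suc y)) k) + crossing k
      ≡⟨ cong (_+ crossing k) (sym (∑-suc n (λ y → (D y ⊛ E y) k))) ⟩
    ∑ (suc n) (λ y → (D y ⊛ E y) k) + crossing k ∎
    where open ≡-Reasoning

module _ (u : ℕ → ℕ) (h : ℕ) where
  open Dominance u h

  -- The sum over the cut tree and the factor `D 0 ⊛ E 0 ⊕ D 1 ⊛ E 1` are controlled by `Dom`. The
  -- product `D 0 ⊛ D 1` is not, since spreading two numbers with a fixed sum lowers their product;
  -- it grows because the kernels of the two resolvents are spread.
  rooted-mono : ∀ {ρ ρ′ μ μ′} → u h ≡ 0 →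
    (∀ {a a′} → Dom a a′ → Dom (children false ρ a) (children false ρ′ a′)) →
    (∀ k → Dom (λ y → μ y k) (λ y → μ′ y k)) →
    (S : Solution (children true ρ) μ) (S′ : Solution (children true ρ′) μ′) →
    ∀ n k → total S (suc n) k ≤ total S′ (suc n) k
  rooted-mono {ρ} {ρ′} {μ} {μ′} uh≡0 dom-L dom-μ S S′ n k = subst₂ _≤_
    (trans (sym (R.rooted-total n k)) (total-unique (children-cong true (λ _ → refl)) R.rooted S (suc n) k))
    (trans (sym (R′.rooted-total n k)) (total-unique (children-cong true (λ _ → refl)) R′.rooted S′ (suc n) k))
    (+-mono-≤ (dom-∑ (dom-DE dom-L dom-μ T T′ k) (suc n)) crossing-≤)
    where
    T : Solution (children false ρ) μ
    T = solution (children false ρ) μ (λ p → children-cong false (λ _ → refl) p)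
    T′ : Solution (children false ρ′) μ′
    T′ = solution (children false ρ′) μ′ (λ p → children-cong false (λ _ → refl) p)
    module R = Rooted T
    module R′ = Rooted T′
    open Solution T
    open Solution T′ using () renaming (D to D′; E to E′; D-eq to D′-eq)
    root-pair : ∀ {a a′} → Dom a a′ → Spread (a′ 0) (a′ 1) (a 0) (a 1)
    root-pair {a} {a′} d = subst (λ v → Spread (a′ v) (a′ (suc v)) (a v) (a (suc v))) uh≡0 (pair d ≤-refl)
    D₀≤D₀′ : ∀ j → D 0 j ≤ D′ 0 j
    D₀≤D₀′ j = other (dom-D dom-L dom-μ T T′ j) (λ _ _ ())
    D₀D₁≤ : ∀ j → (D 0 ⊛ D 1) j ≤ (D′ 0 ⊛ D′ 1) j
    D₀D₁≤ = resolvent-product-mono (λ j → root-pair (dom-L (dom-D dom-L dom-μ T T′ j)))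
      (D-eq 0) (D-eq 1) (D′-eq 0) (D′-eq 1) D₀≤D₀′
    crossing-≤ : R.crossing k ≤ R′.crossing k
    crossing-≤ = ⊛-mono-≤ k (λ j _ → Spread.sum≤ (root-pair (dom-DE dom-L dom-μ T T′ j)))
      (λ j _ → ⊛-mono-≤ j {t} (λ _ _ → ≤-refl) (λ i _ → ⊛-mono-≤ i (λ m _ → D₀D₁≤ m) (λ m _ → geometric-mono D₀D₁≤ m)))

-- The chain of ancestors of two neighbouring vertices

-- The pair (l , suc l) and its ancestors.  The first K rows are nonempty, and the rows after g are shifted
-- to leave room for one vertex.
module Pairs (ρ : ℕ → ℕ) (anti : Antitone ρ) (l K g : ℕ) (K≤1+g : K ≤ suc g) (l< : suc l < lo ρ K)
  (ρ≥1 : ∀ {i} → i < K → 1 ≤ ρ i) where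

  rest : Bool → RowOp
  rest b = row (start b (inc g ρ)) (size b ρ)

  lo-inc-< : ∀ {y} → y < K → lo (inc g ρ) y ≡ lo ρ y
  lo-inc-< y<K = lo-inc-≤ ρ (s≤s⁻¹ (≤-trans y<K K≤1+g))

  lo-cancel-< : ∀ {y} → lo ρ y < lo ρ K → y < K
  lo-cancel-< lo< = ≰⇒> λ K≤y → <⇒≱ lo< (lo-mono ρ K≤y)

  find-row : ∀ k {x} → 2 ≤ x → x < lo ρ k → ∃[ y ] (y < k × lo ρ y ≤ x × x < lo ρ (suc y))
  find-row zero 2≤x x<2 = contradiction 2≤x (<⇒≱ x<2)
  find-row (suc k) {x} 2≤x x< with lo ρ k ≤? x
  ... | yes ≤x = k , ≤-refl , ≤x , x<
  ... | no ≰x with find-row k 2≤x (≰⇒> ≰x)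
  ...   | y , y<k , p , q = y , m≤n⇒m≤1+n y<k , p , q

  -- The way the chain ends fixes the flag: the edge between 0 and 1 has to be cut only for a chain
  -- that ends in the pair 0, 1 itself.
  data Meet : Bool → ℕ → Set where
    roots    : ∀ {x} → x ≡ 0 → Meet false x
    siblings : ∀ {x} y → y < K → start true ρ y ≤ x → suc x < lo ρ (suc y) → Meet true x

  record Ancestors (m : ℕ) : Set where
    field
      u      : ℕ → ℕ
      h      : ℕ
      b      : Bool
      u₀     : u 0 ≡ m
      u-step : ∀ {i} → i < h → suc (u (suc i)) < u i × lo ρ (suc (u (suc i))) ≡ suc (u i) × suc (u (suc i)) < K
      u-meet : Meet b (u h)

  -- If `m` is not the last child of its father `y`, then `suc m` is its sibling and the chain
  -- stops. Otherwise `suc m` is the first child of `suc y`, whose row is not empty, and the chain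
  -- continues with the smaller pair `y`, `suc y`.
  ancestors : ∀ m → m ≤ l → Ancestors m
  ancestors = <-rec _ step
    where
    step : ∀ m → (∀ {y} → y < m → y ≤ l → Ancestors y) → m ≤ l → Ancestors m
    step zero _ _ = record { u = λ _ → 0 ; h = 0 ; u₀ = refl ; u-step = λ () ; u-meet = roots refl }
    -- Vertex 1 lies in no row of `lo`, as these start at 2. With the edge present it is the first
    -- child of 0, and 2 is the second one because `ρ 0` is positive.
    step (suc zero) _ 1≤l = record { u = λ _ → 1 ; h = 0 ; u₀ = refl ; u-step = λ ()
      ; u-meet = siblings 0 0<K ≤-refl (+-monoʳ-≤ 2 (ρ≥1 0<K)) }
      where
      0<K : 0 < K
      0<K = lo-cancel-< (≤-<-trans (s≤s 1≤l) l<)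
    step m@(suc (suc m′)) rec m≤l with find-row K {m} (s≤s (s≤s z≤n)) (<-trans (n<1+n m) (≤-<-trans (s≤s m≤l) l<))
    ... | y , y<K , lo≤m , m<lo with m≤n⇒m<n∨m≡n m<lo
    ...   | inj₁ 1+m<lo = record { u = λ _ → m ; h = 0 ; u₀ = refl ; u-step = λ ()
              ; u-meet = siblings y y<K (≤-trans (start≤lo true ρ y) lo≤m) 1+m<lo }
    ...   | inj₂ 1+m≡lo = record
              { u = λ { zero → m ; (suc i) → A.u i } ; h = suc A.h ; u₀ = refl
              ; u-step = λ { {zero} _ → subst (λ v → suc v < m × lo ρ (suc v) ≡ suc m × suc v < K) (sym A.u₀)
                                          (1+y<m , sym 1+m≡lo ,
                                           lo-cancel-< (subst (_< lo ρ K) 1+m≡lo (≤-<-trans (s≤s m≤l) l<)))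
                           ; {suc i} (s≤s i<h) → A.u-step i<h }
              ; u-meet = A.u-meet }
      where
      1+y<m : suc y < m
      1+y<m = ≤-trans (subst (_≤ lo ρ y) (+-comm y 2) (lo-≥ ρ y λ i i<y → ρ≥1 (<-trans i<y y<K))) lo≤m
      module A = Ancestors (rec {y} (<-trans (n<1+n y) 1+y<m) (≤-trans (<⇒≤ (<-trans (n<1+n y) 1+y<m)) m≤l))

  module _ (A : Ancestors l) where
    open Ancestors A

    u-bound : ∀ {i} → i ≤ h → u i ≤ l
    u-bound {zero} _ = ≤-reflexive u₀
    u-bound {suc i} i<h with u-step i<h
    ... | d , _ = ≤-trans (<⇒≤ (<-trans (n<1+n _) d)) (u-bound (<⇒≤ i<h))

    suc-u<K : ∀ {i} → i < h → suc (u (suc i)) < K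
    suc-u<K i<h = proj₂ (proj₂ (u-step i<h))

    u<K : ∀ {i} → i < h → u (suc i) < K
    u<K i<h = <-trans (n<1+n _) (suc-u<K i<h)

    lo≤lo-inc : ∀ y → lo ρ y ≤ lo (inc g ρ) y
    lo≤lo-inc = lo-mono-≤ (λ y → m≤m+n (ρ y) _)

    chain : Chain (start b (inc g ρ)) (size b ρ) u h
    chain = record
      { below = λ {y} → chain-below b {y}
      ; disjoint = λ {y} {z} → chain-disjoint b {y} {z}
      ; size-anti = λ {y} {z} → chain-anti b {y} {z}
      ; descending = λ i<h → proj₁ (u-step i<h)
      ; lastChild = λ i<h → chain-last i<h
      ; firstChild = λ i<h → chain-first i<h
      ; meet = λ {y} → chain-meet u-meet {y} }
      where
      chain-below : ∀ b {y} → 0 < size b ρ y → y < start b (inc g ρ) y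
      chain-below true {zero} _ = z<s
      chain-below false {zero} _ = z<s
      chain-below b {suc y} 0<ρ = ≤-trans
        (≤-trans (subst (_≤ suc y + 2) (+-comm (suc y) 1) (+-monoʳ-≤ (suc y) (s≤s z≤n)))
          (lo-≥ ρ (suc y) λ i i<y → ≤-trans 0<ρ (anti (<⇒≤ i<y))))
        (lo≤lo-inc (suc y))

      chain-disjoint : ∀ b {y z} → y < z → start b (inc g ρ) y + size b ρ y ≤ start b (inc g ρ) z
      chain-disjoint b {y} {suc z} (s≤s y≤z) = ≤-trans
        (+-monoʳ-≤ (start b (inc g ρ) y) (subst (size b ρ y ≤_) (sym (size-inc b g ρ y)) (m≤m+n _ _)))
        (≤-trans (≤-reflexive (start+size b (inc g ρ) y)) (lo-mono (inc g ρ) (s≤s y≤z)))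

      chain-anti : ∀ b {y z} → y ≤ z → size b ρ z ≤ size b ρ y
      chain-anti b {y} {zero} z≤n = ≤-refl
      chain-anti b {y} {suc z} y≤z = ≤-trans (anti y≤z) (ρ≤size b ρ y)

      chain-last : ∀ {i} → i < h →
        ∃[ r ] (size b ρ (u (suc i)) ≡ suc r × start b (inc g ρ) (u (suc i)) + r ≡ u i)
      chain-last {i} i<h with size b ρ (u (suc i)) in eq
      ... | zero = contradiction (subst (1 ≤_) eq (≤-trans (ρ≥1 (u<K i<h)) (ρ≤size b ρ _))) λ ()
      ... | suc r = r , refl , suc-injective (begin
        suc (start b (inc g ρ) (u (suc i)) + r)  ≡⟨ +-suc _ r ⟨
        start b (inc g ρ) (u (suc i)) + suc r    ≡⟨ cong₂ _+_ (start-cong b (u (suc i)) (lo-inc-< (u<K i<h))) (sym eq) ⟩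
        start b ρ (u (suc i)) + size b ρ (u (suc i)) ≡⟨ start+size b ρ (u (suc i)) ⟩
        lo ρ (suc (u (suc i)))                   ≡⟨ proj₁ (proj₂ (u-step i<h)) ⟩
        suc (u i) ∎)
        where open ≡-Reasoning

      chain-first : ∀ {i} → i < h →
        ∃[ r ] (ρ (suc (u (suc i))) ≡ suc r × lo (inc g ρ) (suc (u (suc i))) ≡ suc (u i))
      chain-first {i} i<h with ρ (suc (u (suc i))) | ρ≥1 (suc-u<K i<h)
      ... | suc r | _ = r , refl , trans (lo-inc-< (suc-u<K i<h)) (proj₁ (proj₂ (u-step i<h)))

      chain-meet : ∀ {b x} → Meet b x → ∀ {y} → 0 < size b ρ y → start b (inc g ρ) y ≢ suc x
      chain-meet (roots refl) {zero} _ ()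
      chain-meet (roots refl) {suc y} _ eq = contradiction (≤-trans (lo-mono (inc g ρ) {0} {suc y} z≤n) (≤-reflexive eq)) λ { (s≤s ()) }
      chain-meet (siblings {x} y₀ y₀<K ≤x <lo) {zero} _ eq with suc-injective eq
      ... | refl = contradiction (≤-trans (start≥1 true ρ y₀) ≤x) λ ()
      chain-meet (siblings {x} y₀ y₀<K ≤x <lo) {suc y} _ eq with suc y ≤? y₀
      ... | yes 1+y≤y₀ = <-irrefl eq (s≤s (≤-trans (≤-reflexive (lo-inc-< (≤-<-trans 1+y≤y₀ y₀<K)))
              (≤-trans (lo≤start 1+y≤y₀) ≤x)))
        where
        lo≤start : ∀ {y z} → suc y ≤ z → lo ρ (suc y) ≤ start true ρ z
        lo≤start {z = suc z} p = lo-mono ρ p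
      ... | no 1+y≰y₀ = <-irrefl (sym eq) (<-≤-trans <lo (≤-trans (lo-mono ρ (≰⇒> 1+y≰y₀)) (lo≤lo-inc (suc y))))

  DomAt : Ancestors l → (ℕ → ℕ) → (ℕ → ℕ) → Set
  DomAt A = Dominance.Dom (Ancestors.u A) (Ancestors.h A)

  module _ {ρ₁ ρ₂ μ μ′}
    (dom-L : ∀ (A : Ancestors l) {a a′} →
             DomAt A a a′ → DomAt A (children (Ancestors.b A) ρ₁ a) (children (Ancestors.b A) ρ₂ a′))
    (dom-μ : ∀ (A : Ancestors l) k → DomAt A (λ y → μ y k) (λ y → μ′ y k))
    (S : Solution (children true ρ₁) μ) (S′ : Solution (children true ρ₂) μ′) where

    total-≤ : ∀ n k → total S (suc n) k ≤ total S′ (suc n) k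
    total-≤ n k = by-meet (ancestors l ≤-refl)
      where
      by-meet : Ancestors l → total S (suc n) k ≤ total S′ (suc n) k
      by-meet A@(record { u = u ; h = h ; b = true }) =
        dom-∑ (dom-DE (dom-L A) (dom-μ A) S S′ k) (suc n)
        where open Dominance u h
      by-meet A@(record { u = u ; h = h ; b = false ; u-meet = roots uh≡0 }) =
        rooted-mono u h uh≡0 (dom-L A) (dom-μ A) S S′ n k

-- Moving one vertex between neighbouring fathers

module Move (ρ : ℕ → ℕ) (l : ℕ) (anti : Antitone ρ) (ρl≥1 : 1 ≤ ρ l) where

  -- The number of the moved vertex. As the last child of `l` and as the first child of `suc l` it
  -- has the same number, so the move renumbers nothing; `ρ` is the code with this vertex left out.
  c : ℕ
  c = lo ρ (suc l)

  ρ≥1 : ∀ {i} → i < suc l → 1 ≤ ρ i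
  ρ≥1 (s≤s i≤l) = ≤-trans ρl≥1 (anti i≤l)

  c-large : suc (suc l) < c
  c-large = subst (_≤ c) (+-comm (suc l) 2) (lo-≥ ρ (suc l) λ i i<1+l → ρ≥1 i<1+l)

  open Pairs ρ anti l (suc l) l ≤-refl (<-trans (n<1+n _) c-large) ρ≥1

  children-after : ∀ b a y → children b (inc l ρ) a y ≡ rest b a y + single l (a c) y
  children-after b a y with l ≟ y
  ... | no l≢y = trans
    (cong (λ m → ∑ m (λ j → a (start b (inc l ρ) y + j)))
      (trans (size-inc b l ρ y) (trans (cong (size b ρ y +_) (single-≢ 1 l≢y)) (+-identityʳ _))))
    (sym (trans (cong (rest b a y +_) (single-≢ (a c) l≢y)) (+-identityʳ _)))
  ... | yes refl = trans
    (cong (λ m → ∑ m (λ j → a (start b (inc l ρ) l + j)))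
      (trans (size-inc b l ρ l) (trans (cong (size b ρ l +_) (single-≡ l 1)) (+-comm _ 1))))
    (cong (rest b a l +_) (trans (cong a c≡) (sym (single-≡ l (a c)))))
    where
    c≡ : start b (inc l ρ) l + size b ρ l ≡ c
    c≡ = trans (cong (_+ size b ρ l) (start-cong b l (lo-inc-≤ {l} ρ ≤-refl))) (start+size b ρ l)

  children-before : ∀ b a y → children b (inc (suc l) ρ) a y ≡ rest b a y + single (suc l) (a c) y
  children-before b a y with suc l ≟ y
  ... | no 1+l≢y = trans
    (cong₂ (λ m s → ∑ m (λ j → a (s + j)))
      (trans (size-inc b (suc l) ρ y) (trans (cong (size b ρ y +_) (single-≢ 1 1+l≢y)) (+-identityʳ _)))
      (start-cong b y same-lo))
    (sym (trans (cong (rest b a y +_) (single-≢ (a c) 1+l≢y)) (+-identityʳ _)))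
    where
    same-lo : lo (inc (suc l) ρ) y ≡ lo (inc l ρ) y
    same-lo with <-cmp y (suc l)
    ... | tri< (s≤s y≤l) _ _ = trans (lo-inc-≤ ρ (m≤n⇒m≤1+n y≤l)) (sym (lo-inc-≤ ρ y≤l))
    ... | tri≈ _ eq _ = contradiction (sym eq) 1+l≢y
    ... | tri> _ _ 1+l<y = trans (lo-inc-> ρ 1+l<y) (sym (lo-inc-> ρ (<-trans (n<1+n l) 1+l<y)))
  ... | yes refl = begin
    ∑ (inc (suc l) ρ (suc l)) (λ j → a (lo (inc (suc l) ρ) (suc l) + j))
      ≡⟨ cong₂ (λ m s → ∑ m (λ j → a (s + j))) (inc-≡ (suc l) ρ) (lo-inc-≤ {suc l} ρ ≤-refl) ⟩
    ∑ (suc (ρ (suc l))) (λ j → a (c + j))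
      ≡⟨ ∑-suc (ρ (suc l)) (λ j → a (c + j)) ⟩
    a (c + 0) + ∑ (ρ (suc l)) (λ j → a (c + suc j))
      ≡⟨ cong₂ _+_ (cong a (+-identityʳ c)) (∑-cong (ρ (suc l)) λ j _ → cong a (trans (+-suc c j) (cong (_+ j) (sym (lo-inc-> ρ (n<1+n l)))))) ⟩
    a c + rest b a (suc l)
      ≡⟨ +-comm (a c) _ ⟩
    rest b a (suc l) + a c
      ≡⟨ cong (rest b a (suc l) +_) (single-≡ (suc l) (a c)) ⟨
    rest b a (suc l) + single (suc l) (a c) (suc l) ∎
    where open ≡-Reasoning

  module _ (A : Ancestors l) where
    open Ancestors A
    open Dominance u h
    open DominanceRow (chain A)

    -- The moved vertex lies beyond both of its possible fathers and their ancestors. Its own branch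
    -- does not change, so the weight taken from `suc l` equals the weight given to `l`.
    low-c : Low c
    low-c = ≤-<-trans (u-bound A ≤-refl) l<c , λ i i≤h →
      (λ c≡ → <⇒≢ (≤-<-trans (u-bound A i≤h) l<c) (sym c≡)) ,
      (λ c≡ → <⇒≢ (≤-<-trans (s≤s (u-bound A i≤h)) (<-trans (n<1+n _) c-large)) (sym c≡))
      where
      l<c : l < c
      l<c = <-trans (<-trans (n<1+n l) (n<1+n _)) c-large

    dom-children : ∀ {a a′} → Dom a a′ → Dom (children b (inc (suc l) ρ) a) (children b (inc l ρ) a′)
    dom-children {a} {a′} d = dom-resp (children-before b a) (children-after b a′)
      (dom-+ (dom-row d) (subst (λ v → Dom (single (suc v) (a c)) (single v (a′ c))) u₀ (dom-single (low-≡ d low-c))))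

  move-total : ∀ {μ} → (∀ k → Antitone (λ y → μ y k)) →
    (S : Solution (children true (inc (suc l) ρ)) μ) (S′ : Solution (children true (inc l ρ)) μ) →
    ∀ n k → total S (suc n) k ≤ total S′ (suc n) k
  move-total anti-μ = total-≤ dom-children (λ A k → Dominance.dom-antitone _ _ (anti-μ k))

single-series : ℕ → ℕ → Series
single-series v y k = single v (1s k) y

module _ (ρ : ℕ → ℕ) (anti : Antitone ρ) (l K : ℕ) (l< : suc l < lo ρ K)
  (ρ≥1 : ∀ {i} → i < K → 1 ≤ ρ i) (ρ≡0 : ∀ {i} → K ≤ i → ρ i ≡ 0) where
  open Pairs ρ anti l K K (n≤1+n K) l< ρ≥1

  -- The gap after row `K` is harmless: all rows that would be shifted are empty.
  children-rest : ∀ b a y → children b ρ a y ≡ rest b a y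
  children-rest b a y with y ≤? K
  ... | yes y≤K = cong (λ s → ∑ (size b ρ y) (λ j → a (s + j))) (sym (start-cong b y (lo-inc-≤ ρ y≤K)))
  children-rest b a zero | no y≰K = contradiction z≤n y≰K
  children-rest b a (suc y) | no y≰K rewrite ρ≡0 {suc y} (<⇒≤ (≰⇒> y≰K)) = refl

  marked-total : (S : Solution (children true ρ) (single-series (suc l)))
    (S′ : Solution (children true ρ) (single-series l)) → ∀ n k → total S (suc n) k ≤ total S′ (suc n) k
  marked-total = total-≤
    (λ A {a} {a′} d → Dominance.dom-resp _ _ (children-rest _ a) (children-rest _ a′) (DominanceRow.dom-row (chain A) d))
    (λ A k → subst (λ v → Dominance.Dom (Ancestors.u A) (Ancestors.h A) (single (suc v) (1s k)) (single v (1s k)))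
      (Ancestors.u₀ A) (DominanceRow.dom-single (chain A) refl))

-- From single moves to majorization

∑-mono-< : ∀ m {f g} → (∀ j → f j ≤ g j) → ∀ {i} → i < m → f i < g i → ∑ m f < ∑ m g
∑-mono-< (suc m) {f} {g} p {i} i<1+m fi<gi with i ≟ m
... | yes refl = +-mono-≤-< (∑-mono-≤ {m} ≤-refl (λ j _ → p j)) fi<gi
... | no i≢m = +-mono-<-≤ (∑-mono-< m p (≤∧≢⇒< (s≤s⁻¹ i<1+m) i≢m) fi<gi) (p m)

first-change : ∀ {P : ℕ → Set} → Decidable P → ∀ a d → ¬ P a → P (a + d) →
  ∃[ j ] (a ≤ j × j < a + d × P (suc j) × (∀ {y} → a ≤ y → y ≤ j → ¬ P y))
first-change {P} P? a zero ¬Pa Pad = contradiction (subst P (+-identityʳ a) Pad) ¬Pa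
first-change {P} P? a (suc d) ¬Pa Pad with P? (suc a)
... | yes Pa′ = a , ≤-refl , m<m+n a z<s , Pa′ , λ a≤y y≤a → subst (¬_ ∘ P) (≤-antisym a≤y y≤a) ¬Pa
... | no ¬Pa′ with first-change P? (suc a) d ¬Pa′ (subst P (+-suc a d) Pad)
...   | j , a<j , j< , Pj , before = j , <⇒≤ a<j , subst (j <_) (sym (+-suc a d)) j< , Pj , before′
  where
  before′ : ∀ {y} → a ≤ y → y ≤ j → ¬ P y
  before′ a≤y y≤j with m≤n⇒m<n∨m≡n a≤y
  ... | inj₁ a<y = before a<y y≤j
  ... | inj₂ refl = ¬Pa

-- The unit descends one row at a time. The codes on the way need not be nonincreasing, but `τ`, the
-- code without the unit, is, and `Move` asks for no more.
moves-total : ∀ {τ μ} → Antitone τ → (∀ k → Antitone (λ y → μ y k)) → ∀ i d →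
  (∀ {l} → l < i + d → 1 ≤ τ l) →
  (S : Solution (children true (inc (i + d) τ)) μ) (S′ : Solution (children true (inc i τ)) μ) →
  ∀ n k → total S (suc n) k ≤ total S′ (suc n) k
moves-total {τ} anti anti-μ i zero _ S S′ n k rewrite +-identityʳ i =
  ≤-reflexive (total-unique (children-cong true (λ _ → refl)) S S′ (suc n) k)
moves-total {τ} {μ} anti anti-μ i (suc d) τ≥1 S S′ n k rewrite +-suc i d =
  ≤-trans (Move.move-total τ (i + d) anti (τ≥1 ≤-refl) anti-μ S T n k)
    (moves-total anti anti-μ i d (λ l< → τ≥1 (m≤n⇒m≤1+n l<)) T S′ n k)
  where
  T : Solution (children true (inc (i + d) τ)) μ
  T = solution _ μ (λ p → children-cong true (λ _ → refl) p)

module _ {n : ℕ} {ρ′ : ℕ → ℕ} (anti′ : Antitone ρ′) (ρ′≡0 : ∀ {y} → n ≤ y → ρ′ y ≡ 0) where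

  record Majorized (ρ : ℕ → ℕ) : Set where
    field
      anti : Antitone ρ
      ρ≡0  : ∀ {y} → n ≤ y → ρ y ≡ 0
      lo≤  : ∀ y → lo ρ y ≤ lo ρ′ y
      lo≡  : lo ρ n ≡ lo ρ′ n

  -- The termination measure: a transfer raises the partial sums between its two rows by one,
  -- without exceeding those of `ρ′`.
  gap : (ℕ → ℕ) → ℕ
  gap ρ = ∑ n (λ y → lo ρ′ y ∸ lo ρ y)

  -- One unit is transferred from row j to row i, where i is the first row at which ρ and ρ′ differ
  -- and j is the row after which the partial sums first agree again.
  module Transfer {ρ : ℕ → ℕ} (M : Majorized ρ) {i j : ℕ} (i<j : i < j) (j<n : j < n)
    (lo-before : ∀ {y} → y ≤ i → lo ρ y ≡ lo ρ′ y) (lo-between : ∀ {y} → i < y → y ≤ j → lo ρ y < lo ρ′ y)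
    (lo-after : lo ρ (suc j) ≡ lo ρ′ (suc j)) where
    open Majorized M

    τ σ : ℕ → ℕ
    τ y = ρ y ∸ single j 1 y
    σ = inc i τ

    ρ<ρ′ : ρ i < ρ′ i
    ρ<ρ′ = +-cancelˡ-< (lo ρ i) _ _ (subst (λ v → lo ρ i + ρ i < v + ρ′ i) (sym (lo-before ≤-refl)) (lo-between ≤-refl i<j))

    ρ′<ρ : ρ′ j < ρ j
    ρ′<ρ = +-cancelˡ-< (lo ρ j) _ _ (subst (lo ρ j + ρ′ j <_) (sym lo-after)
      (+-monoˡ-< (ρ′ j) (lo-between i<j ≤-refl)))

    ρ≡ρ′-before : ∀ {y} → y < i → ρ y ≡ ρ′ y
    ρ≡ρ′-before {y} y<i = +-cancelˡ-≡ (lo ρ y) _ _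
      (trans (lo-before y<i) (cong (_+ ρ′ y) (sym (lo-before (<⇒≤ y<i)))))

    ρ≤ρ′-after : ρ (suc j) ≤ ρ′ (suc j)
    ρ≤ρ′-after = +-cancelˡ-≤ (lo ρ (suc j)) _ _ (subst (λ v → lo ρ (suc (suc j)) ≤ v + ρ′ (suc j)) (sym lo-after) (lo≤ (suc (suc j))))

    τ-≢ : ∀ {y} → j ≢ y → τ y ≡ ρ y
    τ-≢ {y} j≢y = cong (ρ y ∸_) (single-≢ 1 j≢y)

    τ-≡ : suc (τ j) ≡ ρ j
    τ-≡ = trans (cong (λ v → suc (ρ j ∸ v)) (single-≡ j 1)) (m+[n∸m]≡n (≤-trans (s≤s z≤n) ρ′<ρ))

    τ≤ρ : ∀ y → τ y ≤ ρ y
    τ≤ρ y = m∸n≤m (ρ y) (single j 1 y)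

    inc-τ : ∀ y → inc j τ y ≡ ρ y
    inc-τ y with j ≟ y
    ... | yes refl = trans (inc-≡ j τ) τ-≡
    ... | no j≢y = trans (inc-≢ τ j≢y) (τ-≢ j≢y)

    -- The critical inequality is the one between rows `j` and `suc j`. The partial sums agree at
    -- `suc j` but not at `j`, whence `ρ (suc j) ≤ ρ′ (suc j) ≤ ρ′ j < ρ j`.
    τ-anti : Antitone τ
    τ-anti {y} {z} y≤z with j ≟ y
    ... | no j≢y = ≤-trans (τ≤ρ z) (≤-trans (anti y≤z) (≤-reflexive (sym (τ-≢ j≢y))))
    ... | yes refl with m≤n⇒m<n∨m≡n y≤z
    ...   | inj₂ refl = ≤-refl
    ...   | inj₁ j<z = ≤-trans (τ≤ρ z) (s≤s⁻¹ (≤-trans (s≤s (≤-trans (anti j<z)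
              (≤-trans ρ≤ρ′-after (anti′ (n≤1+n j))))) (≤-trans ρ′<ρ (≤-reflexive (sym τ-≡)))))

    τ≥1 : ∀ {l} → l < j → 1 ≤ τ l
    τ≥1 l<j = ≤-trans (≤-trans (s≤s z≤n) ρ′<ρ) (≤-trans (anti (<⇒≤ l<j)) (≤-reflexive (sym (τ-≢ (≢-sym (<⇒≢ l<j))))))

    -- The added unit could only exceed an earlier row `y`; there `ρ` still equals `ρ′`, and
    -- `suc (ρ i) ≤ ρ′ i ≤ ρ′ y = ρ y`.
    σ-anti : Antitone σ
    σ-anti {y} {z} y≤z with i ≟ z
    ... | no i≢z = ≤-trans (≤-reflexive (inc-≢ τ i≢z)) (≤-trans (τ-anti y≤z) (m≤m+n (τ y) _))
    ... | yes refl with m≤n⇒m<n∨m≡n y≤z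
    ...   | inj₂ refl = ≤-refl
    ...   | inj₁ y<i = begin
      σ i       ≡⟨ inc-≡ i τ ⟩
      suc (τ i) ≤⟨ s≤s (τ≤ρ i) ⟩
      suc (ρ i) ≤⟨ ρ<ρ′ ⟩
      ρ′ i      ≤⟨ anti′ (<⇒≤ y<i) ⟩
      ρ′ y      ≡⟨ ρ≡ρ′-before y<i ⟨
      ρ y       ≡⟨ τ-≢ (≢-sym (<⇒≢ (<-trans y<i i<j))) ⟨
      τ y       ≤⟨ m≤m+n (τ y) _ ⟩
      σ y ∎
      where open ≤-Reasoning

    lo-σ-before : ∀ {y} → y ≤ i → lo σ y ≡ lo ρ y
    lo-σ-before {y} y≤i = trans (lo-inc-≤ τ y≤i)
      (trans (sym (lo-inc-≤ τ (≤-trans y≤i (<⇒≤ i<j)))) (lo-cong inc-τ y))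

    lo-σ-between : ∀ {y} → i < y → y ≤ j → lo σ y ≡ suc (lo ρ y)
    lo-σ-between {y} i<y y≤j = trans (lo-inc-> τ i<y) (cong suc (trans (sym (lo-inc-≤ τ y≤j)) (lo-cong inc-τ y)))

    lo-σ-after : ∀ {y} → j < y → lo σ y ≡ lo ρ y
    lo-σ-after {y} j<y = trans (lo-inc-> τ (<-trans i<j j<y)) (trans (sym (lo-inc-> τ j<y)) (lo-cong inc-τ y))

    lo-σ : ∀ y → lo ρ y ≤ lo σ y × lo σ y ≤ lo ρ′ y
    lo-σ y with y ≤? i | y ≤? j
    ... | yes y≤i | _ = ≤-reflexive (sym (lo-σ-before y≤i)) , ≤-trans (≤-reflexive (lo-σ-before y≤i)) (lo≤ y)
    ... | no y≰i | yes y≤j = ≤-trans (n≤1+n _) (≤-reflexive (sym (lo-σ-between (≰⇒> y≰i) y≤j)))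
                           , ≤-trans (≤-reflexive (lo-σ-between (≰⇒> y≰i) y≤j)) (lo-between (≰⇒> y≰i) y≤j)
    ... | no _ | no y≰j = ≤-reflexive (sym (lo-σ-after (≰⇒> y≰j)))
                        , ≤-trans (≤-reflexive (lo-σ-after (≰⇒> y≰j))) (lo≤ y)

    σ-majorized : Majorized σ
    σ-majorized = record
      { anti = σ-anti
      ; ρ≡0 = λ {y} n≤y → trans (inc-≢ τ (<⇒≢ (<-≤-trans (<-trans i<j j<n) n≤y)))
                            (trans (τ-≢ (<⇒≢ (<-≤-trans j<n n≤y))) (ρ≡0 n≤y))
      ; lo≤ = λ y → proj₂ (lo-σ y)
      ; lo≡ = trans (lo-σ-after j<n) lo≡ }

    gap-< : gap σ < gap ρ
    gap-< = ∑-mono-< n (λ y → ∸-monoʳ-≤ (lo ρ′ y) (proj₁ (lo-σ y))) {suc i} (≤-trans (s≤s i<j) j<n)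
      (∸-monoʳ-< (≤-reflexive (sym (lo-σ-between ≤-refl i<j))) (proj₂ (lo-σ (suc i))))

    transfer-total : ∀ {μ} → (∀ k → Antitone (λ y → μ y k)) →
      (S : Solution (children true ρ) μ) (S′ : Solution (children true σ) μ) →
      ∀ n k → total S (suc n) k ≤ total S′ (suc n) k
    transfer-total {μ} anti-μ S S′ n k =
      ≤-trans (≤-reflexive (total-unique (children-cong true (λ y → trans (sym (inc-τ y)) (cong (λ v → inc v τ y) (sym j≡)))) S T (suc n) k))
        (moves-total τ-anti anti-μ i (j ∸ i) (λ l< → τ≥1 (subst (_ <_) j≡ l<)) T S′ n k)
      where
      j≡ : i + (j ∸ i) ≡ j
      j≡ = m+[n∸m]≡n (<⇒≤ i<j)
      T : Solution (children true (inc (i + (j ∸ i)) τ)) μ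
      T = solution _ μ (λ p → children-cong true (λ _ → refl) p)

  majorized-total : ∀ {ρ μ} → Majorized ρ → (∀ k → Antitone (λ y → μ y k)) →
    (S : Solution (children true ρ) μ) (S′ : Solution (children true ρ′) μ) →
    ∀ m k → total S (suc m) k ≤ total S′ (suc m) k
  majorized-total {ρ} {μ} M anti-μ = go (suc (gap ρ)) M ≤-refl
    where
    go : ∀ g {ρ} → Majorized ρ → gap ρ < g → (S : Solution (children true ρ) μ) (S′ : Solution (children true ρ′) μ) →
      ∀ m k → total S (suc m) k ≤ total S′ (suc m) k
    go (suc g) {ρ} M gap<g S S′ m k with anyUpTo? (λ y → lo ρ y <? lo ρ′ y) (suc n)
    ... | no ∄ = ≤-reflexive (total-unique (children-cong true ρ≡ρ′) S S′ (suc m) k)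
      where
      open Majorized M
      lo-≡ : ∀ {y} → y ≤ n → lo ρ y ≡ lo ρ′ y
      lo-≡ {y} y≤n = ≤-antisym (lo≤ y) (≮⇒≥ λ lo< → ∄ (y , s≤s y≤n , lo<))
      ρ≡ρ′ : ∀ y → ρ y ≡ ρ′ y
      ρ≡ρ′ y with y <? n
      ... | yes y<n = +-cancelˡ-≡ (lo ρ y) _ _ (trans (lo-≡ y<n) (cong (_+ ρ′ y) (sym (lo-≡ (<⇒≤ y<n)))))
      ... | no y≮n = trans (ρ≡0 (≮⇒≥ y≮n)) (sym (ρ′≡0 (≮⇒≥ y≮n)))
    ... | yes (x , s≤s x≤n , lo<) with first-change (λ y → lo ρ y <? lo ρ′ y) 0 x (<-irrefl refl) lo<
    ...   | i , _ , i<x , lo<i , before with first-change (λ y → lo ρ y ≟ lo ρ′ y) (suc i) (n ∸ suc i) (<⇒≢ lo<i)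
                (subst (λ v → lo ρ v ≡ lo ρ′ v) (sym (m+[n∸m]≡n (≤-trans i<x x≤n))) (Majorized.lo≡ M))
    ...     | j , i<j , j< , lo≡j , between =
      ≤-trans (Tr.transfer-total anti-μ S T m k)
        (go g Tr.σ-majorized (<-≤-trans Tr.gap-< (s≤s⁻¹ gap<g)) T S′ m k)
      where
      open Majorized M
      module Tr = Transfer M i<j (subst (j <_) (m+[n∸m]≡n (≤-trans i<x x≤n)) j<)
        (λ {y} y≤i → ≤-antisym (lo≤ y) (≮⇒≥ (before z≤n y≤i)))
        (λ {y} i<y y≤j → ≤∧≢⇒< (lo≤ y) (between i<y y≤j)) lo≡j
      T : Solution (children true Tr.σ) μ
      T = solution _ μ (λ p → children-cong true (λ _ → refl) p)

-- Walk generating functions of a forest given by its father matrix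

∑-zero : ∀ n {f} → (∀ j → j < n → f j ≡ 0) → ∑ n f ≡ 0
∑-zero zero p = refl
∑-zero (suc n) p = cong₂ _+_ (∑-zero n (λ j j<n → p j (m≤n⇒m≤1+n j<n))) (p n ≤-refl)

∑-only : ∀ n {f v} → v < n → (∀ j → j < n → j ≢ v → f j ≡ 0) → ∑ n f ≡ f v
∑-only (suc n) {f} {v} v<1+n p with v ≟ n
... | yes refl = cong (_+ f v) (∑-zero n λ j j<n → p j (m≤n⇒m≤1+n j<n) (<⇒≢ j<n))
... | no v≢n = trans (cong₂ _+_ (∑-only n (≤∧≢⇒< (s≤s⁻¹ v<1+n) v≢n) (λ j j<n → p j (m≤n⇒m≤1+n j<n)))
                 (p n ≤-refl (v≢n ∘ sym))) (+-identityʳ (f v))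

∑-+ : ∀ n f g → ∑ n (λ j → f j + g j) ≡ ∑ n f + ∑ n g
∑-+ zero f g = refl
∑-+ (suc n) f g = trans (cong (_+ (f n + g n)) (∑-+ n f g)) (+-interchange (∑ n f) (∑ n g) (f n) (g n))

∑-*ˡ : ∀ n c f → ∑ n (λ j → c * f j) ≡ c * ∑ n f
∑-*ˡ zero c f = sym (*-zeroʳ c)
∑-*ˡ (suc n) c f = trans (cong (_+ c * f n) (∑-*ˡ n c f)) (sym (*-distribˡ-+ c (∑ n f) (f n)))

∑-swap : ∀ m n (f : ℕ → ℕ → ℕ) → ∑ m (λ i → ∑ n (f i)) ≡ ∑ n (λ j → ∑ m (λ i → f i j))
∑-swap zero n f = sym (∑-zero n λ _ _ → refl)
∑-swap (suc m) n f = trans (cong (_+ ∑ n (f m)) (∑-swap m n f)) (sym (∑-+ n (λ j → ∑ m (λ i → f i j)) (f m)))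

∑-⊛ : ∀ n (c : ℕ → ℕ) (F : ℕ → Series) G k →
  ∑ n (λ z → c z * (F z ⊛ G) k) ≡ ((λ j → ∑ n (λ z → c z * F z j)) ⊛ G) k
∑-⊛ zero c F G k = sym (⊛-zeroˡ G k)
∑-⊛ (suc n) c F G k = trans
  (cong₂ _+_ (∑-⊛ n c F G k) (sym (⊛-scaleˡ (c n) (F n) G k)))
  (sym (⊛-distribʳ G (λ j → ∑ n (λ z → c z * F z j)) (λ j → c n * F n j) k))

*-congʳ-nonzero : ∀ c {a b} → (0 < c → a ≡ b) → c * a ≡ c * b
*-congʳ-nonzero zero p = refl
*-congʳ-nonzero (suc c) p = cong (suc c *_) (p z<s)

-- K y x is 1 if y is the father of x and 0 otherwise.
module Walks (n : ℕ) (K : ℕ → ℕ → ℕ)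
  (K≤1 : ∀ y x → K y x ≤ 1)
  (K-< : ∀ {y x} → 0 < K y x → y < x)
  (K-unique : ∀ {y z x} → 0 < K y x → 0 < K z x → y ≡ z) where

  A : ℕ → ℕ → ℕ
  A w z = K w z + K z w

  N : ℕ → ℕ → Series
  N w u zero = single u 1 w
  N w u (suc k) = ∑ n (λ z → A w z * N z u k)

  N-sucʳ : ∀ w u → w < n → u < n → ∀ k → N w u (suc k) ≡ ∑ n (λ z → N w z k * A z u)
  N-sucʳ w u w<n u<n zero = begin
    ∑ n (λ z → A w z * single u 1 z)
      ≡⟨ ∑-only n u<n (λ z _ z≢u → trans (cong (A w z *_) (single-≢ 1 (z≢u ∘ sym))) (*-zeroʳ (A w z))) ⟩
    A w u * single u 1 u
      ≡⟨ trans (cong (A w u *_) (single-≡ u 1)) (*-identityʳ (A w u)) ⟩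
    A w u
      ≡⟨ sym (trans (cong (_* A w u) (single-≡ w 1)) (*-identityˡ (A w u))) ⟩
    single w 1 w * A w u
      ≡⟨ sym (∑-only n {λ z → single z 1 w * A z u} w<n (λ z _ z≢w → cong (_* A z u) (single-≢ 1 z≢w))) ⟩
    ∑ n (λ z → single z 1 w * A z u) ∎
    where open ≡-Reasoning
  N-sucʳ w u w<n u<n (suc k) = begin
    ∑ n (λ z → A w z * N z u (suc k))
      ≡⟨ ∑-cong n (λ z z<n → trans (cong (A w z *_) (N-sucʳ z u z<n u<n k)) (sym (∑-*ˡ n (A w z) _))) ⟩
    ∑ n (λ z → ∑ n (λ y → A w z * (N z y k * A y u)))
      ≡⟨ ∑-swap n n _ ⟩
    ∑ n (λ y → ∑ n (λ z → A w z * (N z y k * A y u)))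
      ≡⟨ ∑-cong n (λ y _ → trans (∑-cong n λ z _ → rotate (A w z) (N z y k) (A y u))
           (trans (∑-*ˡ n (A y u) _) (*-comm (A y u) _))) ⟩
    ∑ n (λ y → N w y (suc k) * A y u) ∎
    where
    open ≡-Reasoning
    rotate : ∀ a b c → a * (b * c) ≡ c * (a * b)
    rotate = solve-∀

  N-sym : ∀ k {w u} → w < n → u < n → N w u k ≡ N u w k
  N-sym zero {w} {u} _ _ with u ≟ w
  ... | yes refl = refl
  ... | no u≢w = trans (single-≢ 1 u≢w) (sym (single-≢ 1 (u≢w ∘ sym)))
  N-sym (suc k) {w} {u} w<n u<n = trans
    (∑-cong n λ z z<n → trans (*-comm (A w z) _) (cong₂ _*_ (N-sym k z<n u<n) (+-comm (K w z) (K z w))))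
    (sym (N-sucʳ u w u<n w<n k))

  down up : (ℕ → Series) → ℕ → Series
  down F w k = ∑ n (λ z → K w z * F z k)
  up F w k = ∑ n (λ z → K z w * F z k)

  N-eq : ∀ w u → N w u ≗ (λ k → single u (1s k) w) ⊕ X ⊛ up (λ z → N z u) w ⊕ X ⊛ down (λ z → N z u) w
  N-eq w u zero = sym (trans (+-identityʳ _) (+-identityʳ _))
  N-eq w u (suc k) = begin
    ∑ n (λ z → A w z * N z u k)
      ≡⟨ ∑-cong n (λ z _ → trans (*-distribʳ-+ (N z u k) (K w z) (K z w)) (+-comm (K w z * N z u k) _)) ⟩
    ∑ n (λ z → K z w * N z u k + K w z * N z u k)
      ≡⟨ ∑-+ n _ _ ⟩
    up (λ z → N z u) w k + down (λ z → N z u) w k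
      ≡⟨ cong₂ _+_ (sym (X-⊛-suc (up (λ z → N z u) w) k)) (sym (X-⊛-suc (down (λ z → N z u) w) k)) ⟩
    (X ⊛ up (λ z → N z u) w) (suc k) + (X ⊛ down (λ z → N z u) w) (suc k)
      ≡⟨ cong (λ v → v + (X ⊛ up (λ z → N z u) w) (suc k) + (X ⊛ down (λ z → N z u) w) (suc k)) (sym (single-0 u w)) ⟩
    single u 0 w + (X ⊛ up (λ z → N z u) w) (suc k) + (X ⊛ down (λ z → N z u) w) (suc k) ∎
    where
    open ≡-Reasoning
    single-0 : ∀ u w → single u 0 w ≡ 0
    single-0 u w with u ≟ w
    ... | yes refl = single-≡ u 0
    ... | no u≢w = single-≢ 0 u≢w

  up-child : ∀ F {w z} → w < n → 0 < K w z → up F z ≗ F w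
  up-child F {w} {z} w<n Kwz k = trans
    (∑-only n w<n λ y _ y≢w → cong (_* F y k) (n≤0⇒n≡0 (≮⇒≥ λ Kyz → y≢w (K-unique Kyz Kwz))))
    (trans (cong (_* F w k) (≤-antisym (K≤1 w z) Kwz)) (*-identityˡ (F w k)))

  module _ {L : RowOp} {μ : ℕ → Series} (S : Solution L μ)
    (L-K : ∀ a {y} → y < n → L a y ≡ ∑ n (λ x → K y x * a x)) where
    open Solution S

    D-eq′ : ∀ {w} → w < n → D w ≗ 1s ⊕ t ⊛ (down D w ⊛ D w)
    D-eq′ {w} w<n = S.trans (D-eq w) (S.+-cong {1s} (λ _ → refl) (⊛-cong {t} (λ _ → refl)
      (⊛-cong (λ k → L-K (λ x → D x k) w<n) (λ _ → refl))))

    down-N : ∀ {w u} → w < n → (∀ {z} → z < n → 0 < K w z → N z u ≗ D z ⊛ (X ⊛ up (λ y → N y u) z)) →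
      down (λ z → N z u) w ≗ down D w ⊛ (X ⊛ N w u)
    down-N {w} {u} w<n IH k = trans
      (∑-cong n λ z z<n → *-congʳ-nonzero (K w z) λ Kwz → trans (IH z<n Kwz k)
        (⊛-cong {D z} (λ _ → refl) (⊛-cong {X} (λ _ → refl) (up-child (λ y → N y u) w<n Kwz)) k))
      (∑-⊛ n (K w) D (X ⊛ N w u) k)

    -- Decomposition by the first step. A step down to a child `z` must come back to `w`, which
    -- costs `D z` and two steps; this gives an equation with the same kernel as that of `D w`, and
    -- `resolvent-unique` applies.
    N-resolvent : ∀ {w u c} → w < n → (∀ k → single u (1s k) w ≡ c k) →
      (∀ {z} → z < n → 0 < K w z → N z u ≗ D z ⊛ (X ⊛ up (λ y → N y u) z)) →
      N w u ≗ D w ⊛ (c ⊕ X ⊛ up (λ z → N z u) w)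
    N-resolvent {w} {u} {c} w<n c≡ IH = resolvent-unique {D w} {down D w} (D-eq′ w<n) (begin
      N w u
        ≈⟨ N-eq w u ⟩
      (λ k → single u (1s k) w) ⊕ X ⊛ up (λ z → N z u) w ⊕ X ⊛ down (λ z → N z u) w
        ≈⟨ S.+-cong (S.+-cong c≡ (λ _ → refl)) (⊛-cong {X} (λ _ → refl) (down-N w<n IH)) ⟩
      c ⊕ X ⊛ up (λ z → N z u) w ⊕ X ⊛ (down D w ⊛ (X ⊛ N w u))
        ≈⟨ SS.solve 4 (λ Y x d N → Y :+ x :* (d :* (x :* N)) := Y :+ x :* x :* (d :* N)) S.refl
             (c ⊕ X ⊛ up (λ z → N z u) w) X (down D w) (N w u) ⟩
      c ⊕ X ⊛ up (λ z → N z u) w ⊕ t ⊛ (down D w ⊛ N w u) ∎)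
      where open Series≗

    -- A walk from w to a vertex u < w leaves the branch of w through the father of w.
    N-exit : ∀ d {w u} → n ≤ w + d → w < n → u < w → N w u ≗ D w ⊛ (X ⊛ up (λ z → N z u) w)
    N-exit zero {w} n≤w w<n _ = contradiction (subst (n ≤_) (+-identityʳ w) n≤w) (<⇒≱ w<n)
    N-exit (suc d) {w} {u} n≤ w<n u<w = N-resolvent {c = 0s} w<n
      (λ k → single-≢ (1s k) (<⇒≢ u<w))
      (λ {z} z<n Kwz → N-exit d (≤-trans (subst (n ≤_) (+-suc w d) n≤) (+-monoˡ-≤ d (K-< Kwz))) z<n (<-trans u<w (K-< Kwz)))

    closed : ℕ → Series
    closed w = N w w

    N-exit′ : ∀ {w u} → w < n → u < w → N w u ≗ D w ⊛ (X ⊛ up (λ z → N z u) w)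
    N-exit′ {w} w<n u<w = N-exit n (m≤n+m n w) w<n u<w

    -- The walks in question start at the father and end at `w`. They are reversed by `N-sym`, so
    -- that they leave the branch of `w` and `N-exit′` describes them.
    up-N : ∀ {w} → w < n → up (λ z → N z w) w ≗ up closed w ⊛ (X ⊛ D w)
    up-N {w} w<n k = trans
      (∑-cong n λ z z<n → *-congʳ-nonzero (K z w) λ Kzw → begin
        N z w k
          ≡⟨ N-sym k z<n w<n ⟩
        N w z k
          ≡⟨ N-exit′ w<n (K-< Kzw) k ⟩
        (D w ⊛ (X ⊛ up (λ y → N y z) w)) k
          ≡⟨ ⊛-cong {D w} (λ _ → refl) (⊛-cong {X} (λ _ → refl) (up-child (λ y → N y z) z<n Kzw)) k ⟩
        (D w ⊛ (X ⊛ closed z)) k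
          ≡⟨ SS.solve 3 (λ d x c → d :* (x :* c) := c :* (x :* d)) S.refl (D w) X (closed z) k ⟩
        (closed z ⊛ (X ⊛ D w)) k ∎)
      (∑-⊛ n (λ z → K z w) closed (X ⊛ D w) k)
      where open ≡-Reasoning

    -- `up closed w` has the series of the father as its only term and vanishes for a vertex without
    -- a father, so one equation serves roots and other vertices.
    closed-eq : ∀ {w} → w < n → closed w ≗ D w ⊕ t ⊛ (D w ⊛ D w ⊛ up closed w)
    closed-eq {w} w<n = begin
      N w w
        ≈⟨ N-resolvent {w} {w} {1s} w<n (λ k → single-≡ w (1s k)) (λ z<n Kwz → N-exit′ z<n (K-< Kwz)) ⟩
      D w ⊛ (1s ⊕ X ⊛ up (λ z → N z w) w)
        ≈⟨ ⊛-cong {D w} (λ _ → refl) (S.+-cong {1s} (λ _ → refl) (⊛-cong {X} (λ _ → refl) (up-N w<n))) ⟩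
      D w ⊛ (1s ⊕ X ⊛ (up closed w ⊛ (X ⊛ D w)))
        ≈⟨ SS.solve 3 (λ d x c → d :* (con 1 :+ x :* (c :* (x :* d))) := d :+ x :* x :* (d :* d :* c)) S.refl
             (D w) X (up closed w) ⟩
      D w ⊕ t ⊛ (D w ⊛ D w ⊛ up closed w) ∎
      where open Series≗

    E-eq′ : ∀ {w} → w < n → E w ≗ μ w ⊕ t ⊛ down (λ x → D x ⊛ D x ⊛ E x) w
    E-eq′ {w} w<n = S.trans (E-eq w) (S.+-cong {μ w} (λ _ → refl) (⊛-cong {t} (λ _ → refl)
      (λ k → L-K (λ x → (D x ⊛ D x ⊛ E x) k) w<n)))

    ∑-⊛-const : ∀ P (F : ℕ → Series) k → ∑ n (λ w → (P ⊛ F w) k) ≡ (P ⊛ (λ j → ∑ n (λ w → F w j))) k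
    ∑-⊛-const P F k = begin
      ∑ n (λ w → (P ⊛ F w) k)      ≡⟨ ∑-cong n (λ w _ → trans (⊛-comm P (F w) k) (sym (*-identityˡ _))) ⟩
      ∑ n (λ w → 1 * (F w ⊛ P) k)  ≡⟨ ∑-⊛ n (λ _ → 1) F P k ⟩
      ((λ j → ∑ n (λ w → 1 * F w j)) ⊛ P) k
        ≡⟨ ⊛-cong {g = P} (λ j → ∑-cong n (λ w _ → *-identityˡ (F w j))) (λ _ → refl) k ⟩
      ((λ j → ∑ n (λ w → F w j)) ⊛ P) k ≡⟨ ⊛-comm _ P k ⟩
      (P ⊛ (λ j → ∑ n (λ w → F w j))) k ∎
      where open ≡-Reasoning

    -- `up` and `down` are multiplication by transposed matrices; this is the duality that exchanges
    -- the equation of `closed` for that of `E`.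
    adjoint : ∀ (F G : ℕ → Series) k → ∑ n (λ w → (F w ⊛ up G w) k) ≡ ∑ n (λ w → (down F w ⊛ G w) k)
    adjoint F G k = begin
      ∑ n (λ w → (F w ⊛ up G w) k)
        ≡⟨ ∑-cong n (λ w _ → trans (⊛-comm (F w) (up G w) k) (sym (∑-⊛ n (λ z → K z w) G (F w) k))) ⟩
      ∑ n (λ w → ∑ n (λ z → K z w * (G z ⊛ F w) k))
        ≡⟨ ∑-swap n n _ ⟩
      ∑ n (λ z → ∑ n (λ w → K z w * (G z ⊛ F w) k))
        ≡⟨ ∑-cong n (λ z _ → trans (∑-cong n λ w _ → cong (K z w *_) (⊛-comm (G z) (F w) k)) (∑-⊛ n (K z) F (G z) k)) ⟩
      ∑ n (λ w → (down F w ⊛ G w) k) ∎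
      where open ≡-Reasoning

    -- Both sides arise from ∑ E w ⊛ closed w, by expanding closed w and E w respectively.
    weighted-closed-walks : ∀ k → ∑ n (λ w → (μ w ⊛ closed w) k) ≡ total S n k
    weighted-closed-walks k = +-cancelʳ-≡ _ _ _ (begin
      ∑ n (λ w → (μ w ⊛ closed w) k) + (t ⊛ (λ j → ∑ n (λ w → (down DDE w ⊛ closed w) j))) k
        ≡⟨ cong (∑ n (λ w → (μ w ⊛ closed w) k) +_) (sym (∑-⊛-const t (λ w → down DDE w ⊛ closed w) k)) ⟩
      ∑ n (λ w → (μ w ⊛ closed w) k) + ∑ n (λ w → (t ⊛ (down DDE w ⊛ closed w)) k)
        ≡⟨ ∑-+ n _ _ ⟨
      ∑ n (λ w → (μ w ⊛ closed w ⊕ t ⊛ (down DDE w ⊛ closed w)) k)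
        ≡⟨ ∑-cong n (λ w w<n → sym (trans (⊛-cong {g = closed w} (E-eq′ w<n) (λ _ → refl) k)
             (SS.solve 4 (λ m t d c → (m :+ t :* d) :* c := m :* c :+ t :* (d :* c)) S.refl (μ w) t (down DDE w) (closed w) k))) ⟩
      ∑ n (λ w → (E w ⊛ closed w) k)
        ≡⟨ ∑-cong n (λ w w<n → trans (⊛-cong {E w} (λ _ → refl) (closed-eq w<n) k)
             (SS.solve 4 (λ e d t c → e :* (d :+ t :* (d :* d :* c)) := d :* e :+ t :* (d :* d :* e :* c)) S.refl
               (E w) (D w) t (up closed w) k)) ⟩
      ∑ n (λ w → (D w ⊛ E w ⊕ t ⊛ (DDE w ⊛ up closed w)) k)
        ≡⟨ ∑-+ n _ _ ⟩
      ∑ n (λ w → (D w ⊛ E w) k) + ∑ n (λ w → (t ⊛ (DDE w ⊛ up closed w)) k)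
        ≡⟨ cong (∑ n (λ w → (D w ⊛ E w) k) +_) (∑-⊛-const t (λ w → DDE w ⊛ up closed w) k) ⟩
      ∑ n (λ w → (D w ⊛ E w) k) + (t ⊛ (λ j → ∑ n (λ w → (DDE w ⊛ up closed w) j))) k
        ≡⟨ cong (∑ n (λ w → (D w ⊛ E w) k) +_) (⊛-cong {t} (λ _ → refl) (adjoint DDE closed) k) ⟩
      ∑ n (λ w → (D w ⊛ E w) k) + (t ⊛ (λ j → ∑ n (λ w → (down DDE w ⊛ closed w) j))) k ∎)
      where
      open ≡-Reasoning
      DDE : ℕ → Series
      DDE x = D x ⊛ D x ⊛ E x

-- The tree described by a code

indicator : ∀ {P : Set} → Dec P → ℕ
indicator P? = if does P? then 1 else 0

indicator-yes : ∀ {P : Set} (P? : Dec P) → P → indicator P? ≡ 1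
indicator-yes P? p rewrite dec-true P? p = refl

indicator-no : ∀ {P : Set} (P? : Dec P) → ¬ P → indicator P? ≡ 0
indicator-no P? ¬p rewrite dec-false P? ¬p = refl

indicator≤1 : ∀ {P : Set} (P? : Dec P) → indicator P? ≤ 1
indicator≤1 (yes _) = ≤-refl
indicator≤1 (no _) = z≤n

indicator-true : ∀ {P : Set} (P? : Dec P) → 0 < indicator P? → P
indicator-true (yes p) _ = p

indicator-⇔ : ∀ {P Q : Set} (P? : Dec P) (Q? : Dec Q) → (P → Q) → (Q → P) → indicator P? ≡ indicator Q?
indicator-⇔ (yes p) Q? f g = sym (indicator-yes Q? (f p))
indicator-⇔ (no ¬p) Q? f g = sym (indicator-no Q? (¬p ∘ g))

∑-split : ∀ m n f → ∑ (m + n) f ≡ ∑ m f + ∑ n (λ j → f (m + j))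
∑-split m zero f = trans (cong (λ v → ∑ v f) (+-identityʳ m)) (sym (+-identityʳ _))
∑-split m (suc n) f = trans (cong (λ v → ∑ v f) (+-suc m n))
  (trans (cong (_+ f (m + n)) (∑-split m n f)) (+-assoc (∑ m f) _ _))

inRow? : ∀ ρ y x → Dec (start true ρ y ≤ x × x < lo ρ (suc y))
inRow? ρ y x = (start true ρ y ≤? x) ×-dec (x <? lo ρ (suc y))

father : (ℕ → ℕ) → ℕ → ℕ → ℕ
father ρ y x = indicator (inRow? ρ y x)

-- `lo≡n` expresses that the degrees of a tree add up to `2n - 2`: the entries below `n` have sum
-- `n - 2`. Since `lo` starts at 2, it also forces `n ≥ 2`.
record TreeCode (n : ℕ) (ρ : ℕ → ℕ) : Set where
  field
    anti : Antitone ρ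
    ρ≡0  : ∀ {y} → n ≤ y → ρ y ≡ 0
    lo≡n : lo ρ n ≡ n

lo-const : ∀ ρ y d → (∀ {i} → y ≤ i → ρ i ≡ 0) → lo ρ (y + d) ≡ lo ρ y
lo-const ρ y zero p = cong (lo ρ) (+-identityʳ y)
lo-const ρ y (suc d) p = trans (cong (lo ρ) (+-suc y d))
  (trans (cong₂ _+_ (lo-const ρ y d p) (p (m≤m+n y d))) (+-identityʳ _))

marks : ℕ → ℕ → Series
marks r y k = if does (y <? r) then 1s k else 0

marks-anti : ∀ r k → Antitone (λ y → marks r y k)
marks-anti r k {y} {z} y≤z with z <? r
... | no z≮r rewrite dec-false (z <? r) z≮r = z≤n
... | yes z<r rewrite dec-true (z <? r) z<r | dec-true (y <? r) (≤-<-trans y≤z z<r) = ≤-refl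

module CodeWalks {n : ℕ} {ρ : ℕ → ℕ} (T : TreeCode n ρ) where
  open TreeCode T

  lo≤n : ∀ y → lo ρ y ≤ n
  lo≤n y with y ≤? n
  ... | yes y≤n = ≤-trans (lo-mono ρ y≤n) (≤-reflexive lo≡n)
  ... | no y≰n = ≤-reflexive (trans (cong (lo ρ) (sym (m+[n∸m]≡n (<⇒≤ (≰⇒> y≰n))))) (trans (lo-const ρ n (y ∸ n) ρ≡0) lo≡n))

  father-< : ∀ {y x} → 0 < father ρ y x → y < x
  father-< {y} {x} f with indicator-true (inRow? ρ y x) f
  father-< {zero} f | p , _ = p
  father-< {suc y} f | p , q = ≤-trans (≤-trans (subst (_≤ suc y + 2) (+-comm (suc y) 1) (+-monoʳ-≤ (suc y) (s≤s z≤n)))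
    (lo-≥ ρ (suc y) λ i i<1+y → ≤-trans 1≤ρ (anti (<⇒≤ i<1+y)))) p
    where
    1≤ρ : 1 ≤ ρ (suc y)
    1≤ρ = +-cancelˡ-< (lo ρ (suc y)) 0 (ρ (suc y)) (subst (_< lo ρ (suc (suc y))) (sym (+-identityʳ _)) (≤-<-trans p q))

  lo≤start : ∀ {y z} → y < z → lo ρ (suc y) ≤ start true ρ z
  lo≤start {z = suc z} p = lo-mono ρ p

  father-unique : ∀ {y z x} → 0 < father ρ y x → 0 < father ρ z x → y ≡ z
  father-unique {y} {z} {x} f g with indicator-true (inRow? ρ y x) f | indicator-true (inRow? ρ z x) g | <-cmp y z
  ... | p , q | p′ , q′ | tri< y<z _ _ = contradiction (≤-trans q (≤-trans (lo≤start y<z) p′)) (<-irrefl refl)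
  ... | p , q | p′ , q′ | tri≈ _ y≡z _ = y≡z
  ... | p , q | p′ , q′ | tri> _ _ z<y = contradiction (≤-trans q′ (≤-trans (lo≤start z<y) p)) (<-irrefl refl)

  open Walks n (father ρ) (λ y x → indicator≤1 (inRow? ρ y x)) father-< father-unique public

  children-father : ∀ a {y} → y < n → children true ρ a y ≡ ∑ n (λ x → father ρ y x * a x)
  children-father a {y} _ = sym (begin
    ∑ n f
      ≡⟨ cong (λ v → ∑ v f) (sym n≡) ⟩
    ∑ (s + m + r) f
      ≡⟨ trans (∑-split (s + m) r f) (cong (_+ ∑ r (λ j → f (s + m + j))) (∑-split s m f)) ⟩
    ∑ s f + ∑ m (λ j → f (s + j)) + ∑ r (λ j → f (s + m + j))
      ≡⟨ cong₂ _+_ (cong₂ _+_ before within) after ⟩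
    0 + ∑ m (λ j → a (s + j)) + 0
      ≡⟨ +-identityʳ _ ⟩
    ∑ m (λ j → a (s + j)) ∎)
    where
    open ≡-Reasoning
    s m r : ℕ
    s = start true ρ y
    m = size true ρ y
    r = n ∸ lo ρ (suc y)
    f : ℕ → ℕ
    f x = father ρ y x * a x
    s+m : s + m ≡ lo ρ (suc y)
    s+m = start+size true ρ y
    n≡ : s + m + r ≡ n
    n≡ = trans (cong (_+ r) s+m) (m+[n∸m]≡n (lo≤n (suc y)))
    before : ∑ s f ≡ 0
    before = ∑-zero s λ j j<s → cong (_* a j) (indicator-no (inRow? ρ y j) λ (s≤j , _) → <⇒≱ j<s s≤j)
    within : ∑ m (λ j → f (s + j)) ≡ ∑ m (λ j → a (s + j))
    within = ∑-cong m λ j j<m → trans (cong (_* a (s + j)) (indicator-yes (inRow? ρ y (s + j))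
      (m≤m+n s j , subst (s + j <_) s+m (+-monoʳ-< s j<m)))) (*-identityˡ _)
    after : ∑ r (λ j → f (s + m + j)) ≡ 0
    after = ∑-zero r λ j _ → cong (_* a (s + m + j)) (indicator-no (inRow? ρ y (s + m + j))
      λ (_ , q) → <⇒≱ q (subst (_≤ s + m + j) s+m (m≤m+n (s + m) j)))

  solve : ∀ μ → Solution (children true ρ) μ
  solve μ = solution _ μ (λ p → children-cong true (λ _ → refl) p)

  marked-closed-walks : ∀ {r} → r ≤ n → ∀ k → ∑ r (λ w → N w w k) ≡ total (solve (marks r)) n k
  marked-closed-walks {r} r≤n k = trans (sym (begin
    ∑ n (λ w → (marks r w ⊛ N w w) k)
      ≡⟨ cong (λ v → ∑ v (λ w → (marks r w ⊛ N w w) k)) (sym (m+[n∸m]≡n r≤n)) ⟩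
    ∑ (r + (n ∸ r)) (λ w → (marks r w ⊛ N w w) k)
      ≡⟨ ∑-split r (n ∸ r) _ ⟩
    ∑ r (λ w → (marks r w ⊛ N w w) k) + ∑ (n ∸ r) (λ j → (marks r (r + j) ⊛ N (r + j) (r + j)) k)
      ≡⟨ cong₂ _+_ (∑-cong r λ w w<r → trans (⊛-cong {g = N w w} (marked w<r) (λ _ → refl) k) (⊛-identityˡ (N w w) k))
                   (∑-zero (n ∸ r) λ j _ → trans (⊛-cong {g = N (r + j) (r + j)} (unmarked j) (λ _ → refl) k) (⊛-zeroˡ (N (r + j) (r + j)) k)) ⟩
    ∑ r (λ w → N w w k) + 0
      ≡⟨ +-identityʳ _ ⟩
    ∑ r (λ w → N w w k) ∎)) (weighted-closed-walks (solve (marks r)) children-father k)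
    where
    open ≡-Reasoning
    marked : ∀ {w} → w < r → marks r w ≗ 1s
    marked {w} w<r j rewrite dec-true (w <? r) w<r = refl
    unmarked : ∀ i → marks r (r + i) ≗ 0s
    unmarked i j rewrite dec-false (r + i <? r) (≤⇒≯ (m≤m+n r i)) = refl

  single-closed-walks : ∀ {l} → l < n → ∀ k → N l l k ≡ total (solve (single-series l)) n k
  single-closed-walks {l} l<n k = trans (sym (begin
    ∑ n (λ w → (single-series l w ⊛ N w w) k)
      ≡⟨ ∑-only n l<n (λ w _ w≢l → trans (⊛-cong {g = N w w} (λ j → single-≢ (1s j) (w≢l ∘ sym)) (λ _ → refl) k) (⊛-zeroˡ (N w w) k)) ⟩
    (single-series l l ⊛ N l l) k
      ≡⟨ trans (⊛-cong {g = N l l} (λ j → single-≡ l (1s j)) (λ _ → refl) k) (⊛-identityˡ (N l l) k) ⟩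
    N l l k ∎)) (weighted-closed-walks (solve (single-series l)) children-father k)
    where open ≡-Reasoning

  nonempty-rows : ∃[ K ] (lo ρ K ≡ n × (∀ {i} → i < K → 1 ≤ ρ i) × (∀ {i} → K ≤ i → ρ i ≡ 0))
  nonempty-rows with ρ 0 ≟ 0
  -- Here the code vanishes identically and belongs to the tree with two vertices.
  ... | yes ρ0≡0 = 0 , trans (sym (lo-const ρ 0 n (λ {i} _ → empty i))) lo≡n , (λ ()) , λ {i} _ → empty i
    where
    empty : ∀ i → ρ i ≡ 0
    empty i = n≤0⇒n≡0 (subst (ρ i ≤_) ρ0≡0 (anti z≤n))
  ... | no ρ0≢0 with first-change (λ y → ρ y ≟ 0) 0 n ρ0≢0 (ρ≡0 ≤-refl)
  ...   | j , _ , j<n , ρ≡0′ , before = suc j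
        , trans (sym (lo-const ρ (suc j) (n ∸ suc j) empty)) (trans (cong (lo ρ) (m+[n∸m]≡n j<n)) lo≡n)
        , (λ i<1+j → n≢0⇒n>0 (before z≤n (s≤s⁻¹ i<1+j)))
        , empty
    where
    empty : ∀ {i} → suc j ≤ i → ρ i ≡ 0
    empty {i} j<i = n≤0⇒n≡0 (subst (ρ i ≤_) ρ≡0′ (anti j<i))

  closed-walks-anti-suc : ∀ {l} → suc l < n → ∀ k → N (suc l) (suc l) k ≤ N l l k
  closed-walks-anti-suc {l} 1+l<n k with nonempty-rows
  ... | K , loK , ρ≥1 , ρ≡0′ = subst₂ _≤_ (sym (single-closed-walks 1+l<n k))
          (sym (single-closed-walks (<-trans (n<1+n l) 1+l<n) k))
          (subst (λ v → total (solve (single-series (suc l))) v k ≤ total (solve (single-series l)) v k)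
            (suc-pred n {{>-nonZero (≤-trans (s≤s z≤n) 1+l<n)}})
            (marked-total ρ anti l K (subst (suc l <_) (sym loK) 1+l<n) ρ≥1 ρ≡0′
              (solve (single-series (suc l))) (solve (single-series l)) (pred n) k))

closed-walks-mono : ∀ {n ρ ρ′} (T : TreeCode n ρ) (T′ : TreeCode n ρ′) → (∀ y → y ≤ n → lo ρ y ≤ lo ρ′ y) →
  ∀ {r} → r ≤ n → ∀ k → ∑ r (λ w → CodeWalks.N T w w k) ≤ ∑ r (λ w → CodeWalks.N T′ w w k)
closed-walks-mono {zero} T T′ lo≤ {zero} r≤n k = z≤n
closed-walks-mono {suc n} {ρ} {ρ′} T T′ lo≤ {r} r≤n k = subst₂ _≤_
  (sym (C.marked-closed-walks r≤n k)) (sym (C′.marked-closed-walks r≤n k))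
  (majorized-total T′.anti T′.ρ≡0 majorized (marks-anti r) (C.solve (marks r)) (C′.solve (marks r)) n k)
  where
  module T = TreeCode T
  module T′ = TreeCode T′
  module C = CodeWalks T
  module C′ = CodeWalks T′
  lo≤′ : ∀ y → lo ρ y ≤ lo ρ′ y
  lo≤′ y with y ≤? suc n
  ... | yes y≤n = lo≤ y y≤n
  ... | no y≰n = ≤-trans (C.lo≤n y) (≤-trans (≤-reflexive (sym T′.lo≡n)) (lo-mono ρ′ (<⇒≤ (≰⇒> y≰n))))
  majorized : Majorized T′.anti T′.ρ≡0 ρ
  majorized = record { anti = T.anti ; ρ≡0 = T.ρ≡0 ; lo≤ = lo≤′ ; lo≡ = trans T.lo≡n (sym T′.lo≡n) }

-- Levels and fathers in a rooted tree

head-∷ʳ : ∀ {A : Set} {m} (xs : Vec A (suc m)) {x} → head (xs ∷ʳ x) ≡ head xs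
head-∷ʳ (_ ∷ _) = refl

last-∷ : ∀ {A : Set} {m} x (xs : Vec A (suc m)) → last (x ∷ xs) ≡ last xs
last-∷ x (_ ∷ _) = refl

all-last : ∀ {A : Set} {P : A → Set} {m} {xs : Vec A (suc m)} → All P xs → P (last xs)
all-last (p ∷ []) = p
all-last (_ ∷ ps@(_ ∷ _)) = all-last ps

all-∷ʳ : ∀ {A : Set} {P : A → Set} {m} {xs : Vec A m} {x} → All P xs → P x → All P (xs ∷ʳ x)
all-∷ʳ [] p = p ∷ []
all-∷ʳ (q ∷ qs) p = q ∷ all-∷ʳ qs p

linked-∷ʳ : ∀ {A : Set} {R : Rel A 0ℓ} {m} {xs : Vec A (suc m)} {x} → Linked R xs → R (last xs) x → Linked R (xs ∷ʳ x)
linked-∷ʳ [-] r = r ∷ [-]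
linked-∷ʳ (q ∷ qs@[-]) r = q ∷ linked-∷ʳ qs r
linked-∷ʳ (q ∷ qs@(_ ∷ _)) r = q ∷ linked-∷ʳ qs r

unique-∷ʳ : ∀ {A : Set} {m} {xs : Vec A m} {x} → Unique xs → All (_≢ x) xs → Unique (xs ∷ʳ x)
unique-∷ʳ [] [] = [] ∷ []
unique-∷ʳ (q ∷ qs) (p ∷ ps) = all-∷ʳ q p ∷ unique-∷ʳ qs ps

linked-init : ∀ {A : Set} {R : Rel A 0ℓ} {m} (w : Vec A (suc (suc m))) → Linked R w →
  ∃[ w′ ] (Linked R {suc m} w′ × head w′ ≡ head w × R (last w′) (last w))
linked-init (x ∷ y ∷ []) (r ∷ [-]) = x ∷ [] , [-] , refl , r
linked-init {R = R} (x ∷ w@(_ ∷ _ ∷ _)) (r ∷ l) with linked-init w l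
... | w′ , l′ , h≡ , r′ = x ∷ w′ , subst (R x) (sym h≡) r ∷ l′ , refl , subst (λ v → R v (last w)) (sym (last-∷ x w′)) r′

module Levels {n : ℕ} (T : RootedTree n) where
  open RootedTree T
  open IsTree isTree using (acyclic)

  h-step : ∀ {u v} → u ∼ v → h v ≤ suc (h u)
  h-step {u} {v} u∼v with h-distance u | h-distance v
  ... | (w , l , w₀ , wₗ) , _ | _ , minimal = minimal (w ∷ʳ v)
    (linked-∷ʳ l (subst (_∼ v) (sym wₗ) u∼v) , trans (head-∷ʳ w) w₀ , Vec.last-∷ʳ v w)

  h-root : h root ≡ 0
  h-root = n≤0⇒n≡0 (proj₂ (h-distance root) (root ∷ []) ([-] , refl , refl))

  h≡0⇒root : ∀ {v} → h v ≡ 0 → v ≡ root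
  h≡0⇒root {v} hv≡0 with h v | h-distance v
  h≡0⇒root refl | zero | (x ∷ [] , _ , x≡root , x≡v) , _ = trans (sym x≡v) x≡root

  -- The last but one vertex of a shortest walk from the root is a father: the walk bounds its
  -- height from above, and `h-step` bounds it from below.
  father-exists : ∀ {v j} → h v ≡ suc j → ∃[ p ] (IsFather p v × h p ≡ j)
  father-exists {v} {j} hv≡ = helper (h v) hv≡ (h-distance v)
    where
    helper : ∀ d → d ≡ suc j → IsDistance graph root v d → ∃[ p ] (IsFather p v × h p ≡ j)
    helper _ refl ((w , l , w₀ , wₗ) , _) with linked-init w l
    ... | w′ , l′ , h≡ , r = p , (p∼v , trans hv≡ (cong suc (sym hp≡j))) , hp≡j
      where
      p : Fin n
      p = last w′
      p∼v : p ∼ v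
      p∼v = subst (p ∼_) wₗ r
      hp≡j : h p ≡ j
      hp≡j = ≤-antisym (proj₂ (h-distance p) w′ (l′ , trans h≡ w₀ , refl))
        (s≤s⁻¹ (subst (_≤ suc (h p)) hv≡ (h-step p∼v)))

  -- Such a path could be extended by the fathers of its ends, until it closes up to a cycle.
  no-detour : ∀ j {m} (w : Vec (Fin n) (suc (suc m))) → Linked _∼_ w → Unique w → All (λ x → j ≤ h x) w →
    ¬ (h (head w) ≡ j × h (last w) ≡ j)
  no-detour zero (x ∷ w) l (x∉w ∷ _) _ (hx , hy) = all-last x∉w (trans (h≡0⇒root hx) (sym (h≡0⇒root (trans (cong h (sym (last-∷ x w))) hy))))
  no-detour (suc j) w l uniq levels (hx , hy) with father-exists hx | father-exists hy
  ... | p , (p∼x , _) , hp | q , (q∼y , _) , hq with p Fin.≟ q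
  ...   | yes refl = acyclic (p ∷ w) (p∼x ∷ l) (All.map (λ j<hx p≡x → <⇒≢ j<hx (trans (sym hp) (cong h p≡x))) levels ∷ uniq)
                       (subst (_∼ p) (sym (last-∷ p w)) (symm q∼y))
  ...   | no p≢q = no-detour j (p ∷ (w ∷ʳ q))
      (subst (p ∼_) (sym (head-∷ʳ w)) p∼x ∷ linked-∷ʳ l (symm q∼y))
      (all-∷ʳ (All.map (λ j<hx p≡x → <⇒≢ j<hx (trans (sym hp) (cong h p≡x))) levels) p≢q
        ∷ unique-∷ʳ uniq (All.map (λ j<hx x≡q → <⇒≢ j<hx (trans (sym hq) (cong h (sym x≡q)))) levels))
      (≤-reflexive (sym hp) ∷ all-∷ʳ (All.map <⇒≤ levels) (≤-reflexive (sym hq)))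
      (hp , trans (cong h (trans (last-∷ p (w ∷ʳ q)) (Vec.last-∷ʳ q w))) hq)

  levels-differ : ∀ {u v} → u ∼ v → h u ≢ h v
  levels-differ {u} {v} u∼v hu≡hv = no-detour (h u) (u ∷ v ∷ []) (u∼v ∷ [-])
    (((λ u≡v → irrefl u≡v u∼v) ∷ []) ∷ [] ∷ []) (≤-refl ∷ ≤-reflexive hu≡hv ∷ []) (refl , sym hu≡hv)

  father-unique : ∀ {p q v} → IsFather p v → IsFather q v → p ≡ q
  father-unique {p} {q} {v} (p∼v , hv≡) (q∼v , hv≡′) with p Fin.≟ q
  ... | yes p≡q = p≡q
  ... | no p≢q = contradiction (refl , sym (suc-injective (trans (sym hv≡) hv≡′)))
    (no-detour (h p) (p ∷ v ∷ q ∷ []) (p∼v ∷ symm q∼v ∷ [-])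
      (((λ p≡v → irrefl p≡v p∼v) ∷ p≢q ∷ []) ∷ ((λ v≡q → irrefl (sym v≡q) q∼v) ∷ []) ∷ [] ∷ [])
      (≤-refl ∷ ≤-trans (n≤1+n _) (≤-reflexive (sym hv≡)) ∷ ≤-reflexive (suc-injective (trans (sym hv≡) hv≡′)) ∷ []))

  adjacent⇒father : ∀ {u v} → u ∼ v → IsFather u v ⊎ IsFather v u
  adjacent⇒father {u} {v} u∼v with m≤n⇒m<n∨m≡n (h-step u∼v) | m≤n⇒m<n∨m≡n (h-step (symm u∼v))
  ... | inj₂ hv≡ | _ = inj₁ (u∼v , hv≡)
  ... | inj₁ _ | inj₂ hu≡ = inj₂ (symm u∼v , hu≡)
  ... | inj₁ hv< | inj₁ hu< = contradiction (≤-antisym (s≤s⁻¹ hu<) (s≤s⁻¹ hv<)) (levels-differ u∼v)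

  isFather? : ∀ u v → Dec (IsFather u v)
  isFather? u v = (u ∼? v) ×-dec (h v ≟ suc (h u))

  root-fatherless : ∀ {p} → ¬ IsFather p root
  root-fatherless (_ , h≡) = 1+n≢0 (trans (sym h≡) h-root)

  fatherOf : ∀ {v} → v ≢ root → ∃[ p ] IsFather p v
  fatherOf {v} v≢root with h v in eq
  ... | zero = contradiction (h≡0⇒root eq) v≢root
  ... | suc j with father-exists eq
  ...   | p , (p∼v , hv≡) , _ = p , p∼v , trans (sym eq) hv≡

-- Counting in lists and over finite sets; recursion for the number of walks

∑ᶠ-toℕ : ∀ n (g : ℕ → ℕ) → ∑ᶠ {n} (g ∘ toℕ) ≡ ∑ n g
∑ᶠ-toℕ zero g = refl
∑ᶠ-toℕ (suc n) g = trans (cong (g 0 +_) (∑ᶠ-toℕ n (g ∘ suc))) (sym (∑-suc n g))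

∑ᶠ-mono-≤ : ∀ {n} {f g : Fin n → ℕ} → (∀ i → f i ≤ g i) → ∑ᶠ f ≤ ∑ᶠ g
∑ᶠ-mono-≤ {zero} p = z≤n
∑ᶠ-mono-≤ {suc n} p = +-mono-≤ (p Fin.zero) (∑ᶠ-mono-≤ (p ∘ Fin.suc))

∑ᶠ-mono-< : ∀ {n} {f g : Fin n → ℕ} → (∀ i → f i ≤ g i) → ∀ i → f i < g i → ∑ᶠ f < ∑ᶠ g
∑ᶠ-mono-< p Fin.zero f<g = +-mono-<-≤ f<g (∑ᶠ-mono-≤ (p ∘ Fin.suc))
∑ᶠ-mono-< p (Fin.suc i) f<g = +-mono-≤-< (p Fin.zero) (∑ᶠ-mono-< (p ∘ Fin.suc) i f<g)

∑ᶠ-one : ∀ n → ∑ᶠ {n} (λ _ → 1) ≡ n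
∑ᶠ-one zero = refl
∑ᶠ-one (suc n) = cong suc (∑ᶠ-one n)

∑ᶠ-zero : ∀ {n} {f : Fin n → ℕ} → (∀ i → f i ≡ 0) → ∑ᶠ f ≡ 0
∑ᶠ-zero {zero} p = refl
∑ᶠ-zero {suc n} p = cong₂ _+_ (p Fin.zero) (∑ᶠ-zero (p ∘ Fin.suc))

∑ᶠ-only : ∀ {n} {f : Fin n → ℕ} v → (∀ i → i ≢ v → f i ≡ 0) → ∑ᶠ f ≡ f v
∑ᶠ-only {f = f} Fin.zero p = trans (cong (f Fin.zero +_) (∑ᶠ-zero (λ i → p (Fin.suc i) λ ()))) (+-identityʳ _)
∑ᶠ-only {f = f} (Fin.suc v) p =
  cong₂ _+_ (p Fin.zero λ ()) (∑ᶠ-only v (λ i i≢v → p (Fin.suc i) (i≢v ∘ Fin.suc-injective)))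

count : ∀ {A : Set} {P : Pred A 0ℓ} → Decidable P → List A → ℕ
count P? xs = length (filter P? xs)

count-∷ : ∀ {A : Set} {P : Pred A 0ℓ} (P? : Decidable P) x xs → count P? (x ∷ xs) ≡ indicator (P? x) + count P? xs
count-∷ P? x xs with P? x
... | yes _ = refl
... | no _ = refl

count-tabulate : ∀ {A : Set} {P : Pred A 0ℓ} (P? : Decidable P) {n} (f : Fin n → A) →
  count P? (tabulate f) ≡ ∑ᶠ (λ i → indicator (P? (f i)))
count-tabulate P? {zero} f = refl
count-tabulate P? {suc n} f = trans (count-∷ P? (f Fin.zero) (tabulate (f ∘ Fin.suc)))
  (cong (indicator (P? (f Fin.zero)) +_) (count-tabulate P? (f ∘ Fin.suc)))

count-map-++ : ∀ {A B : Set} {P : Pred B 0ℓ} (P? : Decidable P) (f : A → B) xs ys →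
  count P? (List.map f xs ++ ys) ≡ count (P? ∘ f) xs + count P? ys
count-map-++ P? f [] ys = refl
count-map-++ P? f (x ∷ xs) ys = begin
  count P? (f x ∷ List.map f xs ++ ys)
    ≡⟨ count-∷ P? (f x) _ ⟩
  indicator (P? (f x)) + count P? (List.map f xs ++ ys)
    ≡⟨ cong (indicator (P? (f x)) +_) (count-map-++ P? f xs ys) ⟩
  indicator (P? (f x)) + (count (P? ∘ f) xs + count P? ys)
    ≡⟨ +-assoc (indicator (P? (f x))) _ _ ⟨
  indicator (P? (f x)) + count (P? ∘ f) xs + count P? ys
    ≡⟨ cong (_+ count P? ys) (count-∷ (P? ∘ f) x xs) ⟨
  count (P? ∘ f) (x ∷ xs) + count P? ys ∎
  where open ≡-Reasoning

count-product : ∀ {A B C : Set} {P : Pred C 0ℓ} (P? : Decidable P) (_·_ : A → B → C) {n} (f : Fin n → A) ys →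
  count P? (cartesianProductWith _·_ (tabulate f) ys) ≡ ∑ᶠ (λ i → count (P? ∘ (f i ·_)) ys)
count-product P? _·_ {zero} f ys = refl
count-product P? _·_ {suc n} f ys = trans
  (count-map-++ P? (f Fin.zero ·_) ys (cartesianProductWith _·_ (tabulate (f ∘ Fin.suc)) ys))
  (cong (count (P? ∘ (f Fin.zero ·_)) ys +_) (count-product P? _·_ (f ∘ Fin.suc) ys))

count-⇔ : ∀ {A : Set} {P Q : Pred A 0ℓ} (P? : Decidable P) (Q? : Decidable Q) →
  (∀ x → P x → Q x) → (∀ x → Q x → P x) → ∀ xs → count P? xs ≡ count Q? xs
count-⇔ P? Q? f g [] = refl
count-⇔ P? Q? f g (x ∷ xs) = trans (count-∷ P? x xs)
  (trans (cong₂ _+_ (indicator-⇔ (P? x) (Q? x) (f x) (g x)) (count-⇔ P? Q? f g xs)) (sym (count-∷ Q? x xs)))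

count-none : ∀ {A : Set} {P : Pred A 0ℓ} (P? : Decidable P) → (∀ x → ¬ P x) → ∀ xs → count P? xs ≡ 0
count-none P? ¬P [] = refl
count-none P? ¬P (x ∷ xs) = trans (count-∷ P? x xs) (cong₂ _+_ (indicator-no (P? x) (¬P x)) (count-none P? ¬P xs))

injective⇒surjective : ∀ {n} {f : Fin n → Fin n} → Injective _≡_ _≡_ f → ∀ y → ∃[ x ] f x ≡ y
injective⇒surjective {suc n} {f} inj y with Fin.any? (λ x → f x Fin.≟ y)
... | yes x,fx≡y = x,fx≡y
... | no ∄x = contradiction (Fin.injective⇒≤ avoid-injective) (<⇒≱ (n<1+n n))
  where
  y≢f : ∀ x → y ≢ f x
  y≢f x y≡fx = ∄x (x , sym y≡fx)
  avoid : Fin (suc n) → Fin n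
  avoid x = punchOut (y≢f x)
  avoid-injective : Injective _≡_ _≡_ avoid
  avoid-injective {x} {x′} eq = inj (Fin.punchOut-injective (y≢f x) (y≢f x′) eq)

module ClosedWalks {n : ℕ} (G : Graph n) where
  open Graph G

  -- Splitting off the start vertex leaves a sequence of length `k`, so that the recursion on the
  -- first step follows the recursion of `sequences`.
  walks? : ∀ {k} u v (w : Vec (Fin n) k) → Dec (Linked _∼_ (u ∷ w) × last (u ∷ w) ≡ v)
  walks? u v w = linked? _∼?_ (u ∷ w) ×-dec (last (u ∷ w) Fin.≟ v)

  walks : ℕ → Fin n → Fin n → ℕ
  walks k u v = count (walks? u v) (sequences n k)

  closedWalks≡walks : ∀ k v → closedWalks k G v ≡ walks k v v
  closedWalks≡walks k v = begin
    count (isWalk? G v v) (sequences n (suc k))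
      ≡⟨ count-product (isWalk? G v v) _∷_ id (sequences n k) ⟩
    ∑ᶠ (λ a → count (isWalk? G v v ∘ (a ∷_)) (sequences n k))
      ≡⟨ ∑ᶠ-only v (λ a a≢v → count-none (isWalk? G v v ∘ (a ∷_)) (λ w (_ , a≡v , _) → a≢v a≡v) (sequences n k)) ⟩
    count (isWalk? G v v ∘ (v ∷_)) (sequences n k)
      ≡⟨ count-⇔ (isWalk? G v v ∘ (v ∷_)) (walks? v v) (λ w (l , _ , e) → l , e) (λ w (l , e) → l , refl , e) (sequences n k) ⟩
    walks k v v ∎
    where open ≡-Reasoning

  walks-zero : ∀ u v → walks 0 u v ≡ indicator (u Fin.≟ v)
  walks-zero u v = trans (count-∷ (walks? u v) [] []) (trans (+-identityʳ _)
    (indicator-⇔ (walks? u v []) (u Fin.≟ v) proj₂ ([-] ,_)))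

  walks-suc : ∀ k u v → walks (suc k) u v ≡ ∑ᶠ (λ z → indicator (u ∼? z) * walks k z v)
  walks-suc k u v = trans (count-product (walks? u v) _∷_ id (sequences n k)) (sum-cong-≗ λ z → step z (u ∼? z))
    where
    step : ∀ z (d : Dec (u ∼ z)) → count (walks? u v ∘ (z ∷_)) (sequences n k) ≡ indicator d * walks k z v
    step z (yes u∼z) = trans (count-⇔ (walks? u v ∘ (z ∷_)) (walks? z v)
            (λ { w (_ ∷ l , e) → l , trans (sym (last-∷ u (z ∷ w))) e })
            (λ w (l , e) → u∼z ∷ l , trans (last-∷ u (z ∷ w)) e) (sequences n k)) (sym (+-identityʳ _))
    step z (no u≁z) = count-none (walks? u v ∘ (z ∷_)) (λ { w (u∼z ∷ _ , _) → u≁z u∼z }) (sequences n k)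

-- From a breadth-first ordering to a code

≥-totalOrder : TotalOrder 0ℓ 0ℓ 0ℓ
≥-totalOrder = DecTotalOrder.totalOrder (Flip.decTotalOrder ≤-decTotalOrder)

module Sort = DataListSort (Flip.decTotalOrder ≤-decTotalOrder)

sum-take-tabulate : ∀ {n r} → r ≤ n → ∀ g → sum (take r (tabulate {n = n} (g ∘ toℕ))) ≡ ∑ r g
sum-take-tabulate z≤n g = refl
sum-take-tabulate (s≤s {r} r≤n) g = trans (cong (g 0 +_) (sum-take-tabulate r≤n (g ∘ suc))) (sym (∑-suc r g))

sum-filter-tabulate : ∀ {A : Set} {P : Pred A 0ℓ} (P? : Decidable P) (f : A → ℕ) {n} (g : Fin n → A) →
  sum (List.map f (filter P? (tabulate g))) ≡ ∑ᶠ (λ i → indicator (P? (g i)) * f (g i))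
sum-filter-tabulate P? f {zero} g = refl
sum-filter-tabulate P? f {suc n} g with P? (g Fin.zero)
... | yes _ = cong₂ _+_ (sym (*-identityˡ _)) (sum-filter-tabulate P? f (g ∘ Fin.suc))
... | no _ = sum-filter-tabulate P? f (g ∘ Fin.suc)

∑ᶠ-≥ : ∀ {n} {f : Fin n → ℕ} i → f i ≤ ∑ᶠ f
∑ᶠ-≥ Fin.zero = m≤m+n _ _
∑ᶠ-≥ (Fin.suc i) = ≤-trans (∑ᶠ-≥ i) (m≤n+m _ _)

module Ordered {n : ℕ} (T : RootedTree n) {_≺_ : Rel (Fin n) 0ℓ} (bfs : IsBFSOrdering T _≺_)
  (level-degree : ∀ {u v} → RootedTree.h T v ≡ suc (RootedTree.h T u) → RootedTree.d T v ≤ RootedTree.d T u) where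
  open RootedTree T
  open IsBFSOrdering bfs
  open IsStrictTotalOrder isStrictTotalOrder using () renaming (_<?_ to _≺?_; irrefl to ≺-irrefl; trans to ≺-trans; compare to ≺-compare)
  open Levels T

  position-∑ : ∀ v → position v ≡ ∑ᶠ (λ i → indicator (i ≺? v))
  position-∑ v = count-tabulate (_≺? v) id

  indicator-mono : ∀ {P Q : Set} (P? : Dec P) (Q? : Dec Q) → (P → Q) → indicator P? ≤ indicator Q?
  indicator-mono (yes p) Q? f = ≤-reflexive (sym (indicator-yes Q? (f p)))
  indicator-mono (no _) Q? f = z≤n

  module _ {P : Pred (Fin n) 0ℓ} (P? : Decidable P) where

    position<count : ∀ {v} → (∀ {i} → i ≺ v → P i) → P v → position v < ∑ᶠ (indicator ∘ P?)
    position<count {v} below Pv = subst (_< ∑ᶠ (indicator ∘ P?)) (sym (position-∑ v))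
      (∑ᶠ-mono-< (λ i → indicator-mono (i ≺? v) (P? i) below) v
        (subst₂ _<_ (sym (indicator-no (v ≺? v) (≺-irrefl refl))) (sym (indicator-yes (P? v) Pv)) z<s))

    count≤position : ∀ {v} → (∀ {i} → P i → i ≺ v) → ∑ᶠ (indicator ∘ P?) ≤ position v
    count≤position {v} above = subst (∑ᶠ (indicator ∘ P?) ≤_) (sym (position-∑ v))
      (∑ᶠ-mono-≤ λ i → indicator-mono (P? i) (i ≺? v) above)

  ≺⇒< : ∀ {u v} → u ≺ v → position u < position v
  ≺⇒< {u} {v} u≺v = subst (position u <_) (sym (position-∑ v)) (position<count (_≺? v) (λ i≺u → ≺-trans i≺u u≺v) u≺v)

  <⇒≺ : ∀ {u v} → position u < position v → u ≺ v
  <⇒≺ {u} {v} p<q with ≺-compare u v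
  ... | tri< u≺v _ _ = u≺v
  ... | tri≈ _ refl _ = contradiction p<q (<-irrefl refl)
  ... | tri> _ _ v≺u = contradiction (≺⇒< v≺u) (<-asym p<q)

  position<n : ∀ v → position v < n
  position<n v = subst₂ _<_ (sym (position-∑ v)) (∑ᶠ-one n)
    (∑ᶠ-mono-< (λ i → indicator≤1 (i ≺? v)) v (subst (_< 1) (sym (indicator-no (v ≺? v) (≺-irrefl refl))) z<s))

  position-injective : ∀ {u v} → position u ≡ position v → u ≡ v
  position-injective {u} {v} p≡q with ≺-compare u v
  ... | tri< u≺v _ _ = contradiction p≡q (<⇒≢ (≺⇒< u≺v))
  ... | tri≈ _ u≡v _ = u≡v
  ... | tri> _ _ v≺u = contradiction (sym p≡q) (<⇒≢ (≺⇒< v≺u))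

  pos : Fin n → Fin n
  pos v = fromℕ< (position<n v)

  toℕ-pos : ∀ v → toℕ (pos v) ≡ position v
  toℕ-pos v = Fin.toℕ-fromℕ< (position<n v)

  pos-injective : Injective _≡_ _≡_ pos
  pos-injective {u} {v} eq = position-injective (trans (sym (toℕ-pos u)) (trans (cong toℕ eq) (toℕ-pos v)))

  vtx : Fin n → Fin n
  vtx i = proj₁ (injective⇒surjective pos-injective i)

  pos-vtx : ∀ i → pos (vtx i) ≡ i
  pos-vtx i = proj₂ (injective⇒surjective pos-injective i)

  vtx-pos : ∀ v → vtx (pos v) ≡ v
  vtx-pos v = pos-injective (pos-vtx (pos v))

  position-vtx : ∀ i → position (vtx i) ≡ toℕ i
  position-vtx i = trans (sym (toℕ-pos (vtx i))) (cong toℕ (pos-vtx i))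

  ordering : Permutation n n
  ordering = permutation pos vtx pos-vtx vtx-pos

  reindex : ∀ (g : ℕ → ℕ) → ∑ᶠ (g ∘ position) ≡ ∑ n g
  reindex g = trans (sum-cong-≗ (λ v → cong g (sym (toℕ-pos v))))
    (trans (sym (sum-permute (g ∘ toℕ) ordering)) (∑ᶠ-toℕ n g))

  -- The default value 0 keeps a nonincreasing function nonincreasing past the last vertex, and
  -- makes the code vanish from `n` on.
  at : (Fin n → ℕ) → ℕ → ℕ
  at f x with x <? n
  ... | yes x<n = f (vtx (fromℕ< x<n))
  ... | no _ = 0

  at-position : ∀ f v → at f (position v) ≡ f v
  at-position f v with position v <? n
  ... | yes p<n = cong f (trans (cong vtx (Fin.fromℕ<-cong _ _ refl p<n (position<n v))) (vtx-pos v))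
  ... | no p≮n = contradiction (position<n v) p≮n

  at-beyond : ∀ f {x} → n ≤ x → at f x ≡ 0
  at-beyond f {x} n≤x with x <? n
  ... | yes x<n = contradiction x<n (≤⇒≯ n≤x)
  ... | no _ = refl

  vertexAt : ∀ {x} → x < n → ∃[ v ] position v ≡ x
  vertexAt x<n = vtx (fromℕ< x<n) , trans (position-vtx _) (Fin.toℕ-fromℕ< x<n)

  Decreasing : (Fin n → ℕ) → Set
  Decreasing f = ∀ {u v} → u ≺ v → f v ≤ f u

  at-antitone : ∀ {f} → Decreasing f → Antitone (at f)
  at-antitone {f} dec {y} {z} y≤z with z <? n
  ... | no _ = z≤n
  ... | yes z<n with vertexAt z<n | vertexAt (≤-<-trans y≤z z<n)
  ...   | v , refl | u , refl = subst (_≤ at f (position u))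
            (cong f (trans (sym (vtx-pos v)) (cong vtx (Fin.fromℕ<-cong _ _ refl (position<n v) z<n))))
            (subst (f v ≤_) (sym (at-position f u)) (by-order (m≤n⇒m<n∨m≡n y≤z)))
    where
    by-order : position u < position v ⊎ position u ≡ position v → f v ≤ f u
    by-order (inj₁ p<q) = dec (<⇒≺ p<q)
    by-order (inj₂ p≡q) = ≤-reflexive (cong f (sym (position-injective p≡q)))

  vtx-injective : ∀ {i j} → vtx i ≡ vtx j → i ≡ j
  vtx-injective {i} {j} eq = trans (sym (pos-vtx i)) (trans (cong pos eq) (pos-vtx j))

  allFin-↭ : allFin n ↭ List.map vtx (allFin n)
  allFin-↭ = ∼bag⇒↭ (unique∧set⇒bag (Unique.allFin⁺ n) (Unique.map⁺ vtx-injective (Unique.allFin⁺ n))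
    (λ {v} → mk⇔ (λ _ → subst (_∈ List.map vtx (allFin n)) (vtx-pos v) (∈-map⁺ vtx (∈-allFin (pos v)))) (λ _ → ∈-allFin v)))

  -- Listing `f` in the breadth-first order is already sorted, and two sorted permutations of one
  -- list coincide.
  sort↓-↭ : ∀ {f} → Decreasing f → ∀ {L} → L ↭ List.map f (allFin n) → sort↓ L ≡ tabulate (f ∘ vtx)
  sort↓-↭ {f} dec {L} L↭ = ≋⇒≡ (↗↭↗⇒≋ ≥-totalOrder (Sort.sort-↗ L)
    (AllPairs⇒Sorted ≥-totalOrder (AllPairs.tabulate⁺-< λ {i} {j} i<j →
      dec (<⇒≺ (subst₂ _<_ (sym (position-vtx i)) (sym (position-vtx j)) i<j))))
    (↭⇒↭ₛ (↭-trans (Sort.sort-↭ L) (↭-trans L↭ (subst (List.map f (allFin n) ↭_)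
      (trans (cong (List.map f) (map-tabulate id vtx)) (map-tabulate vtx f)) (map⁺ f allFin-↭))))))

  prefix-sum : ∀ {f} → Decreasing f → ∀ {L} → L ↭ List.map f (allFin n) → ∀ {r} → r ≤ n →
    sum (take r (sort↓ L)) ≡ ∑ r (at f)
  prefix-sum {f} dec L↭ {r} r≤n = trans (cong (sum ∘ take r)
    (trans (sort↓-↭ dec L↭) (tabulate-cong λ i → sym (trans (cong (at f) (sym (position-vtx i))) (at-position f (vtx i))))))
    (sum-take-tabulate r≤n (at f))

  sum-firstVertices : ∀ f {r} → r ≤ n → sum (List.map f (firstVertices r)) ≡ ∑ r (at f)
  sum-firstVertices f {r} r≤n = begin
    sum (List.map f (filter (λ v → position v <? r) (allFin n)))
      ≡⟨ sum-filter-tabulate (λ v → position v <? r) f id ⟩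
    ∑ᶠ (λ v → indicator (position v <? r) * f v)
      ≡⟨ sum-cong-≗ (λ v → cong (indicator (position v <? r) *_) (sym (at-position f v))) ⟩
    ∑ᶠ (λ v → indicator (position v <? r) * at f (position v))
      ≡⟨ reindex (λ x → indicator (x <? r) * at f x) ⟩
    ∑ n g
      ≡⟨ trans (cong (λ m → ∑ m g) (sym (m+[n∸m]≡n r≤n))) (∑-split r (n ∸ r) g) ⟩
    ∑ r g + ∑ (n ∸ r) (λ j → g (r + j))
      ≡⟨ cong₂ _+_ (∑-cong r λ x x<r → trans (cong (_* at f x) (indicator-yes (x <? r) x<r)) (*-identityˡ _))
           (∑-zero (n ∸ r) λ j _ → cong (_* at f (r + j)) (indicator-no (r + j <? r) (≤⇒≯ (m≤m+n r j)))) ⟩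
    ∑ r (at f) + 0
      ≡⟨ +-identityʳ _ ⟩
    ∑ r (at f) ∎
    where
    open ≡-Reasoning
    g : ℕ → ℕ
    g x = indicator (x <? r) * at f x

  deeper-degree : ∀ {u} j {v} → h v ≡ j → h u < j → d v ≤ d u
  deeper-degree {u} (suc j) {v} hv≡ (s≤s hu≤j) with m≤n⇒m<n∨m≡n hu≤j
  ... | inj₂ refl = level-degree hv≡
  ... | inj₁ hu<j with father-exists hv≡
  ...   | p , (_ , hv≡′) , hp≡j = ≤-trans (level-degree hv≡′) (deeper-degree j hp≡j hu<j)

  degree-decreasing : Decreasing d
  degree-decreasing {u} {v} u≺v with <-cmp (h u) (h v)
  ... | tri< hu<hv _ _ = deeper-degree (h v) refl hu<hv
  ... | tri≈ _ hu≡hv _ = degree-≥ u≺v hu≡hv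
  ... | tri> _ _ hv<hu = contradiction (≺-trans u≺v (level-≺ hv<hu)) (≺-irrefl refl)

  ρ : ℕ → ℕ
  ρ y = at d y ∸ 1

  -- 0 for the root, and otherwise one more than the position of the father.
  fatherRank : Fin n → ℕ
  fatherRank v with v Fin.≟ root
  ... | yes _ = 0
  ... | no v≢root = suc (position (proj₁ (fatherOf v≢root)))

  fatherRank-root : fatherRank root ≡ 0
  fatherRank-root with root Fin.≟ root
  ... | yes _ = refl
  ... | no root≢root = contradiction refl root≢root

  fatherRank-father : ∀ {p v} → IsFather p v → fatherRank v ≡ suc (position p)
  fatherRank-father {p} {v} pf with v Fin.≟ root
  ... | yes refl = contradiction pf root-fatherless
  ... | no v≢root = cong (suc ∘ position) (father-unique (proj₂ (fatherOf v≢root)) pf)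

  rootOrFather : ∀ v → v ≡ root ⊎ ∃[ p ] IsFather p v
  rootOrFather v with v Fin.≟ root
  ... | yes v≡root = inj₁ v≡root
  ... | no v≢root = inj₂ (fatherOf v≢root)

  fatherRank⇒father : ∀ {p v} → fatherRank v ≡ suc (position p) → IsFather p v
  fatherRank⇒father {p} {v} eq with rootOrFather v
  ... | inj₁ refl = contradiction (trans (sym fatherRank-root) eq) λ ()
  ... | inj₂ (q , qf) = subst (λ w → IsFather w v)
    (position-injective (suc-injective (trans (sym (fatherRank-father qf)) eq))) qf

  root≺ : ∀ {v} → v ≢ root → root ≺ v
  root≺ {v} v≢root = level-≺ (subst (_< h v) (sym h-root) (n≢0⇒n>0 (v≢root ∘ h≡0⇒root)))

  position-root : position root ≡ 0
  position-root = trans (position-∑ root) (∑ᶠ-zero λ i → indicator-no (i ≺? root) (¬≺root i))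
    where
    ¬≺root : ∀ i → ¬ i ≺ root
    ¬≺root i i≺root with i Fin.≟ root
    ... | yes refl = ≺-irrefl refl i≺root
    ... | no i≢root = ≺-irrefl refl (≺-trans i≺root (root≺ i≢root))

  fatherRank-mono : ∀ {u v} → u ≺ v → fatherRank u ≤ fatherRank v
  fatherRank-mono {u} {v} u≺v with rootOrFather u | rootOrFather v
  ... | inj₁ refl | _ = ≤-trans (≤-reflexive fatherRank-root) z≤n
  ... | inj₂ _ | inj₁ refl = contradiction (≺⇒< u≺v) (subst (λ x → ¬ position u < x) (sym position-root) λ ())
  ... | inj₂ (p , pf) | inj₂ (q , qf) = subst₂ _≤_ (sym (fatherRank-father pf)) (sym (fatherRank-father qf)) (s≤s p≤q)
    where
    p≤q : position p ≤ position q
    p≤q with <-cmp (h u) (h v)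
    ... | tri< hu<hv _ _ = <⇒≤ (≺⇒< (level-≺ (s≤s⁻¹ (subst₂ _<_ (proj₂ pf) (proj₂ qf) hu<hv))))
    ... | tri> _ _ hv<hu = contradiction (≺-trans u≺v (level-≺ hv<hu)) (≺-irrefl refl)
    ... | tri≈ _ hu≡hv _ with father-≼ u≺v hu≡hv pf qf
    ...   | inj₁ refl = ≤-refl
    ...   | inj₂ p≺q = <⇒≤ (≺⇒< p≺q)

  adjacent-indicator : ∀ u v → indicator (u ∼? v) ≡ indicator (isFather? u v) + indicator (isFather? v u)
  adjacent-indicator u v = cases (isFather? u v) (isFather? v u)
    where
    cases : (f : Dec (IsFather u v)) (g : Dec (IsFather v u)) → indicator (u ∼? v) ≡ indicator f + indicator g
    cases (yes (_ , hv≡)) (yes (_ , hu≡)) =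
      contradiction (≤-reflexive (trans (cong suc (sym hv≡)) (sym hu≡))) (<⇒≱ (m≤n⇒m≤1+n (n<1+n (h u))))
    cases (yes (u∼v , _)) (no _) = indicator-yes (u ∼? v) u∼v
    cases (no _) (yes (v∼u , _)) = indicator-yes (u ∼? v) (symm v∼u)
    cases (no ¬uf) (no ¬vf) = indicator-no (u ∼? v) λ u∼v → [ ¬uf , ¬vf ]′ (adjacent⇒father u∼v)

  childCount : Fin n → ℕ
  childCount p = ∑ᶠ (λ v → indicator (isFather? p v))

  degree-split : ∀ p → d p ≡ childCount p + ∑ᶠ (λ v → indicator (isFather? v p))
  degree-split p = trans (count-tabulate (p ∼?_) id)
    (trans (sum-cong-≗ (adjacent-indicator p)) (∑-distrib-+ (λ v → indicator (isFather? p v)) (λ v → indicator (isFather? v p))))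

  degree-root : d root ≡ childCount root
  degree-root = trans (degree-split root)
    (trans (cong (childCount root +_) (∑ᶠ-zero λ v → indicator-no (isFather? v root) root-fatherless)) (+-identityʳ _))

  degree-nonroot : ∀ {p} → p ≢ root → d p ≡ suc (childCount p)
  degree-nonroot {p} p≢root with fatherOf p≢root
  ... | q , qf = trans (degree-split p) (trans (cong (childCount p +_)
    (trans (∑ᶠ-only q λ v v≢q → indicator-no (isFather? v p) λ vf → v≢q (father-unique vf qf)) (indicator-yes (isFather? q p) qf)))
    (+-comm (childCount p) 1))

  -- Only the tree with one vertex has a root of degree 0.
  module _ (2≤n : 2 ≤ n) where

    neighbour : ∀ {k v} (w : Vec (Fin n) (suc k)) → Linked _∼_ w → head w ≡ root → last w ≡ v → v ≢ root → ∃[ u ] root ∼ u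
    neighbour (x ∷ []) _ x≡root x≡v v≢root = contradiction (trans (sym x≡v) x≡root) v≢root
    neighbour (x ∷ y ∷ w) (x∼y ∷ _) refl _ _ = y , x∼y

    1≤degree-root : 1 ≤ d root
    1≤degree-root with vertexAt 2≤n
    ... | v , pv≡1 with IsTree.connected isTree root v
    ...   | k , w , l , w₀ , wₗ with neighbour w l w₀ wₗ (λ { refl → 1+n≢0 (trans (sym pv≡1) position-root) })
    ...     | u , root∼u = subst₂ _≤_ (indicator-yes (root ∼? u) root∼u) (sym (count-tabulate (root ∼?_) id))
                (∑ᶠ-≥ {f = λ i → indicator (root ∼? i)} u)

    1≤degree : ∀ v → 1 ≤ d v
    1≤degree v with v Fin.≟ root
    ... | yes refl = 1≤degree-root
    ... | no v≢root = subst (1 ≤_) (sym (degree-nonroot v≢root)) (s≤s z≤n)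

    -- Degrees are positive, so nothing is lost in `∸ 1`. The correction by `y` is the same for both
    -- trees, so partial sums of degrees can be compared through `lo`.
    lo-degrees : ∀ {y} → y ≤ n → lo ρ y + y ≡ 2 + ∑ y (at d)
    lo-degrees {zero} _ = refl
    lo-degrees {suc y} y<n = begin
      lo ρ y + (at d y ∸ 1) + suc y    ≡⟨ regroup (lo ρ y) (at d y ∸ 1) y ⟩
      lo ρ y + y + suc (at d y ∸ 1)    ≡⟨ cong₂ _+_ (lo-degrees (<⇒≤ y<n)) (m+[n∸m]≡n (1≤at (vertexAt y<n))) ⟩
      2 + ∑ y (at d) + at d y          ∎
      where
      open ≡-Reasoning
      regroup : ∀ a b c → a + b + suc c ≡ a + c + suc b
      regroup = solve-∀
      1≤at : ∀ {x} → ∃[ v ] position v ≡ x → 1 ≤ at d x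
      1≤at (v , refl) = subst (1 ≤_) (sym (at-position d v)) (1≤degree v)

    size-childCount : ∀ p → size true ρ (position p) ≡ childCount p
    size-childCount p with p Fin.≟ root
    ... | no p≢root with position p in eq
    ...   | zero = contradiction (position-injective (trans eq (sym position-root))) p≢root
    ...   | suc y = trans (cong (_∸ 1) (trans (cong (at d) (sym eq)) (at-position d p))) (cong (_∸ 1) (degree-nonroot p≢root))
    size-childCount p | yes refl = begin
      size true ρ (position root)      ≡⟨ cong (size true ρ) position-root ⟩
      suc (at d 0 ∸ 1)                 ≡⟨ cong (λ x → suc (x ∸ 1)) (trans (cong (at d) (sym position-root)) (at-position d root)) ⟩
      suc (d root ∸ 1)                 ≡⟨ m+[n∸m]≡n 1≤degree-root ⟩
      d root                           ≡⟨ degree-root ⟩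
      childCount root ∎
      where
      open ≡-Reasoning

    -- The vertices counted are the root and the children of the vertices before position `y`. They
    -- form an initial segment because `fatherRank` is monotone, so their number is the position
    -- where the row of `y` starts.
    rank≤ : ℕ → ℕ
    rank≤ y = ∑ᶠ (λ v → indicator (fatherRank v ≤? y))

    rank≤-suc : ∀ p → rank≤ (suc (position p)) ≡ rank≤ (position p) + childCount p
    rank≤-suc p = trans (sum-cong-≗ split)
      (∑-distrib-+ (λ v → indicator (fatherRank v ≤? position p)) (λ v → indicator (isFather? p v)))
      where
      split : ∀ v → indicator (fatherRank v ≤? suc (position p)) ≡
                    indicator (fatherRank v ≤? position p) + indicator (isFather? p v)
      split v with <-cmp (fatherRank v) (suc (position p))
      ... | tri< r< _ _ = trans (indicator-yes (fatherRank v ≤? suc (position p)) (<⇒≤ r<))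
              (sym (cong₂ _+_ (indicator-yes (fatherRank v ≤? position p) (s≤s⁻¹ r<))
                              (indicator-no (isFather? p v) λ pf → <⇒≢ r< (fatherRank-father pf))))
      ... | tri≈ _ r≡ _ = trans (indicator-yes (fatherRank v ≤? suc (position p)) (≤-reflexive r≡))
              (sym (cong₂ _+_ (indicator-no (fatherRank v ≤? position p) (<⇒≱ (≤-reflexive (sym r≡))))
                              (indicator-yes (isFather? p v) (fatherRank⇒father r≡))))
      ... | tri> _ _ r> = trans (indicator-no (fatherRank v ≤? suc (position p)) (<⇒≱ r>))
              (sym (cong₂ _+_ (indicator-no (fatherRank v ≤? position p) (<⇒≱ (<-trans (n<1+n _) r>)))
                              (indicator-no (isFather? p v) λ pf → <⇒≢ r> (sym (fatherRank-father pf)))))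

    rank≤-start : ∀ y → y ≤ n → rank≤ y ≡ start true ρ y
    rank≤-start zero _ = trans (∑ᶠ-only root λ v v≢root → indicator-no (fatherRank v ≤? 0)
      λ r≤0 → v≢root (rank0 v (n≤0⇒n≡0 r≤0))) (indicator-yes (fatherRank root ≤? 0) (≤-reflexive fatherRank-root))
      where
      rank0 : ∀ v → fatherRank v ≡ 0 → v ≡ root
      rank0 v r≡0 with rootOrFather v
      ... | inj₁ v≡root = v≡root
      ... | inj₂ (p , pf) = contradiction (trans (sym (fatherRank-father pf)) r≡0) λ ()
    rank≤-start (suc y) y<n = trans (by-vertex (vertexAt y<n))
      (trans (cong (_+ size true ρ y) (rank≤-start y (<⇒≤ y<n))) (start+size true ρ y))
      where
      by-vertex : ∃[ p ] position p ≡ y → rank≤ (suc y) ≡ rank≤ y + size true ρ y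
      by-vertex (p , refl) = trans (rank≤-suc p) (cong (rank≤ (position p) +_) (sym (size-childCount p)))

    before-start : ∀ {v y} → y ≤ n → fatherRank v ≤ y → position v < start true ρ y
    before-start {v} {y} y≤n r≤y = subst (position v <_) (rank≤-start y y≤n)
      (position<count (λ i → fatherRank i ≤? y) (λ i≺v → ≤-trans (fatherRank-mono i≺v) r≤y) r≤y)

    after-start : ∀ {v y} → y ≤ n → y < fatherRank v → start true ρ y ≤ position v
    after-start {v} {y} y≤n y<r = subst (_≤ position v) (rank≤-start y y≤n)
      (count≤position (λ i → fatherRank i ≤? y) below)
      where
      below : ∀ {i} → fatherRank i ≤ y → i ≺ v
      below {i} r≤y with ≺-compare i v
      ... | tri< i≺v _ _ = i≺v
      ... | tri≈ _ refl _ = contradiction r≤y (<⇒≱ y<r)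
      ... | tri> _ _ v≺i = contradiction (≤-trans (fatherRank-mono v≺i) r≤y) (<⇒≱ y<r)

    -- Identifies the given tree with the tree of its code: the children of `p` lie between the
    -- starts of two successive rows, and nothing else does.
    father-indicator : ∀ p v → father ρ (position p) (position v) ≡ indicator (isFather? p v)
    father-indicator p v = indicator-⇔ (inRow? ρ (position p) (position v)) (isFather? p v)
      (λ (s≤ , <lo) → fatherRank⇒father (≤-antisym
        (≮⇒≥ λ r> → <⇒≱ <lo (after-start (position<n p) r>))
        (≰⇒> λ r≤ → <⇒≱ (before-start (<⇒≤ (position<n p)) r≤) s≤)))
      (λ pf → after-start (<⇒≤ (position<n p)) (≤-reflexive (sym (fatherRank-father pf)))
            , before-start (position<n p) (≤-reflexive (fatherRank-father pf)))

    fatherRank≤n : ∀ v → fatherRank v ≤ n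
    fatherRank≤n v with v Fin.≟ root
    ... | yes _ = z≤n
    ... | no v≢root = position<n _

    treeCode : TreeCode n ρ
    treeCode = record
      { anti = λ y≤z → ∸-monoˡ-≤ 1 (at-antitone degree-decreasing y≤z)
      ; ρ≡0 = λ n≤y → cong (_∸ 1) (at-beyond d n≤y)
      ; lo≡n = trans (sym (start≡lo (≤-trans (s≤s z≤n) 2≤n))) (trans (sym (rank≤-start n ≤-refl))
          (trans (sum-cong-≗ λ v → indicator-yes (fatherRank v ≤? n) (fatherRank≤n v)) (∑ᶠ-one n))) }
      where
      start≡lo : ∀ {y} → 1 ≤ y → start true ρ y ≡ lo ρ y
      start≡lo {suc y} _ = refl

    module CW = CodeWalks treeCode
    open ClosedWalks graph

    walks≡N : ∀ k u v → walks k u v ≡ CW.N (position u) (position v) k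
    walks≡N zero u v = trans (walks-zero u v) (by-eq (u Fin.≟ v))
      where
      by-eq : (e : Dec (u ≡ v)) → indicator e ≡ single (position v) 1 (position u)
      by-eq (yes refl) = sym (single-≡ (position u) 1)
      by-eq (no u≢v) = sym (single-≢ 1 λ p≡q → u≢v (position-injective (sym p≡q)))
    walks≡N (suc k) u v = begin
      walks (suc k) u v
        ≡⟨ walks-suc k u v ⟩
      ∑ᶠ (λ z → indicator (u ∼? z) * walks k z v)
        ≡⟨ sum-cong-≗ (λ z → cong₂ _*_ (trans (adjacent-indicator u z)
             (sym (cong₂ _+_ (father-indicator u z) (father-indicator z u)))) (walks≡N k z v)) ⟩
      ∑ᶠ (λ z → CW.A (position u) (position z) * CW.N (position z) (position v) k)
        ≡⟨ reindex (λ z → CW.A (position u) z * CW.N z (position v) k) ⟩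
      ∑ n (λ z → CW.A (position u) z * CW.N z (position v) k) ∎
      where open ≡-Reasoning

    closedWalks≡N : ∀ k v → closedWalks k graph v ≡ CW.N (position v) (position v) k
    closedWalks≡N k v = trans (closedWalks≡walks k v) (walks≡N k v v)

    -- With this the breadth-first order is a sorted order for `C` as well, so the sums of largest
    -- entries in `⊲w` become sums over the first vertices.
    closedWalks-decreasing : ∀ k → Decreasing (closedWalks k graph)
    closedWalks-decreasing k {u} {v} u≺v = subst₂ _≤_ (sym (closedWalks≡N k v)) (sym (closedWalks≡N k u))
      (descend (<⇒≤ (≺⇒< u≺v)) (position<n v))
      where
      descend : ∀ {i j} → i ≤ j → j < n → CW.N j j k ≤ CW.N i i k
      descend {i} {j} i≤j j<n with m≤n⇒m<n∨m≡n i≤j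
      ... | inj₂ refl = ≤-refl
      descend {i} {suc j} i≤j j<n | inj₁ (s≤s i≤j′) =
        ≤-trans (CW.closed-walks-anti-suc j<n k) (descend i≤j′ (<-trans (n<1+n j) j<n))

    sum-closedWalks : ∀ k {r} → r ≤ n → ∑ r (at (closedWalks k graph)) ≡ ∑ r (λ w → CW.N w w k)
    sum-closedWalks k {r} r≤n = ∑-cong r λ w w<r → by-vertex (vertexAt (<-≤-trans w<r r≤n))
      where
      by-vertex : ∀ {w} → ∃[ v ] position v ≡ w → at (closedWalks k graph) w ≡ CW.N w w k
      by-vertex (v , refl) = trans (at-position (closedWalks k graph) v) (closedWalks≡N k v)

-- Comparison of the two greedy trees

open RootedTree using (graph)
open IsBFSOrdering using (firstVertices)

toList-tabulate : ∀ {n} (f : Fin n → ℕ) → toList (Vec.tabulate f) ≡ map f (allFin n)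
toList-tabulate {n} f = trans (as-list f) (sym (map-tabulate id f))
  where
  as-list : ∀ {n} (f : Fin n → ℕ) → toList (Vec.tabulate f) ≡ List.tabulate f
  as-list {zero} f = refl
  as-list {suc n} f = cong (f Fin.zero List.∷_) (as-list (f ∘ Fin.suc))

module _ {n : ℕ} {π π′ : Vec ℕ n} (π⊲π′ : π ⊲w π′) {T T′ : RootedTree n}
  (degrees : HasDegreeSequence (graph T) π) (degrees′ : HasDegreeSequence (graph T′) π′)
  {_≺_ _≺′_ : Rel (Fin n) 0ℓ} (bfs : IsBFSOrdering T _≺_) (bfs′ : IsBFSOrdering T′ _≺′_)
  (level-degree : ∀ {u v} → RootedTree.h T v ≡ suc (RootedTree.h T u) → RootedTree.d T v ≤ RootedTree.d T u)
  (level-degree′ : ∀ {u v} → RootedTree.h T′ v ≡ suc (RootedTree.h T′ u) → RootedTree.d T′ v ≤ RootedTree.d T′ u) where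
  private
    module O = Ordered T bfs level-degree
    module O′ = Ordered T′ bfs′ level-degree′

  degree-prefix-≤ : ∀ {y} → y ≤ n → ∑ y (O.at (degree (graph T))) ≤ ∑ y (O′.at (degree (graph T′)))
  degree-prefix-≤ {zero} _ = z≤n
  degree-prefix-≤ {suc y} y<n = subst₂ _≤_
    (O.prefix-sum O.degree-decreasing (proj₂ degrees) y<n) (O′.prefix-sum O′.degree-decreasing (proj₂ degrees′) y<n)
    (subst (λ t → sum (take (suc t) (sort↓ (toList π))) ≤ sum (take (suc t) (sort↓ (toList π′)))) (Fin.toℕ-fromℕ< y<n)
      (π⊲π′ (fromℕ< y<n)))

  lo-≤ : 2 ≤ n → ∀ y → y ≤ n → lo O.ρ y ≤ lo O′.ρ y
  lo-≤ 2≤n y y≤n = +-cancelʳ-≤ y _ _ (subst₂ _≤_ (sym (O.lo-degrees 2≤n y≤n)) (sym (O′.lo-degrees 2≤n y≤n))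
    (+-monoʳ-≤ 2 (degree-prefix-≤ y≤n)))

  module _ (2≤n : 2 ≤ n) (k : ℕ) where

    prefix-≤ : ∀ {r} → r ≤ n → ∑ r (O.at (closedWalks k (graph T))) ≤ ∑ r (O′.at (closedWalks k (graph T′)))
    prefix-≤ r≤n = subst₂ _≤_ (sym (O.sum-closedWalks 2≤n k r≤n)) (sym (O′.sum-closedWalks 2≤n k r≤n))
      (closed-walks-mono (O.treeCode 2≤n) (O′.treeCode 2≤n) (lo-≤ 2≤n) r≤n k)

    weakly-majorized : C k (graph T) ⊲w C k (graph T′)
    weakly-majorized t = subst₂ _≤_
      (sym (O.prefix-sum (O.closedWalks-decreasing 2≤n k) (↭-reflexive (toList-tabulate _)) (Fin.toℕ<n t)))
      (sym (O′.prefix-sum (O′.closedWalks-decreasing 2≤n k) (↭-reflexive (toList-tabulate _)) (Fin.toℕ<n t)))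
      (prefix-≤ (Fin.toℕ<n t))

    firstVertices-≤ : ∀ {r} → r ≤ n →
      sum (map (closedWalks k (graph T)) (firstVertices bfs r)) ≤ sum (map (closedWalks k (graph T′)) (firstVertices bfs′ r))
    firstVertices-≤ r≤n = subst₂ _≤_ (sym (O.sum-firstVertices _ r≤n)) (sym (O′.sum-firstVertices _ r≤n)) (prefix-≤ r≤n)

-- The codes presuppose the vertices 0 and 1, so the tree with one vertex is treated apart: a graph
-- on one vertex has no edge and hence no walk of positive length.
walks-Fin1 : (G G′ : Graph 1) → ∀ k u v → ClosedWalks.walks G k u v ≡ ClosedWalks.walks G′ k u v
walks-Fin1 G G′ zero u v = trans (ClosedWalks.walks-zero G u v) (sym (ClosedWalks.walks-zero G′ u v))
walks-Fin1 G G′ (suc k) u v = trans (isolated G) (sym (isolated G′))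
  where
  all-equal : (u v : Fin 1) → u ≡ v
  all-equal Fin.zero Fin.zero = refl
  isolated : (G : Graph 1) → ClosedWalks.walks G (suc k) u v ≡ 0
  isolated G = trans (ClosedWalks.walks-suc G k u v) (∑ᶠ-zero λ z →
    cong (_* ClosedWalks.walks G k z v) (indicator-no (Graph._∼?_ G u z) (Graph.irrefl G (all-equal u z))))

closedWalks-Fin1 : (G G′ : Graph 1) → ∀ k v → closedWalks k G v ≡ closedWalks k G′ v
closedWalks-Fin1 G G′ k v = trans (ClosedWalks.closedWalks≡walks G k v)
  (trans (walks-Fin1 G G′ k v v) (sym (ClosedWalks.closedWalks≡walks G′ k v)))

module _ {T T′ : RootedTree 1} {_≺_ _≺′_ : Rel (Fin 1) 0ℓ} (bfs : IsBFSOrdering T _≺_) (bfs′ : IsBFSOrdering T′ _≺′_)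
  (level-degree : ∀ {u v} → RootedTree.h T v ≡ suc (RootedTree.h T u) → RootedTree.d T v ≤ RootedTree.d T u)
  (level-degree′ : ∀ {u v} → RootedTree.h T′ v ≡ suc (RootedTree.h T′ u) → RootedTree.d T′ v ≤ RootedTree.d T′ u) where
  private
    module O = Ordered T bfs level-degree
    module O′ = Ordered T′ bfs′ level-degree′

  firstVertices-Fin1 : ∀ k {r} → r ≤ 1 → sum (map (closedWalks k (graph T)) (firstVertices bfs r)) ≡
    sum (map (closedWalks k (graph T′)) (firstVertices bfs′ r))
  firstVertices-Fin1 k {r} r≤1 = trans (O.sum-firstVertices f r≤1)
    (trans (∑-cong r λ { zero _ → at-zero ; (suc j) j<r → contradiction (≤-trans j<r r≤1) λ { (s≤s ()) } })
      (sym (O′.sum-firstVertices f′ r≤1)))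
    where
    f f′ : Fin 1 → ℕ
    f = closedWalks k (graph T)
    f′ = closedWalks k (graph T′)
    at-zero : O.at f 0 ≡ O′.at f′ 0
    at-zero = begin
      O.at f 0                      ≡⟨ cong (O.at f) (n<1⇒n≡0 (O.position<n Fin.zero)) ⟨
      O.at f (IsBFSOrdering.position bfs Fin.zero)     ≡⟨ O.at-position f Fin.zero ⟩
      f Fin.zero                    ≡⟨ closedWalks-Fin1 (graph T) (graph T′) k Fin.zero ⟩
      f′ Fin.zero                   ≡⟨ O′.at-position f′ Fin.zero ⟨
      O′.at f′ (IsBFSOrdering.position bfs′ Fin.zero)  ≡⟨ cong (O′.at f′) (n<1⇒n≡0 (O′.position<n Fin.zero)) ⟩
      O′.at f′ 0 ∎
      where open ≡-Reasoning

theorem2p4 : ∀ {n : ℕ} (π π′ : Vec ℕ n) →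
    IsTreeDegreeSequence π → IsTreeDegreeSequence π′ → π ⊲w π′ →
    (T T′ : RootedTree n) →
    IsGreedy T → HasDegreeSequence (graph T) π →
    IsGreedy T′ → HasDegreeSequence (graph T′) π′ →
    ∀ (k : ℕ) →
    (C k (graph T) ⊲w C k (graph T′)) ×
    (∀ {_≺_ _≺′_ : Rel (Fin n) 0ℓ}
    (bfs : IsBFSOrdering T _≺_) (bfs′ : IsBFSOrdering T′ _≺′_)
    (r : ℕ) → r ≤ n →
    sum (map (closedWalks k (graph T)) (firstVertices bfs r))
    ≤ sum (map (closedWalks k (graph T′)) (firstVertices bfs′ r)))
theorem2p4 {zero} π π′ _ _ _ T T′ _ _ _ _ k = (λ ()) , λ { _ _ zero z≤n → z≤n }
theorem2p4 {suc zero} π π′ _ _ _ T T′ greedy _ greedy′ _ k =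
  (λ t → ≤-reflexive (cong (λ v → sum (take (suc (toℕ t)) (sort↓ (toList v))))
    (Vec.tabulate-cong (closedWalks-Fin1 (graph T) (graph T′) k)))) ,
  λ bfs bfs′ r r≤1 → ≤-reflexive
    (firstVertices-Fin1 bfs bfs′ (IsGreedy.level-degree greedy) (IsGreedy.level-degree greedy′) k r≤1)
theorem2p4 {suc (suc n)} π π′ _ _ π⊲π′ T T′ greedy degrees greedy′ degrees′ k =
  weakly-majorized π⊲π′ degrees degrees′ G.isBFSOrdering G′.isBFSOrdering G.level-degree G′.level-degree 2≤n k ,
  -- These orderings need not be the ones contained in `greedy` and `greedy′`. The degree condition
  -- between levels does not mention the ordering, so it combines with any of them.
  λ bfs bfs′ r r≤n → firstVertices-≤ π⊲π′ degrees degrees′ bfs bfs′ G.level-degree G′.level-degree 2≤n k r≤n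
  where
  module G = IsGreedy greedy
  module G′ = IsGreedy greedy′
  2≤n : 2 ≤ suc (suc n)
  2≤n = s≤s (s≤s z≤n)
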